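{- Let $n,w\ge1$ be integers. Let $\mathrm{CDP}(n,w)$ be the set of integer sequences $(a_1,\dots,a_n)$ with $0\le a_i\le w-1$ and $a_{i+1}\le a_i+1$ for all $1\le i\le n$ (where $a_{n+1}:=a_1$), and let $\alpha$ act on $\mathrm{CDP}(n,w)$ by the cyclic shift $(a_1,\dots,a_n)\mapsto(a_n,a_1,\dots,a_{n-1})$, generating a cyclic group $\langle\alpha\rangle$ of order $n$. Let $|\mathrm{CDP}(n,w)|_q=\sum_{(x_0,\mathbf b)}q^{\mathrm{maj}(\mathbf b)}$, summing over all pairs $(x_0,\mathbf b)$ with $x_0\in\{1,\dots,w\}$, $\mathbf b=(b_1,\dots,b_{2n})\in\{0,1\}^{2n}$ having $n$ zeros and $n$ ones and $b_{2n}=1$, such that the lattice path from $(x_0,0)$ taking an east step $(1,0)$ for each $0$ and a north step $(0,1)$ for each $1$ never visits a lattice point on the lines $y=x$ or $y=x-(w+2)$. Then $(\mathrm{CDP}(n,w),\langle\alpha\rangle,|\mathrm{CDP}(n,w)|_q)$ exhibits the cyclic sieving phenomenon.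
   Context: $\mathrm{maj}(\mathbf b)=\sum\{i: b_i>b_{i+1}\}$. A triple $(X,C_n,f(q))$, with $X$ a finite set, $C_n=\langle g\rangle$ a cyclic group of order $n$ acting on $X$, and $f(q)$ a polynomial with non-negative integer coefficients, exhibits the cyclic sieving phenomenon (CSP) if for every $k\in\{1,\dots,n\}$, $f(\omega_n^k)=|\{x\in X: g^k\cdot x=x\}|$, where $\omega_n=e^{2\pi i/n}$ (in particular $f(1)=|X|$). -}

module Defs where

open import Level using (0ℓ)
open import Data.Bool using (Bool; true; false; _∧_; not; if_then_else_)
open import Data.Nat using (ℕ; zero; suc; _≡ᵇ_; _<ᵇ_; _≤ᵇ_) renaming (_+_ to _+ℕ_)
import Data.Nat
open import Data.Nat.DivMod using (_mod_)
open import Data.Fin using (Fin; toℕ) renaming (zero to fzero; suc to fsuc)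
open import Data.Fin.Properties using (all?)
open import Data.List using (List; []; _∷_; map; concatMap; length; filterᵇ; upTo; allFin)
open import Data.Vec.Functional using () renaming (_∷_ to _◂_)
open import Algebra.Bundles using (CommutativeRing)
open import Data.Product using (_×_)
open import Data.Sum using (_⊎_)
open import Relation.Nullary using (¬_)
open import Relation.Nullary.Decidable using (⌊_⌋)
open import Data.Bool using (T)

-- Cyclic index arithmetic on Fin n (positions 1..n of the paper are
-- Fin n = 0..n-1 here).

sucCyc : ∀ {n} → Fin n → Fin n
sucCyc {suc m} i = suc (toℕ i) mod suc m

predCyc : ∀ {n} → Fin n → Fin n
predCyc {suc m} i = (toℕ i +ℕ m) mod suc m

isCDP : (n w : ℕ) → (Fin n → ℕ) → Bool
isCDP n w a = ⌊ all? (λ i → T? ((a i <ᵇ w) ∧ (a (sucCyc i) ≤ᵇ a i +ℕ 1))) ⌋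
  where open import Relation.Nullary.Decidable using (T?)

α : ∀ {n} → (Fin n → ℕ) → (Fin n → ℕ)
α a i = a (predCyc i)

iter : ∀ {A : Set} → ℕ → (A → A) → A → A
iter zero    f x = x
iter (suc k) f x = f (iter k f x)

eqSeq : ∀ {n} → (Fin n → ℕ) → (Fin n → ℕ) → Bool
eqSeq a b = ⌊ all? (λ i → T? (a i ≡ᵇ b i)) ⌋
  where open import Relation.Nullary.Decidable using (T?)

allFuns : (n w : ℕ) → List (Fin n → Fin w)
allFuns zero    w = (λ ()) ∷ []
allFuns (suc n) w = concatMap (λ x → map (λ f → x ◂ f) (allFuns n w)) (allFin w)

CDP : (n w : ℕ) → List (Fin n → ℕ)
CDP n w = filterᵇ (isCDP n w) (map (λ f i → toℕ (f i)) (allFuns n w))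

fixCount : (n w k : ℕ) → ℕ
fixCount n w k = length (filterᵇ (λ a → eqSeq (iter k α a) a) (CDP n w))

-- The q-count.  false = 0 = east step, true = 1 = north step.

allBools : ℕ → List (List Bool)
allBools zero    = [] ∷ []
allBools (suc m) = concatMap (λ b → map (b ∷_) (allBools m)) (true ∷ false ∷ [])

majFrom : ℕ → List Bool → ℕ
majFrom i (x ∷ y ∷ rest) = (if x ∧ not y then i else 0) +ℕ majFrom (suc i) (y ∷ rest)
majFrom i _ = 0

maj : List Bool → ℕ
maj = majFrom 1

countTrue : List Bool → ℕ
countTrue [] = 0
countTrue (true ∷ bs) = suc (countTrue bs)
countTrue (false ∷ bs) = countTrue bs

lastIsTrue : List Bool → Bool
lastIsTrue [] = false
lastIsTrue (b ∷ []) = b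
lastIsTrue (_ ∷ c ∷ bs) = lastIsTrue (c ∷ bs)

okPoint : ℕ → ℕ → ℕ → Bool
okPoint w x y = not (x ≡ᵇ y) ∧ not (x ≡ᵇ y +ℕ (w +ℕ 2))

avoids : ℕ → ℕ → ℕ → List Bool → Bool
avoids w x y []           = okPoint w x y
avoids w x y (false ∷ bs) = okPoint w x y ∧ avoids w (suc x) y bs
avoids w x y (true  ∷ bs) = okPoint w x y ∧ avoids w x (suc y) bs

validPair : ℕ → ℕ → ℕ → List Bool → Bool
validPair n w x0 b = (countTrue b ≡ᵇ n) ∧ lastIsTrue b ∧ avoids w x0 0 b

-- multiset of exponents maj(b) over all valid pairs (x0,b),
-- x0 ∈ {1,…,w}, b ∈ {0,1}^{2n}; |CDP(n,w)|_q = Σ_{e ∈ qExps n w} q^e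
qExps : ℕ → ℕ → List ℕ
qExps n w = concatMap (λ x0 → map maj (filterᵇ (validPair n w x0) (allBools (n +ℕ n))))
                      (map suc (upTo w))

module _ (R : CommutativeRing 0ℓ 0ℓ) where
  open CommutativeRing R

  pow : Carrier → ℕ → Carrier
  pow x zero    = 1#
  pow x (suc k) = x * pow x k

  natR : ℕ → Carrier
  natR zero    = 0#
  natR (suc k) = 1# + natR k

  evalExps : List ℕ → Carrier → Carrier
  evalExps []       x = 0#
  evalExps (e ∷ es) x = pow x e + evalExps es x

  IsIntDomainChar0 : Set
  IsIntDomainChar0 = (∀ x y → x * y ≈ 0# → x ≈ 0# ⊎ y ≈ 0#)
                   × (∀ m → ¬ (natR (suc m) ≈ 0#))

  IsPrimitiveRoot : ℕ → Carrier → Set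
  IsPrimitiveRoot n ω = (pow ω n ≈ 1#)
                      × (∀ j → 0 Data.Nat.< j → j Data.Nat.< n → ¬ (pow ω j ≈ 1#))

{-# OPTIONS --safe #-}
-- Set U = w + 2, and let [N, i] be the q-binomial coefficients.
--
-- The strip paths counted by maj satisfy a three-term recurrence in their end point which is also
-- satisfied by every [N, i + s]; an image sum of such solutions (with weights dictated by the two
-- boundary lines) vanishes on the boundary and hence counts the paths.  The image sum also vanishes
-- for the two starting abscissas x₀ = 0 and x₀ = w + 1, so |CDP(n,w)|_q is a sum over a full period
-- 0 ≤ x₀ < U.  At a root of unity z with zⁿ = 1, Pascal's rule expresses two consecutive terms
-- [2n−1, ·] through [2n, ·], and the sum telescopes to one over the coefficients [2n, ·].  By the
-- q-Lucas theorem these only see n / d, where d is the order of z; hence |CDP(n,w)|_z is the number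
-- of pairs (x₀, b) for n / d.  That number is counted by closed chains of heights, just as the
-- elements of CDP(n/d, w), and those are the elements of CDP(n, w) fixed by the rotation.
module Submission where

open import Defs
open import Level using (0ℓ)
open import Algebra.Bundles using (CommutativeRing; RawRing)
import Algebra.Solver.Ring
open import Algebra.Solver.Ring.AlmostCommutativeRing using (fromCommutativeRing; _-Raw-AlmostCommutative⟶_)
open import Data.Bool using (Bool; true; false; _∧_; not; if_then_else_; T)
import Data.Bool.Properties as Boolₚ
open import Data.Empty using (⊥-elim)
open import Data.Fin using (Fin; toℕ; fromℕ; inject₁) renaming (zero to fzero; suc to fsuc)
import Data.Fin.Properties as Finₚ
open import Data.Fin.Relation.Unary.Top using (view; ‵fromℕ; ‵inject₁)
open import Data.List using (List; []; _∷_; _++_; _∷ʳ_; map; concatMap; length; filterᵇ; upTo; applyUpTo; allFin; tabulate)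
open import Data.Maybe using (Maybe; just; nothing)
open import Data.Nat as ℕ using (ℕ; zero; suc; _≤_; _≡ᵇ_; _≤ᵇ_; _<ᵇ_)
open import Data.Nat.DivMod using (_mod_; _%_; _/_; m≡m%n+[m/n]*n; [m+kn]%n≡m%n; m<n⇒m%n≡m; m%n<n; n%n≡0)
open import Data.Nat.Divisibility using (_∣_; divides)
open import Data.Nat.GCD using (gcd; gcd[m,n]∣m; gcd[m,n]∣n; gcd-GCD; module Bézout)
import Data.Nat.Properties as ℕₚ
open import Data.Nat.Tactic.RingSolver using (solve-∀)
open import Data.Product using (_×_; _,_; proj₁; proj₂)
open import Data.Sum using (_⊎_; inj₁; inj₂)
open import Data.Unit using (tt)
open import Data.Vec.Functional using () renaming (_∷_ to _◂_)
open import Function using (_∘_; _⇔_; mk⇔; Equivalence)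
open import Relation.Binary.PropositionalEquality as ≡ using (_≡_; _≢_)
open import Relation.Nullary using (¬_; yes; no)
open import Relation.Nullary.Decidable using (toWitness; fromWitness)

open Equivalence using (to; from)

-- No closed form is ever computed. At z of order d, with n = md, the reduction ends in `reduced`,
-- built only from m, U, a truncation bound K and ordinary binomial coefficients. The same reduction
-- at 1, with m in place of n and order 1, ends in literally the same expression, so the two
-- evaluations agree. The two boundary lines behave differently because `maj` charges north-east
-- turns, whose corners point towards the line y = x. On the upper line the image sum vanishes. On
-- the lower line what is shown to vanish is a combination of two neighbouring image sums, namely
-- the one that the path recurrence loses when such a corner is forbidden. The sum over x₀ is
-- essential: for one x₀ the negative images occupy two residue classes of indices modulo U. Over a
-- full period each positive index below the truncation is met twice, once from each family, and
-- such a pair is what Pascal's rule turns into a coefficient of row 2n.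

module _ (R : CommutativeRing 0ℓ 0ℓ) where
  open CommutativeRing R hiding (zero)

  NoZeroDivisors : Set
  NoZeroDivisors = ∀ x y → x * y ≈ 0# → x ≈ 0# ⊎ y ≈ 0#

  -- Stands in for invertibility of `q`: identities that naturally carry negative powers of `q` are
  -- multiplied up and cancelled afterwards. Roots of unity satisfy it by `root-cancel`.
  PowersCancel : Carrier → Set
  PowersCancel q = ∀ i {a b} → pow R q i * a ≈ pow R q i * b → a ≈ b

-- Commutative rings: a solver with integer coefficients, powers, finite sums.

module RingBasics (R : CommutativeRing 0ℓ 0ℓ) where
  open CommutativeRing R hiding (zero)
  open import Algebra.Properties.Ring ring using (-‿distribˡ-*; -‿distribʳ-*; -‿involutive; -0#≈0#; -‿+-comm)
  open import Algebra.Properties.Group +-group using () renaming (x∙y⁻¹≈ε⇒x≈y to x-y≈0⇒x≈y; x≈y⇒x∙y⁻¹≈ε to x≈y⇒x-y≈0) public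
  open import Algebra.Properties.CommutativeSemigroup +-commutativeSemigroup using (interchange)
  open import Relation.Binary.Reasoning.Setoid setoid

  natR-+ : ∀ a b → natR R (a ℕ.+ b) ≈ natR R a + natR R b
  natR-+ zero    b = sym (+-identityˡ _)
  natR-+ (suc a) b = trans (+-congˡ (natR-+ a b)) (sym (+-assoc _ _ _))

  natR-* : ∀ a b → natR R (a ℕ.* b) ≈ natR R a * natR R b
  natR-* zero    b = sym (zeroˡ _)
  natR-* (suc a) b = begin
    natR R (b ℕ.+ a ℕ.* b)                  ≈⟨ natR-+ b (a ℕ.* b) ⟩
    natR R b + natR R (a ℕ.* b)             ≈⟨ +-cong (sym (*-identityˡ _)) (natR-* a b) ⟩
    1# * natR R b + natR R a * natR R b     ≈⟨ distribʳ _ _ _ ⟨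
    (1# + natR R a) * natR R b              ∎

  -- The solver's coefficients: (a , b) stands for the integer a − b, and is kept reduced so that
  -- equal coefficients are syntactically equal.
  private
    reduce : ℕ → ℕ → ℕ × ℕ
    reduce (suc a) (suc b) = reduce a b
    reduce a       b       = a , b

    coeffs : RawRing 0ℓ 0ℓ
    coeffs = record
      { Carrier = ℕ × ℕ
      ; _≈_     = _≡_
      ; _+_     = λ (a , b) (c , d) → reduce (a ℕ.+ c) (b ℕ.+ d)
      ; _*_     = λ (a , b) (c , d) → reduce (a ℕ.* c ℕ.+ b ℕ.* d) (a ℕ.* d ℕ.+ b ℕ.* c)
      ; -_      = λ (a , b) → b , a
      ; 0#      = 0 , 0
      ; 1#      = 1 , 0
      }

    diff : ℕ × ℕ → Carrier
    diff (a , b) = natR R a - natR R b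

    ⟦_⟧ : ℕ × ℕ → Carrier
    ⟦ 0 , 0 ⟧ = 0#
    ⟦ 1 , 0 ⟧ = 1#
    ⟦ p ⟧     = diff p

    ⟦⟧≈diff : ∀ p → ⟦ p ⟧ ≈ diff p
    ⟦⟧≈diff (0 , 0)             = sym (-‿inverseʳ _)
    ⟦⟧≈diff (1 , 0)             = sym (trans (+-cong (+-identityʳ _) -0#≈0#) (+-identityʳ _))
    ⟦⟧≈diff (0 , suc _)         = refl
    ⟦⟧≈diff (1 , suc _)         = refl
    ⟦⟧≈diff (suc (suc _) , _)   = refl

    -‿diff : ∀ a b → - (natR R a - natR R b) ≈ natR R b - natR R a
    -‿diff a b = trans (sym (-‿+-comm _ _)) (trans (+-comm _ _) (+-congʳ (-‿involutive _)))

    diff-cross : ∀ a b c d → a ℕ.+ d ≡ c ℕ.+ b → diff (a , b) ≈ diff (c , d)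
    diff-cross a b c d e = x-y≈0⇒x≈y _ _ (begin
      (A - B) - (C - D)         ≈⟨ +-congˡ (-‿diff c d) ⟩
      (A - B) + (D - C)         ≈⟨ interchange _ _ _ _ ⟩
      (A + D) + (- B - C)       ≈⟨ +-cong (trans (sym (natR-+ a d)) (trans (reflexive (≡.cong (natR R) e)) (natR-+ c b))) (trans (-‿+-comm _ _) (-‿cong (+-comm _ _))) ⟩
      (C + B) - (C + B)         ≈⟨ -‿inverseʳ _ ⟩
      0#                        ∎)
      where
      A = natR R a
      B = natR R b
      C = natR R c
      D = natR R d

    ⟦reduce⟧ : ∀ a b → ⟦ reduce a b ⟧ ≈ diff (a , b)
    ⟦reduce⟧ zero    b       = ⟦⟧≈diff (zero , b)
    ⟦reduce⟧ (suc a) zero    = ⟦⟧≈diff (suc a , zero)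
    ⟦reduce⟧ (suc a) (suc b) = trans (⟦reduce⟧ a b) (diff-cross a b (suc a) (suc b) (ℕₚ.+-suc a b))

    +-homo : ∀ p q → ⟦ RawRing._+_ coeffs p q ⟧ ≈ ⟦ p ⟧ + ⟦ q ⟧
    +-homo p@(a , b) q@(c , d) = begin
      ⟦ reduce (a ℕ.+ c) (b ℕ.+ d) ⟧
        ≈⟨ ⟦reduce⟧ (a ℕ.+ c) (b ℕ.+ d) ⟩
      natR R (a ℕ.+ c) - natR R (b ℕ.+ d)
        ≈⟨ +-cong (natR-+ a c) (trans (-‿cong (natR-+ b d)) (sym (-‿+-comm _ _))) ⟩
      (natR R a + natR R c) + (- natR R b + - natR R d)
        ≈⟨ interchange _ _ _ _ ⟩
      diff p + diff q
        ≈⟨ +-cong (⟦⟧≈diff p) (⟦⟧≈diff q) ⟨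
      ⟦ p ⟧ + ⟦ q ⟧ ∎

    *-homo : ∀ p q → ⟦ RawRing._*_ coeffs p q ⟧ ≈ ⟦ p ⟧ * ⟦ q ⟧
    *-homo p@(a , b) q@(c , d) = begin
      ⟦ reduce (a ℕ.* c ℕ.+ b ℕ.* d) (a ℕ.* d ℕ.+ b ℕ.* c) ⟧
        ≈⟨ ⟦reduce⟧ (a ℕ.* c ℕ.+ b ℕ.* d) (a ℕ.* d ℕ.+ b ℕ.* c) ⟩
      natR R (a ℕ.* c ℕ.+ b ℕ.* d) - natR R (a ℕ.* d ℕ.+ b ℕ.* c)
        ≈⟨ +-cong (split a c b d) (trans (-‿cong (split a d b c)) (sym (-‿+-comm _ _))) ⟩
      (A * C + B * D) + (- (A * D) + - (B * C))
        ≈⟨ +-cong (+-congˡ (sym -b*-d)) (+-cong (-‿distribʳ-* A D) (-‿distribˡ-* B C)) ⟩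
      (A * C + - B * - D) + (A * - D + - B * C)
        ≈⟨ +-congˡ (+-comm _ _) ⟩
      (A * C + - B * - D) + (- B * C + A * - D)
        ≈⟨ interchange _ _ _ _ ⟩
      (A * C + - B * C) + (- B * - D + A * - D)
        ≈⟨ +-cong (sym (distribʳ C A (- B))) (trans (+-comm _ _) (sym (distribʳ (- D) A (- B)))) ⟩
      (A - B) * C + (A - B) * - D
        ≈⟨ distribˡ _ _ _ ⟨
      (A - B) * (C - D)
        ≈⟨ *-cong (⟦⟧≈diff p) (⟦⟧≈diff q) ⟨
      ⟦ p ⟧ * ⟦ q ⟧ ∎
      where
      A = natR R a
      B = natR R b
      C = natR R c
      D = natR R d
      split : ∀ a c b d → natR R (a ℕ.* c ℕ.+ b ℕ.* d) ≈ natR R a * natR R c + natR R b * natR R d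
      split a c b d = trans (natR-+ (a ℕ.* c) (b ℕ.* d)) (+-cong (natR-* a c) (natR-* b d))
      -b*-d : - B * - D ≈ B * D
      -b*-d = trans (sym (-‿distribˡ-* B (- D))) (trans (-‿cong (sym (-‿distribʳ-* B D))) (-‿involutive _))

    morphism : coeffs -Raw-AlmostCommutative⟶ fromCommutativeRing R
    morphism = record
      { ⟦_⟧    = ⟦_⟧
      ; +-homo = +-homo
      ; *-homo = *-homo
      ; -‿homo = λ (a , b) → trans (⟦⟧≈diff (b , a)) (sym (trans (-‿cong (⟦⟧≈diff (a , b))) (-‿diff a b)))
      ; 0-homo = refl
      ; 1-homo = refl
      }

    _≟_ : ∀ p q → Maybe (⟦ p ⟧ ≈ ⟦ q ⟧)
    p@(a , b) ≟ q@(c , d) with a ℕ.+ d ℕₚ.≟ c ℕ.+ b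
    ... | yes e = just (trans (⟦⟧≈diff p) (trans (diff-cross a b c d e) (sym (⟦⟧≈diff q))))
    ... | no  _ = nothing

  open Algebra.Solver.Ring coeffs (fromCommutativeRing R) morphism _≟_ public
    using (solve; _:=_; _:+_; _:*_; :-_; _:-_; con; Polynomial)

  :1 : ∀ {n} → Polynomial n
  :1 = con (1 , 0)

  :0 : ∀ {n} → Polynomial n
  :0 = con (0 , 0)

  infixr 8 _^_
  _^_ : Carrier → ℕ → Carrier
  _^_ = pow R

  ^-+ : ∀ x a b → x ^ (a ℕ.+ b) ≈ x ^ a * x ^ b
  ^-+ x zero    b = sym (*-identityˡ _)
  ^-+ x (suc a) b = trans (*-congˡ (^-+ x a b)) (sym (*-assoc _ _ _))

  ^-congʳ : ∀ x {a b} → a ≡ b → x ^ a ≈ x ^ b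
  ^-congʳ x ≡.refl = refl

  ^-congˡ : ∀ {x y} a → x ≈ y → x ^ a ≈ y ^ a
  ^-congˡ zero    e = refl
  ^-congˡ (suc a) e = *-cong e (^-congˡ a e)

  ^-* : ∀ x a b → x ^ (a ℕ.* b) ≈ (x ^ b) ^ a
  ^-* x zero    b = refl
  ^-* x (suc a) b = trans (^-+ x b (a ℕ.* b)) (*-congˡ (^-* x a b))

  1^ : ∀ a → 1# ^ a ≈ 1#
  1^ zero    = refl
  1^ (suc a) = trans (*-identityˡ _) (1^ a)

  ^-*-1 : ∀ x a b → x ^ b ≈ 1# → x ^ (a ℕ.* b) ≈ 1#
  ^-*-1 x a b e = trans (^-* x a b) (trans (^-congˡ a e) (1^ a))

  ∑ : ℕ → (ℕ → Carrier) → Carrier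
  ∑ zero    f = 0#
  ∑ (suc n) f = ∑ n f + f n

  ∑-cong : ∀ n {f g} → (∀ i → i ℕ.< n → f i ≈ g i) → ∑ n f ≈ ∑ n g
  ∑-cong zero    e = refl
  ∑-cong (suc n) e = +-cong (∑-cong n (λ i i<n → e i (ℕₚ.m<n⇒m<1+n i<n))) (e n ℕₚ.≤-refl)

  ∑-0 : ∀ n {f} → (∀ i → i ℕ.< n → f i ≈ 0#) → ∑ n f ≈ 0#
  ∑-0 zero    e = refl
  ∑-0 (suc n) e = trans (+-cong (∑-0 n (λ i i<n → e i (ℕₚ.m<n⇒m<1+n i<n))) (e n ℕₚ.≤-refl)) (+-identityˡ _)

  ∑-+ : ∀ n (f g : ℕ → Carrier) → ∑ n (λ i → f i + g i) ≈ ∑ n f + ∑ n g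
  ∑-+ zero    f g = sym (+-identityˡ _)
  ∑-+ (suc n) f g = trans (+-congʳ (∑-+ n f g)) (interchange _ _ _ _)

  ∑-- : ∀ n (f g : ℕ → Carrier) → ∑ n (λ i → f i - g i) ≈ ∑ n f - ∑ n g
  ∑-- zero    f g = sym (-‿inverseʳ _)
  ∑-- (suc n) f g = trans (+-congʳ (∑-- n f g))
    (solve 4 (λ a b c d → (a :- b) :+ (c :- d) := (a :+ c) :- (b :+ d)) refl _ _ _ _)

  ∑-*ˡ : ∀ n c (f : ℕ → Carrier) → ∑ n (λ i → c * f i) ≈ c * ∑ n f
  ∑-*ˡ zero    c f = sym (zeroʳ _)
  ∑-*ˡ (suc n) c f = trans (+-congʳ (∑-*ˡ n c f)) (sym (distribˡ _ _ _))

  ∑-*ʳ : ∀ n c (f : ℕ → Carrier) → ∑ n (λ i → f i * c) ≈ ∑ n f * c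
  ∑-*ʳ zero    c f = sym (zeroˡ _)
  ∑-*ʳ (suc n) c f = trans (+-congʳ (∑-*ʳ n c f)) (sym (distribʳ _ _ _))

  ∑-telescope : ∀ n (f : ℕ → Carrier) → ∑ n (λ i → f (suc i) - f i) ≈ f n - f 0
  ∑-telescope zero    f = sym (-‿inverseʳ _)
  ∑-telescope (suc n) f = trans (+-congʳ (∑-telescope n f))
    (solve 3 (λ a b c → (b :- c) :+ (a :- b) := a :- c) refl _ _ _)

  ∑-first : ∀ n f → ∑ (suc n) f ≈ f 0 + ∑ n (λ i → f (suc i))
  ∑-first zero    f = +-comm _ _
  ∑-first (suc n) f = trans (+-congʳ (∑-first n f)) (+-assoc _ _ _)

  ∑-split : ∀ n m f → ∑ (m ℕ.+ n) f ≈ ∑ n f + ∑ m (λ i → f (i ℕ.+ n))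
  ∑-split n zero    f = sym (+-identityʳ _)
  ∑-split n (suc m) f = trans (+-congʳ (∑-split n m f)) (+-assoc _ _ _)

  ∑-blocks : ∀ K U f → ∑ (K ℕ.* U) f ≈ ∑ K (λ k → ∑ U (λ x → f (x ℕ.+ k ℕ.* U)))
  ∑-blocks zero    U f = refl
  ∑-blocks (suc K) U f = trans (∑-split (K ℕ.* U) U f) (+-congʳ (∑-blocks K U f))

  ∑-swap : ∀ K U (f : ℕ → ℕ → Carrier) → ∑ K (λ k → ∑ U (f k)) ≈ ∑ U (λ x → ∑ K (λ k → f k x))
  ∑-swap zero    U f = sym (∑-0 U (λ _ _ → refl))
  ∑-swap (suc K) U f = trans (+-congʳ (∑-swap K U f)) (sym (∑-+ U (λ x → ∑ K (λ k → f k x)) (f K)))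

  ∑-reverse : ∀ n f → ∑ n f ≈ ∑ n (λ i → f (n ℕ.∸ suc i))
  ∑-reverse zero    f = refl
  ∑-reverse (suc n) f = begin
    ∑ n f + f n                                 ≈⟨ +-comm _ _ ⟩
    f n + ∑ n f                                 ≈⟨ +-congˡ (∑-reverse n f) ⟩
    f n + ∑ n (λ i → f (n ℕ.∸ suc i))           ≈⟨ ∑-first n (λ i → f (n ℕ.∸ i)) ⟨
    ∑ (suc n) (λ i → f (n ℕ.∸ i))               ∎

-- Gaussian binomial coefficients.

module QBinomial (R : CommutativeRing 0ℓ 0ℓ) (q : CommutativeRing.Carrier R) where
  open CommutativeRing R hiding (zero)
  open RingBasics R
  open import Relation.Binary.Reasoning.Setoid setoid

  binom : ℕ → ℕ → Carrier
  binom N       zero    = 1#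
  binom zero    (suc i) = 0#
  binom (suc N) (suc i) = binom N i + q ^ suc i * binom N (suc i)

  binom-> : ∀ N i → N ℕ.< i → binom N i ≈ 0#
  binom-> zero    (suc i) _          = refl
  binom-> (suc N) (suc i) (ℕ.s≤s N<i) = trans
    (+-cong (binom-> N i N<i) (trans (*-congˡ (binom-> N (suc i) (ℕₚ.m<n⇒m<1+n N<i))) (zeroʳ _)))
    (+-identityˡ _)

  binom-refl : ∀ N → binom N N ≈ 1#
  binom-refl zero    = refl
  binom-refl (suc N) = trans
    (+-cong (binom-refl N) (trans (*-congˡ (binom-> N (suc N) ℕₚ.≤-refl)) (zeroʳ _)))
    (+-identityʳ _)

  -- Proved together with `absorb′`, without dividing. Pascal's rule expresses [N+2, i+1] through
  -- [N+1, i] and [N+1, i+1]; `absorb` one row lower turns the latter into [N, i], and `absorb′`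
  -- turns that back into [N+1, i].
  absorb : ∀ N i → (1# - q ^ suc i) * binom (suc N) (suc i) ≈ (1# - q ^ suc N) * binom N i
  absorb′ : ∀ N i → (q ^ i - q ^ suc N) * binom (suc N) i ≈ q ^ i * ((1# - q ^ suc N) * binom N i)

  absorb zero    zero    = *-congˡ (trans (+-congˡ (zeroʳ _)) (+-identityʳ _))
  absorb zero    (suc i) = trans (*-congˡ (binom-> 1 (suc (suc i)) (ℕ.s≤s (ℕ.s≤s ℕ.z≤n)))) (trans (zeroʳ _) (sym (zeroʳ _)))
  absorb (suc N) i = begin
    (1# - x) * (b₁ + x * b₂)                    ≈⟨ solve 3 (λ x b₁ b₂ → (:1 :- x) :* (b₁ :+ x :* b₂) := (:1 :- x) :* b₁ :+ x :* ((:1 :- x) :* b₂)) refl x b₁ b₂ ⟩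
    (1# - x) * b₁ + x * ((1# - x) * b₂)         ≈⟨ +-congˡ (*-congˡ (absorb N i)) ⟩
    (1# - x) * b₁ + x * ((1# - y) * b₀)         ≈⟨ +-congˡ (*-assoc q _ _) ⟩
    (1# - x) * b₁ + q * (q ^ i * ((1# - y) * b₀)) ≈⟨ +-congˡ (*-congˡ (absorb′ N i)) ⟨
    (1# - x) * b₁ + q * ((q ^ i - y) * b₁)      ≈⟨ solve 4 (λ q z y b₁ → (:1 :- q :* z) :* b₁ :+ q :* ((z :- y) :* b₁) := (:1 :- q :* y) :* b₁) refl q (q ^ i) y b₁ ⟩
    (1# - q * y) * b₁                           ∎
    where
    x = q ^ suc i
    y = q ^ suc N
    b₀ = binom N i
    b₁ = binom (suc N) i
    b₂ = binom (suc N) (suc i)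

  absorb′ N zero    = sym (*-identityˡ _)
  absorb′ N (suc i) = begin
    (x - y) * b₁                          ≈⟨ solve 3 (λ x y b₁ → (x :- y) :* b₁ := (:1 :- y) :* b₁ :- (:1 :- x) :* b₁) refl x y b₁ ⟩
    (1# - y) * b₁ - (1# - x) * b₁         ≈⟨ +-congˡ (-‿cong (absorb N i)) ⟩
    (1# - y) * b₁ - (1# - y) * b₀         ≈⟨ solve 4 (λ x y b₀ b₂ → (:1 :- y) :* (b₀ :+ x :* b₂) :- (:1 :- y) :* b₀ := x :* ((:1 :- y) :* b₂)) refl x y b₀ (binom N (suc i)) ⟩
    x * ((1# - y) * binom N (suc i))      ∎
    where
    x = q ^ suc i
    y = q ^ suc N
    b₀ = binom N i
    b₁ = binom (suc N) (suc i)

  -- `absorb` trades the factor q^(i+1) of Pascal's rule for q^(N+1), which is independent of i.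
  -- Hence every shift of the lower index solves one and the same recurrence, that of `paths-rec`.
  binom-3term : ∀ N i → binom (suc (suc N)) (suc i) ≈
    binom (suc N) i + binom (suc N) (suc i) + (q ^ suc N - 1#) * binom N i
  binom-3term N i = begin
    b₁ + x * b₂                                 ≈⟨ solve 3 (λ x b₁ b₂ → b₁ :+ x :* b₂ := b₁ :+ b₂ :- (:1 :- x) :* b₂) refl x b₁ b₂ ⟩
    b₁ + b₂ - (1# - x) * b₂                     ≈⟨ +-congˡ (-‿cong (absorb N i)) ⟩
    b₁ + b₂ - (1# - y) * b₀                     ≈⟨ solve 4 (λ y b₀ b₁ b₂ → b₁ :+ b₂ :- (:1 :- y) :* b₀ := b₁ :+ b₂ :+ (y :- :1) :* b₀) refl y b₀ b₁ b₂ ⟩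
    b₁ + b₂ + (y - 1#) * b₀                     ∎
    where
    x = q ^ suc i
    y = q ^ suc N
    b₀ = binom N i
    b₁ = binom (suc N) i
    b₂ = binom (suc N) (suc i)

  module _ (cancel : PowersCancel R q) where

    binom-pascal′ : ∀ i b → binom (suc (i ℕ.+ b)) (suc i) ≈ binom (i ℕ.+ b) (suc i) + q ^ b * binom (i ℕ.+ b) i
    binom-pascal′ i b = cancel (suc i) (begin
      x * binom (suc N) (suc i)                ≈⟨ solve 2 (λ x b₁ → x :* b₁ := b₁ :- (:1 :- x) :* b₁) refl x _ ⟩
      binom (suc N) (suc i) - (1# - x) * binom (suc N) (suc i)
                                               ≈⟨ +-congˡ (-‿cong (absorb N i)) ⟩
      (b₀ + x * b₁) - (1# - q ^ suc N) * b₀    ≈⟨ +-congˡ (-‿cong (*-congʳ (+-congˡ (-‿cong (^-+ q (suc i) b))))) ⟩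
      (b₀ + x * b₁) - (1# - x * q ^ b) * b₀    ≈⟨ solve 4 (λ x z b₀ b₁ → (b₀ :+ x :* b₁) :- (:1 :- x :* z) :* b₀ := x :* (b₁ :+ z :* b₀)) refl x (q ^ b) b₀ b₁ ⟩
      x * (b₁ + q ^ b * b₀)                    ∎)
      where
      N = i ℕ.+ b
      x = q ^ suc i
      b₀ = binom N i
      b₁ = binom N (suc i)

    binom-sym : ∀ a b → binom (a ℕ.+ b) a ≈ binom (a ℕ.+ b) b
    binom-sym zero    b       = sym (binom-refl b)
    binom-sym (suc a) zero    = trans (reflexive (≡.cong (λ N → binom N (suc a)) (ℕₚ.+-identityʳ (suc a)))) (binom-refl (suc a))
    binom-sym (suc a) (suc b) = begin
      binom (suc (a ℕ.+ suc b)) (suc a)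
        ≈⟨ binom-pascal′ a (suc b) ⟩
      binom (a ℕ.+ suc b) (suc a) + q ^ suc b * binom (a ℕ.+ suc b) a
        ≈⟨ +-cong shifted (*-congˡ (binom-sym a (suc b))) ⟩
      binom (a ℕ.+ suc b) b + q ^ suc b * binom (a ℕ.+ suc b) (suc b) ∎
      where
      shifted : binom (a ℕ.+ suc b) (suc a) ≈ binom (a ℕ.+ suc b) b
      shifted = begin
        binom (a ℕ.+ suc b) (suc a)   ≈⟨ reflexive (≡.cong (λ N → binom N (suc a)) (ℕₚ.+-suc a b)) ⟩
        binom (suc a ℕ.+ b) (suc a)   ≈⟨ binom-sym (suc a) b ⟩
        binom (suc a ℕ.+ b) b         ≈⟨ reflexive (≡.cong (λ N → binom N b) (ℕₚ.+-suc a b)) ⟨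
        binom (a ℕ.+ suc b) b         ∎

-- The method of images in the strip 0 < x - y < U.

K≤i+K* : ∀ U → 1 ℕ.≤ U → ∀ K i → K ℕ.≤ i ℕ.+ K ℕ.* U
K≤i+K* U 1≤U K i = ℕₚ.≤-trans (ℕₚ.≤-trans (ℕₚ.≤-reflexive (≡.sym (ℕₚ.*-identityʳ K))) (ℕₚ.*-monoʳ-≤ K 1≤U)) (ℕₚ.m≤n+m _ i)

private
  upper-index : ∀ y x₀ c k → y ℕ.+ suc k ℕ.* (x₀ ℕ.+ c) ≡ y ℕ.+ c ℕ.+ (x₀ ℕ.+ k ℕ.* (x₀ ℕ.+ c))
  upper-index = solve-∀

  lower-index₁ : ∀ j x₀ u → j ℕ.+ (x₀ ℕ.+ u) ≡ (x₀ ℕ.+ j) ℕ.+ u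
  lower-index₁ = solve-∀

  lower-index₂ : ∀ j x₀ c k → j ℕ.+ suc k ℕ.* (x₀ ℕ.+ c) ≡ (x₀ ℕ.+ j) ℕ.+ (c ℕ.+ k ℕ.* (x₀ ℕ.+ c))
  lower-index₂ = solve-∀

  lower-exponent₀ : ∀ j x₀ U → let s = x₀ ℕ.+ j in
    1 ℕ.* (x₀ ℕ.+ 0 ℕ.* U) ℕ.+ (j ℕ.+ s) ≡ 0 ℕ.+ ((s ℕ.+ 0 ℕ.* U) ℕ.+ (s ℕ.+ 0 ℕ.* U))
  lower-exponent₀ = solve-∀

  lower-exponent₁ : ∀ j x₀ U k → let s = x₀ ℕ.+ j in
    suc (suc k) ℕ.* (x₀ ℕ.+ suc k ℕ.* U) ℕ.+ (j ℕ.+ s) ≡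
    suc k ℕ.* (x₀ ℕ.+ k ℕ.* U) ℕ.+ ((s ℕ.+ suc k ℕ.* U) ℕ.+ (s ℕ.+ suc k ℕ.* U))
  lower-exponent₁ = solve-∀

  lower-exponent₂ : ∀ j x₀ c k → let s = x₀ ℕ.+ j; U = x₀ ℕ.+ c in
    suc k ℕ.* (c ℕ.+ suc k ℕ.* U) ℕ.+ (j ℕ.+ s) ≡
    k ℕ.* (c ℕ.+ k ℕ.* U) ℕ.+ ((s ℕ.+ (c ℕ.+ k ℕ.* U)) ℕ.+ (s ℕ.+ (c ℕ.+ k ℕ.* U)))
  lower-exponent₂ = solve-∀

  exponent₀ : ∀ k U → suc k ℕ.* (0 ℕ.+ k ℕ.* U) ≡ k ℕ.* (U ℕ.+ k ℕ.* U)
  exponent₀ = solve-∀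

module Images
  (R : CommutativeRing 0ℓ 0ℓ) (q : CommutativeRing.Carrier R)
  (cancel : PowersCancel R q)
  (x₀ c K : ℕ) where
  open CommutativeRing R hiding (zero)
  open RingBasics R
  open QBinomial R q
  open import Relation.Binary.Reasoning.Setoid setoid

  U : ℕ
  U = x₀ ℕ.+ c

  -- Exponents accumulated by alternating reflections: `eA k` is the sum of x₀ + 2iU over 0 ≤ i ≤ k
  -- and `eB k` the sum of 2iU - x₀ over 1 ≤ i ≤ k, these being the positions that get reflected in
  -- the line x - y = 0.
  eA eB : ℕ → ℕ
  eA k = suc k ℕ.* (x₀ ℕ.+ k ℕ.* U)
  eB k = k ℕ.* (c ℕ.+ k ℕ.* U)

  A B : ℕ → Carrier
  A k = q ^ eA k
  B k = q ^ eB k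

  -- For N = j + y, image sums the free paths to (x₀ + j, y) from the images x₀ + 2kU and −x₀ − 2kU
  -- (k ∈ ℤ) of x₀.  Paths from an image to the right of x₀ are counted by their number of north steps,
  -- those from an image to its left by their number of east steps, so that no index is negative.
  -- Reflection in the line x − y = 0 multiplies the weight of an image at s by −q^s, and reflection
  -- in x − y = U by −1.
  term : ℕ → ℕ → ℕ → ℕ → Carrier
  term N j y k =
      A k * (binom N (y ℕ.+ suc k ℕ.* U) - binom N (j ℕ.+ (x₀ ℕ.+ k ℕ.* U)))
    + (B (suc k) * binom N (j ℕ.+ suc k ℕ.* U) - B k * binom N (y ℕ.+ (c ℕ.+ k ℕ.* U)))

  image : ℕ → ℕ → ℕ → Carrier
  image N j y = binom N y + ∑ K (term N j y)

  image-3term : ∀ N j y → image (suc (suc N)) (suc j) (suc y) ≈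
    image (suc N) (suc j) y + image (suc N) j (suc y) + (q ^ suc N - 1#) * image N j y
  image-3term N j y = begin
    binom (suc (suc N)) (suc y) + ∑ K (term (suc (suc N)) (suc j) (suc y))
      ≈⟨ +-cong (binom-3term N y) (∑-cong K (λ k _ → step k)) ⟩
    (binom (suc N) y + binom (suc N) (suc y) + Q * binom N y)
      + ∑ K (λ k → (t₁ k + t₂ k) + Q * t₃ k)
      ≈⟨ +-congˡ (trans (∑-+ K _ _) (+-cong (∑-+ K _ _) (∑-*ˡ K Q t₃))) ⟩
    (binom (suc N) y + binom (suc N) (suc y) + Q * binom N y)
      + ((∑ K t₁ + ∑ K t₂) + Q * ∑ K t₃)
      ≈⟨ solve 7 (λ a b c d e f Q → (a :+ b :+ Q :* c) :+ ((d :+ e) :+ Q :* f) := (a :+ d) :+ (b :+ e) :+ Q :* (c :+ f)) refl _ _ _ _ _ _ _ ⟩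
    (binom (suc N) y + ∑ K t₁) + (binom (suc N) (suc y) + ∑ K t₂) + Q * (binom N y + ∑ K t₃) ∎
    where
    Q = q ^ suc N - 1#
    t₁ = term (suc N) (suc j) y
    t₂ = term (suc N) j (suc y)
    t₃ = term N j y
    step : ∀ k → term (suc (suc N)) (suc j) (suc y) k ≈ (t₁ k + t₂ k) + Q * t₃ k
    step k = trans
      (+-cong (*-congˡ (+-cong (binom-3term N _) (-‿cong (binom-3term N _))))
              (+-cong (*-congˡ (binom-3term N _)) (-‿cong (*-congˡ (binom-3term N _)))))
      (solve 16 (λ Q A B B′ a₁ a₂ a₃ b₁ b₂ b₃ c₁ c₂ c₃ d₁ d₂ d₃ →
           A :* ((a₁ :+ a₂ :+ Q :* a₃) :- (b₁ :+ b₂ :+ Q :* b₃))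
             :+ (B′ :* (c₁ :+ c₂ :+ Q :* c₃) :- B :* (d₁ :+ d₂ :+ Q :* d₃))
        := ((A :* (a₁ :- b₂) :+ (B′ :* c₂ :- B :* d₁)) :+ (A :* (a₂ :- b₁) :+ (B′ :* c₁ :- B :* d₂)))
             :+ Q :* (A :* (a₃ :- b₃) :+ (B′ :* c₃ :- B :* d₃)))
        refl Q (A k) (B k) (B (suc k)) _ _ _ _ _ _ _ _ _ _ _ _)

  -- Two images that are mirrored in the upper line have opposite weights and, for an end point on
  -- that line, equal coefficients. The `A`-terms therefore cancel at once and the `B`-terms
  -- telescope; x₀ itself cancels against `G 0` by the symmetry of the coefficients, and `K` > N
  -- kills the far end.
  image-upper : ∀ y → 1 ℕ.≤ U → y ℕ.+ c ℕ.+ y ℕ.< K → image (y ℕ.+ c ℕ.+ y) (y ℕ.+ c) y ≈ 0#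
  image-upper y U≢0 N<K = begin
    binom N y + ∑ K (term N j y)                  ≈⟨ +-cong (sym (binom-sym cancel j y)) (∑-cong K (λ k _ → step k)) ⟩
    binom N j + ∑ K (λ k → G (suc k) - G k)       ≈⟨ +-congˡ (∑-telescope K G) ⟩
    binom N j + (G K - G 0)                       ≈⟨ +-congˡ (+-cong GK (-‿cong (trans (*-identityˡ _) (reflexive (≡.cong (λ i → binom N (y ℕ.+ i)) (ℕₚ.+-identityʳ c)))))) ⟩
    binom N j + (0# - binom N j)                  ≈⟨ solve 1 (λ a → a :+ (:0 :- a) := :0) refl _ ⟩
    0#                                            ∎
    where
    j = y ℕ.+ c
    N = j ℕ.+ y
    G : ℕ → Carrier
    G k = B k * binom N (y ℕ.+ (c ℕ.+ k ℕ.* U))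
    GK : G K ≈ 0#
    GK = trans (*-congˡ (binom-> N _ (ℕₚ.<-≤-trans N<K (ℕₚ.≤-trans (K≤i+K* U U≢0 K j) (ℕₚ.≤-reflexive (ℕₚ.+-assoc y c _)))))) (zeroʳ _)
    step : ∀ k → term N j y k ≈ G (suc k) - G k
    step k = trans
      (+-cong (trans (*-congˡ (x≈y⇒x-y≈0 (reflexive (≡.cong (binom N) i₁)))) (zeroʳ _))
              (+-congʳ (*-congˡ (reflexive (≡.cong (binom N) (ℕₚ.+-assoc y c _))))))
      (+-identityˡ _)
      where
      i₁ : y ℕ.+ suc k ℕ.* U ≡ j ℕ.+ (x₀ ℕ.+ k ℕ.* U)
      i₁ = upper-index y x₀ c k

  -- Here (x₀ + j, y + 1) lies on the line x = y. The sum is what `paths-rec` attaches to this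
  -- point: the paths ending there, plus the correction for a north-east turn with its corner there.
  -- `north` and `east` bring the contributions of an image at s and of its mirror at -s to the same
  -- shape, so that they cancel.
  image-lower : ∀ j y → 1 ℕ.≤ U → x₀ ℕ.+ j ≡ suc y → j ℕ.+ y ℕ.< K →
    image (suc (j ℕ.+ y)) j (suc y) + (q ^ suc (j ℕ.+ y) - 1#) * image (j ℕ.+ y) j y ≈ 0#
  image-lower j y U≢0 x₀+j≡1+y N<K = begin
    (binom (suc N) (suc y) + ∑ K t₁) + Q * (binom N y + ∑ K t₂)
      ≈⟨ solve 5 (λ a b c d Q → (a :+ b) :+ Q :* (c :+ d) := (a :+ Q :* c) :+ (b :+ Q :* d)) refl _ _ _ _ _ ⟩
    (binom (suc N) (suc y) + Q * binom N y) + (∑ K t₁ + Q * ∑ K t₂)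
      ≈⟨ +-cong (north y) (trans (+-congˡ (sym (∑-*ˡ K Q t₂))) (trans (sym (∑-+ K t₁ _)) (∑-cong K (λ k _ → step k)))) ⟩
    q ^ suc y * binom (suc N) (suc y) + ∑ K (λ k → H (suc k) - H k)
      ≈⟨ +-cong (sym H0) (∑-telescope K H) ⟩
    H 0 + (H K - H 0)
      ≈⟨ solve 2 (λ a b → a :+ (b :- a) := b) refl _ _ ⟩
    H K
      ≈⟨ trans (*-congˡ (trans (*-congˡ (binom-> (suc N) _ (ℕ.s≤s (ℕₚ.<-≤-trans N<K (K≤i+K* U U≢0 K y))))) (zeroʳ _))) (zeroʳ _) ⟩
    0# ∎
    where
    N = j ℕ.+ y
    Q = q ^ suc N - 1#
    t₁ = term (suc N) j (suc y)
    t₂ = term N j y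

    north : ∀ i → binom (suc N) (suc i) + Q * binom N i ≈ q ^ suc i * binom (suc N) (suc i)
    north i = begin
      b₁ + Q * b₀                 ≈⟨ solve 3 (λ b₁ b₀ y → b₁ :+ (y :- :1) :* b₀ := b₁ :- (:1 :- y) :* b₀) refl b₁ b₀ _ ⟩
      b₁ - (1# - q ^ suc N) * b₀  ≈⟨ +-congˡ (-‿cong (sym (absorb N i))) ⟩
      b₁ - (1# - q ^ suc i) * b₁  ≈⟨ solve 2 (λ b x → b :- (:1 :- x) :* b := x :* b) refl b₁ _ ⟩
      q ^ suc i * b₁              ∎
      where
      b₀ = binom N i
      b₁ = binom (suc N) (suc i)

    east : ∀ i → q ^ i * (binom (suc N) i + Q * binom N i) ≈ q ^ suc N * binom (suc N) i
    east i = begin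
      x * (b₁ + Q * b₀)                     ≈⟨ solve 4 (λ x b₁ b₀ y → x :* (b₁ :+ (y :- :1) :* b₀) := x :* b₁ :- x :* ((:1 :- y) :* b₀)) refl x b₁ b₀ _ ⟩
      x * b₁ - x * ((1# - q ^ suc N) * b₀)  ≈⟨ +-congˡ (-‿cong (sym (absorb′ N i))) ⟩
      x * b₁ - (x - q ^ suc N) * b₁         ≈⟨ solve 3 (λ x b y → x :* b :- (x :- y) :* b := y :* b) refl x b₁ _ ⟩
      q ^ suc N * b₁                        ∎
      where
      x = q ^ i
      b₀ = binom N i
      b₁ = binom (suc N) i

    -- `east` divided by q^i. The quotient q^(N+1-i) may have a negative exponent, so it is absorbed
    -- into the weight: the hypothesis says e + (N + 1) - i = e′ + i.
    east′ : ∀ e e′ i → e ℕ.+ suc N ≡ e′ ℕ.+ (i ℕ.+ i) →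
      q ^ e * (binom (suc N) i + Q * binom N i) ≈ q ^ e′ * (q ^ i * binom (suc N) i)
    east′ e e′ i eq = cancel i (begin
      q ^ i * (q ^ e * X)             ≈⟨ solve 3 (λ a b c → a :* (b :* c) := b :* (a :* c)) refl _ _ _ ⟩
      q ^ e * (q ^ i * X)             ≈⟨ *-congˡ (east i) ⟩
      q ^ e * (q ^ suc N * b₁)        ≈⟨ *-assoc _ _ _ ⟨
      q ^ e * q ^ suc N * b₁          ≈⟨ *-congʳ (^-+ q e (suc N)) ⟨
      q ^ (e ℕ.+ suc N) * b₁          ≈⟨ *-congʳ (^-congʳ q eq) ⟩
      q ^ (e′ ℕ.+ (i ℕ.+ i)) * b₁     ≈⟨ *-congʳ (trans (^-+ q e′ _) (*-congˡ (^-+ q i i))) ⟩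
      q ^ e′ * (q ^ i * q ^ i) * b₁   ≈⟨ solve 3 (λ a b c → a :* (b :* b) :* c := b :* (a :* (b :* c))) refl _ _ _ ⟩
      q ^ i * (q ^ e′ * (q ^ i * b₁)) ∎)
      where
      b₁ = binom (suc N) i
      X = b₁ + Q * binom N i

    -- `eA` shifted by one place, with 0 for the starting point, so that `H k` is the contribution
    -- of the image x₀ + 2kU and `H 0` that of x₀ itself.
    eH : ℕ → ℕ
    eH zero    = 0
    eH (suc k) = eA k

    H : ℕ → Carrier
    H k = q ^ eH k * (q ^ suc (y ℕ.+ k ℕ.* U) * binom (suc N) (suc (y ℕ.+ k ℕ.* U)))

    H0 : H 0 ≈ q ^ suc y * binom (suc N) (suc y)
    H0 = trans (*-identityˡ _) (reflexive (≡.cong (λ i → q ^ suc i * binom (suc N) (suc i)) (ℕₚ.+-identityʳ y)))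

    sucN : suc N ≡ j ℕ.+ suc y
    sucN = ≡.sym (ℕₚ.+-suc j y)

    idx₁ : ∀ k → j ℕ.+ (x₀ ℕ.+ k ℕ.* U) ≡ suc (y ℕ.+ k ℕ.* U)
    idx₁ k = ≡.trans (lower-index₁ j x₀ (k ℕ.* U)) (≡.cong (ℕ._+ k ℕ.* U) x₀+j≡1+y)

    idx₂ : ∀ k → j ℕ.+ suc k ℕ.* U ≡ suc (y ℕ.+ (c ℕ.+ k ℕ.* U))
    idx₂ k = ≡.trans (lower-index₂ j x₀ c k) (≡.cong (ℕ._+ (c ℕ.+ k ℕ.* U)) x₀+j≡1+y)

    replace : ∀ e e′ u → e ℕ.+ (j ℕ.+ (x₀ ℕ.+ j)) ≡ e′ ℕ.+ ((x₀ ℕ.+ j ℕ.+ u) ℕ.+ (x₀ ℕ.+ j ℕ.+ u)) →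
      e ℕ.+ suc N ≡ e′ ℕ.+ (suc (y ℕ.+ u) ℕ.+ suc (y ℕ.+ u))
    replace e e′ u eq = ≡.trans (≡.cong (e ℕ.+_) sucN)
      (≡.subst (λ s → e ℕ.+ (j ℕ.+ s) ≡ e′ ℕ.+ ((s ℕ.+ u) ℕ.+ (s ℕ.+ u))) x₀+j≡1+y eq)

    exp₁ : ∀ k → eA k ℕ.+ suc N ≡ eH k ℕ.+ (suc (y ℕ.+ k ℕ.* U) ℕ.+ suc (y ℕ.+ k ℕ.* U))
    exp₁ zero    = replace (eA 0) 0 (0 ℕ.* U) (lower-exponent₀ j x₀ U)
    exp₁ (suc k) = replace (eA (suc k)) (eA k) (suc k ℕ.* U) (lower-exponent₁ j x₀ U k)

    exp₂ : ∀ k → eB (suc k) ℕ.+ suc N ≡ eB k ℕ.+ (suc (y ℕ.+ (c ℕ.+ k ℕ.* U)) ℕ.+ suc (y ℕ.+ (c ℕ.+ k ℕ.* U)))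
    exp₂ k = replace (eB (suc k)) (eB k) (c ℕ.+ k ℕ.* U) (lower-exponent₂ j x₀ c k)

    -- The image -x₀ - 2kU gives -`H k` and x₀ + 2(k+1)U gives `H (suc k)`; the remaining two
    -- images, 2(k+1)U - x₀ and its negative, give -`W` and `W`.
    step : ∀ k → t₁ k + Q * t₂ k ≈ H (suc k) - H k
    step k = begin
      t₁ k + Q * t₂ k
        ≈⟨ solve 12 (λ Q A B B′ a₁ a₂ b₁ b₂ c₁ c₂ d₁ d₂ →
             (A :* (a₁ :- b₁) :+ (B′ :* c₁ :- B :* d₁)) :+ Q :* (A :* (a₂ :- b₂) :+ (B′ :* c₂ :- B :* d₂))
           := (A :* (a₁ :+ Q :* a₂) :- A :* (b₁ :+ Q :* b₂)) :+ (B′ :* (c₁ :+ Q :* c₂) :- B :* (d₁ :+ Q :* d₂)))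
           refl Q (A k) (B k) (B (suc k)) _ _ _ _ _ _ _ _ ⟩
      (A k * (binom (suc N) (suc y ℕ.+ suc k ℕ.* U) + Q * binom N (y ℕ.+ suc k ℕ.* U)) - A k * X (j ℕ.+ (x₀ ℕ.+ k ℕ.* U)))
        + (B (suc k) * X (j ℕ.+ suc k ℕ.* U) - B k * (binom (suc N) (suc i₂) + Q * binom N i₂))
        ≈⟨ +-cong (+-cong (*-congˡ (north _)) (-‿cong (trans (*-congˡ (reflexive (≡.cong X (idx₁ k)))) (east′ (eA k) (eH k) (suc (y ℕ.+ k ℕ.* U)) (exp₁ k)))))
                  (+-cong (trans (*-congˡ (reflexive (≡.cong X (idx₂ k)))) (east′ (eB (suc k)) (eB k) (suc i₂) (exp₂ k))) (-‿cong (*-congˡ (north i₂)))) ⟩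
      (H (suc k) - H k) + (W - W)
        ≈⟨ trans (+-congˡ (-‿inverseʳ W)) (+-identityʳ _) ⟩
      H (suc k) - H k ∎
      where
      X : ℕ → Carrier
      X i = binom (suc N) i + Q * binom N i
      i₂ = y ℕ.+ (c ℕ.+ k ℕ.* U)
      W = B k * (q ^ suc i₂ * binom (suc N) (suc i₂))

  private
    -- Near the bottom and left edges the end point is out of reach of every image other than x₀:
    -- all their indices exceed the row.
    image-edge : ∀ N j y →
      (∀ k → N ℕ.< y ℕ.+ suc k ℕ.* U) → (∀ k → N ℕ.< j ℕ.+ (x₀ ℕ.+ k ℕ.* U)) →
      (∀ k → N ℕ.< j ℕ.+ suc k ℕ.* U) → (∀ k → N ℕ.< y ℕ.+ (c ℕ.+ k ℕ.* U)) →
      image N j y ≈ binom N y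
    image-edge N j y h₁ h₂ h₃ h₄ = trans (+-congˡ (∑-0 K (λ k _ → trans
      (+-cong (*-congˡ (+-cong (binom-> N _ (h₁ k)) (-‿cong (binom-> N _ (h₂ k)))))
              (+-cong (*-congˡ (binom-> N _ (h₃ k))) (-‿cong (*-congˡ (binom-> N _ (h₄ k))))))
      (solve 3 (λ a b c → a :* (:0 :- :0) :+ (b :* :0 :- c :* :0) := :0) refl _ _ _))))
      (+-identityʳ _)

  image-bottom : ∀ j → 1 ℕ.≤ x₀ → j ℕ.< c → image j j 0 ≈ 1#
  image-bottom j 1≤x₀ j<c = image-edge j j 0
    (λ k → ℕₚ.<-≤-trans j<c (ℕₚ.≤-trans (ℕₚ.m≤n+m c x₀) (ℕₚ.m≤m+n U _)))
    (λ k → ℕₚ.m<m+n j (ℕₚ.≤-trans 1≤x₀ (ℕₚ.m≤m+n x₀ _)))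
    (λ k → ℕₚ.m<m+n j (ℕₚ.≤-trans 1≤x₀ (ℕₚ.≤-trans (ℕₚ.m≤m+n x₀ c) (ℕₚ.m≤m+n U _))))
    (λ k → ℕₚ.<-≤-trans j<c (ℕₚ.m≤m+n c _))

  image-left : ∀ y → 1 ℕ.≤ c → y ℕ.< x₀ → image y 0 y ≈ 1#
  image-left y 1≤c y<x₀ = trans (image-edge y 0 y
    (λ k → ℕₚ.m<m+n y (ℕₚ.≤-trans 1≤c (ℕₚ.≤-trans (ℕₚ.m≤n+m c x₀) (ℕₚ.m≤m+n U _))))
    (λ k → ℕₚ.<-≤-trans y<x₀ (ℕₚ.m≤m+n x₀ _))
    (λ k → ℕₚ.<-≤-trans y<x₀ (ℕₚ.≤-trans (ℕₚ.m≤m+n x₀ c) (ℕₚ.m≤m+n U _)))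
    (λ k → ℕₚ.m<m+n y (ℕₚ.≤-trans 1≤c (ℕₚ.m≤m+n c _))))
    (binom-refl y)

module _
  (R : CommutativeRing 0ℓ 0ℓ) (q : CommutativeRing.Carrier R)
  (cancel : PowersCancel R q)
  (U K : ℕ) where
  open CommutativeRing R hiding (zero)
  open RingBasics R
  open QBinomial R q
  open Images R q cancel 0 U K hiding (U)
  open import Relation.Binary.Reasoning.Setoid setoid

  -- A start on the lower line is its own mirror. With x₀ = 0 and c = U the weights `A k` and `B k`
  -- coincide, and every position occurs twice with opposite signs: 2(k+1)U with `A k` and -`B k`,
  -- -2(k+1)U with `B (suc k)` and -`A (suc k)`, and 0 with 1 and -`A 0`. This works for every end
  -- point.
  image-origin : ∀ j y → 1 ℕ.≤ U → j ℕ.+ y ℕ.< K → image (j ℕ.+ y) j y ≈ 0#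
  image-origin j y U≢0 N<K = begin
    binom N y + ∑ K (term N j y)                  ≈⟨ +-cong (sym (binom-sym cancel j y)) (∑-cong K (λ k _ → step k)) ⟩
    binom N j + ∑ K (λ k → G (suc k) - G k)       ≈⟨ +-congˡ (∑-telescope K G) ⟩
    binom N j + (G K - G 0)                       ≈⟨ +-congˡ (+-cong GK (-‿cong (trans (*-identityˡ _) (reflexive (≡.cong (binom N) (ℕₚ.+-identityʳ j)))))) ⟩
    binom N j + (0# - binom N j)                  ≈⟨ solve 1 (λ a → a :+ (:0 :- a) := :0) refl _ ⟩
    0#                                            ∎
    where
    N = j ℕ.+ y
    G : ℕ → Carrier
    G k = B k * binom N (j ℕ.+ k ℕ.* U)
    GK : G K ≈ 0#
    GK = trans (*-congˡ (binom-> N _ (ℕₚ.<-≤-trans N<K (K≤i+K* U U≢0 K j)))) (zeroʳ _)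
    step : ∀ k → term N j y k ≈ G (suc k) - G k
    step k = begin
      A k * (b₁ - b₂) + (B (suc k) * b₃ - B k * b₁) ≈⟨ +-congʳ (*-congʳ (^-congʳ q (exponent₀ k U))) ⟩
      B k * (b₁ - b₂) + (B (suc k) * b₃ - B k * b₁)
        ≈⟨ solve 5 (λ B B′ b₁ b₂ b₃ → B :* (b₁ :- b₂) :+ (B′ :* b₃ :- B :* b₁) := B′ :* b₃ :- B :* b₂) refl _ _ b₁ b₂ b₃ ⟩
      B (suc k) * b₃ - B k * b₂ ∎
      where
      b₁ = binom N (y ℕ.+ suc k ℕ.* U)
      b₂ = binom N (j ℕ.+ (0 ℕ.+ k ℕ.* U))
      b₃ = binom N (j ℕ.+ suc k ℕ.* U)

-- Summation over a full period of starting abscissas at a root of unity.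

private
  block-exponent : ∀ k x U → suc k ℕ.* (suc x ℕ.+ suc k ℕ.* U) ≡ suc k ℕ.* suc x ℕ.+ (k ℕ.* (suc k ℕ.* U) ℕ.+ suc k ℕ.* U)
  block-exponent = solve-∀

  block-exponent₀ : ∀ k x U → suc k ℕ.* (x ℕ.+ k ℕ.* U) ≡ suc k ℕ.* x ℕ.+ k ℕ.* (suc k ℕ.* U)
  block-exponent₀ = solve-∀

  block-exponent₁ : ∀ k U → suc k ℕ.* (suc k ℕ.* U) ≡ k ℕ.* (suc k ℕ.* U) ℕ.+ suc k ℕ.* U
  block-exponent₁ = solve-∀

  times-suc : ∀ k i → suc k ℕ.* i ≡ k ℕ.* i ℕ.+ i
  times-suc k i = ℕₚ.+-comm i (k ℕ.* i)

module TraceSum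
  (R : CommutativeRing 0ℓ 0ℓ) (z : CommutativeRing.Carrier R)
  (cancel : PowersCancel R z)
  (n′ U K : ℕ) where
  open CommutativeRing R hiding (zero)
  open RingBasics R
  open QBinomial R z
  open import Relation.Binary.Reasoning.Setoid setoid

  private
    n N : ℕ
    n = suc n′
    N = n ℕ.+ n′

  h δ : ℕ → Carrier
  h i = binom N (n′ ℕ.+ i)
  δ i = binom (suc N) (n ℕ.+ i)

  γ : ℕ → Carrier
  γ κ = ∑ U (λ x → z ^ (κ ℕ.* suc x))

  -- The end point is (x₀ + n, n - 1), one step before the final north step that b_{2n} = 1
  -- prescribes.
  strip : ℕ → ℕ → Carrier
  strip x₀ c = Images.image R z cancel x₀ c K N n n′

  module _ (zⁿ≈1 : z ^ n ≈ 1#) where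

    z²ⁿ≈1 : z ^ suc N ≈ 1#
    z²ⁿ≈1 = trans (^-congʳ z (≡.sym (ℕₚ.+-suc n n′))) (trans (^-+ z n n) (trans (*-cong zⁿ≈1 zⁿ≈1) (*-identityˡ _)))

    δ-rec : ∀ i → δ i ≈ h i + z ^ i * h (suc i)
    δ-rec i = +-congˡ (*-cong
      (trans (^-+ z n i) (trans (*-congʳ zⁿ≈1) (*-identityˡ _)))
      (reflexive (≡.cong (binom N) (≡.sym (ℕₚ.+-suc n′ i)))))

    -- By `absorb`, (1 - z^(n+i)) [2n, n+i] has the factor 1 - z^(2n) = 0, and z^(n+i) = z^i. Powers
    -- of z^i in front of `δ i` can thus be dropped.
    z^*δ : ∀ i → z ^ i * δ i ≈ δ i
    z^*δ i = sym (x-y≈0⇒x≈y _ _ (begin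
      δ i - z ^ i * δ i             ≈⟨ solve 2 (λ x d → d :- x :* d := (:1 :- x) :* d) refl _ _ ⟩
      (1# - z ^ i) * δ i            ≈⟨ *-congʳ (+-congˡ (-‿cong (sym (trans (^-+ z n i) (trans (*-congʳ zⁿ≈1) (*-identityˡ _)))))) ⟩
      (1# - z ^ (n ℕ.+ i)) * δ i    ≈⟨ absorb N (n′ ℕ.+ i) ⟩
      (1# - z ^ suc N) * h i        ≈⟨ *-congʳ (x≈y⇒x-y≈0 (sym z²ⁿ≈1)) ⟩
      0# * h i                      ≈⟨ zeroˡ _ ⟩
      0#                            ∎))

    z^k*δ : ∀ k i → z ^ (k ℕ.* i) * δ i ≈ δ i
    z^k*δ zero    i = *-identityˡ _
    z^k*δ (suc k) i = trans (*-congʳ (^-+ z i (k ℕ.* i)))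
      (trans (*-assoc _ _ _) (trans (*-congˡ (z^k*δ k i)) (z^*δ i)))

    private
      F : ℕ → ℕ → Carrier
      F k i = z ^ (k ℕ.* i) * h i

      -- The four families of `term`: the `p` carry a plus sign and sit at indices independent of
      -- the starting point, the `m` carry a minus sign and sit at indices moving with it. `p₂` and
      -- `m₂` take c = U - x₀ as their argument.
      p₁ p₂ m₁ m₂ : ℕ → ℕ → Carrier
      p₁ k x = z ^ (suc k ℕ.* (x ℕ.+ k ℕ.* U)) * h (suc k ℕ.* U)
      p₂ k c = z ^ (suc k ℕ.* (c ℕ.+ suc k ℕ.* U)) * h (suc (suc k ℕ.* U))
      m₁ k x = z ^ (suc k ℕ.* (x ℕ.+ k ℕ.* U)) * h (suc (x ℕ.+ k ℕ.* U))
      m₂ k c = z ^ (k ℕ.* (c ℕ.+ k ℕ.* U)) * h (c ℕ.+ k ℕ.* U)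

      strip-explicit : ∀ x₀ c → x₀ ℕ.+ c ≡ U →
        strip x₀ c ≈ h 0 + ∑ K (λ k → (p₁ k x₀ - m₁ k x₀) + (p₂ k c - m₂ k c))
      strip-explicit x₀ c ≡.refl = +-cong (reflexive (≡.cong (binom N) (≡.sym (ℕₚ.+-identityʳ n′))))
        (∑-cong K (λ k _ → +-cong
          (trans (*-congˡ (+-congˡ (-‿cong (h-suc (x₀ ℕ.+ k ℕ.* U)))))
            (solve 3 (λ a b c → a :* (b :- c) := a :* b :- a :* c) refl _ _ _))
          (+-congʳ (*-congˡ (h-suc (suc k ℕ.* U))))))
        where
        h-suc : ∀ i → binom N (n ℕ.+ i) ≈ h (suc i)
        h-suc i = reflexive (≡.cong (binom N) (≡.sym (ℕₚ.+-suc n′ i)))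

      -- For i = x + kU these are the terms of x₀ = x and of c = x + 1, which share the coefficient
      -- `h (suc i)`. Pascal's rule also wants `h i`; adding and subtracting it leaves a difference
      -- in i, which telescopes.
      m-pair : ∀ k i → z ^ (suc k ℕ.* i) * h (suc i) + z ^ (k ℕ.* suc i) * h (suc i)
        ≈ δ i + (F k (suc i) - F k i)
      m-pair k i = begin
        z ^ (suc k ℕ.* i) * h (suc i) + F k (suc i)
          ≈⟨ +-congʳ (*-congʳ (trans (^-congʳ z (times-suc k i)) (^-+ z (k ℕ.* i) i))) ⟩
        (z ^ (k ℕ.* i) * z ^ i) * h (suc i) + F k (suc i)
          ≈⟨ solve 5 (λ a b c d f → (a :* b) :* c :+ f := a :* (d :+ b :* c) :+ (f :- a :* d)) refl _ _ _ (h i) _ ⟩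
        z ^ (k ℕ.* i) * (h i + z ^ i * h (suc i)) + (F k (suc i) - F k i)
          ≈⟨ +-congʳ (trans (*-congˡ (sym (δ-rec i))) (z^k*δ k i)) ⟩
        δ i + (F k (suc i) - F k i) ∎

      m-block : ∀ k → ∑ U (m₁ k) + ∑ U (λ x → m₂ k (suc x)) ≈
        ∑ U (λ x → δ (x ℕ.+ k ℕ.* U)) + (F k (suc k ℕ.* U) - F k (k ℕ.* U))
      m-block k = begin
        ∑ U (m₁ k) + ∑ U (λ x → m₂ k (suc x))
          ≈⟨ ∑-+ U _ _ ⟨
        ∑ U (λ x → m₁ k x + m₂ k (suc x))
          ≈⟨ ∑-cong U (λ x _ → m-pair k (x ℕ.+ k ℕ.* U)) ⟩
        ∑ U (λ x → δ (x ℕ.+ k ℕ.* U) + (F k (suc x ℕ.+ k ℕ.* U) - F k (x ℕ.+ k ℕ.* U)))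
          ≈⟨ ∑-+ U _ _ ⟩
        ∑ U (λ x → δ (x ℕ.+ k ℕ.* U)) + ∑ U (λ x → F k (suc x ℕ.+ k ℕ.* U) - F k (x ℕ.+ k ℕ.* U))
          ≈⟨ +-congˡ (∑-telescope U (λ x → F k (x ℕ.+ k ℕ.* U))) ⟩
        ∑ U (λ x → δ (x ℕ.+ k ℕ.* U)) + (F k (suc k ℕ.* U) - F k (k ℕ.* U)) ∎

      -- Here the index i = (k+1)U is fixed and `h i`, `h (suc i)` are the two neighbours needed for
      -- `δ i`. Their weights are off by a factor z^(k+1); the correction for this telescopes in x.
      p-pair : ∀ k x → p₁ k x + p₂ k (suc x) ≈
        z ^ (suc k ℕ.* suc x) * δ (suc k ℕ.* U) +
        (z ^ (suc k ℕ.* x) * F k (suc k ℕ.* U) - z ^ (suc k ℕ.* suc x) * F k (suc k ℕ.* U))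
      p-pair k x = begin
        p₁ k x + p₂ k (suc x)
          ≈⟨ +-cong (*-congʳ (trans (^-congʳ z (block-exponent₀ k x U)) (^-+ z (suc k ℕ.* x) (k ℕ.* i))))
                    (*-congʳ (trans (^-congʳ z (block-exponent k x U)) (trans (^-+ z (suc k ℕ.* suc x) (k ℕ.* i ℕ.+ i)) (*-congˡ (^-+ z (k ℕ.* i) i))))) ⟩
        (X * E) * h i + (X′ * (E * z ^ i)) * h (suc i)
          ≈⟨ solve 6 (λ X E hi X′ zi hi′ → (X :* E) :* hi :+ (X′ :* (E :* zi)) :* hi′
                := X′ :* (E :* (hi :+ zi :* hi′)) :+ (X :* (E :* hi) :- X′ :* (E :* hi)))
               refl X E (h i) X′ (z ^ i) (h (suc i)) ⟩
        X′ * (E * (h i + z ^ i * h (suc i))) + (X * F k i - X′ * F k i)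
          ≈⟨ +-congʳ (*-congˡ (trans (*-congˡ (sym (δ-rec i))) (z^k*δ k i))) ⟩
        X′ * δ i + (X * F k i - X′ * F k i) ∎
        where
        i = suc k ℕ.* U
        X = z ^ (suc k ℕ.* x)
        X′ = z ^ (suc k ℕ.* suc x)
        E = z ^ (k ℕ.* i)

      p-block : ∀ k → ∑ U (p₁ k) + ∑ U (λ x → p₂ k (suc x)) ≈
        γ (suc k) * δ (suc k ℕ.* U) + (F k (suc k ℕ.* U) - F (suc k) (suc k ℕ.* U))
      p-block k = begin
        ∑ U (p₁ k) + ∑ U (λ x → p₂ k (suc x))
          ≈⟨ ∑-+ U _ _ ⟨
        ∑ U (λ x → p₁ k x + p₂ k (suc x))
          ≈⟨ ∑-cong U (λ x _ → trans (p-pair k x) (+-congˡ (solve 2 (λ a b → a :- b := (:- b) :- (:- a)) refl _ _))) ⟩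
        ∑ U (λ x → z ^ (suc k ℕ.* suc x) * δ i + (G (suc x) - G x))
          ≈⟨ ∑-+ U _ _ ⟩
        ∑ U (λ x → z ^ (suc k ℕ.* suc x) * δ i) + ∑ U (λ x → G (suc x) - G x)
          ≈⟨ +-cong (∑-*ʳ U (δ i) _) (∑-telescope U G) ⟩
        γ (suc k) * δ i + (G U - G 0)
          ≈⟨ +-congˡ (trans (+-cong (-‿cong GU) (-‿cong (-‿cong G0))) (solve 2 (λ a b → (:- a) :- (:- b) := b :- a) refl _ _)) ⟩
        γ (suc k) * δ i + (F k i - F (suc k) i) ∎
        where
        i = suc k ℕ.* U
        G : ℕ → Carrier
        G x = - (z ^ (suc k ℕ.* x) * F k i)
        GU : z ^ (suc k ℕ.* U) * F k i ≈ F (suc k) i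
        GU = trans (sym (*-assoc _ _ _)) (*-congʳ (trans (*-comm _ _)
          (trans (sym (^-+ z (k ℕ.* i) i)) (^-congʳ z (≡.sym (block-exponent₁ k U))))))
        G0 : z ^ (suc k ℕ.* 0) * F k i ≈ F k i
        G0 = trans (*-congʳ (^-congʳ z (ℕₚ.*-zeroʳ (suc k)))) (*-identityˡ _)

    ∑-strip : N ℕ.< K → 1 ℕ.≤ U → ∑ U (λ x → strip x (U ℕ.∸ x)) ≈
      ∑ U (λ _ → h 0) + h 0 + ∑ K (λ k → γ (suc k) * δ (suc k ℕ.* U)) - ∑ (K ℕ.* U) δ
    ∑-strip N<K 1≤U = begin
      ∑ U (λ x → strip x (U ℕ.∸ x))
        ≈⟨ ∑-cong U (λ x x<U → strip-explicit x (U ℕ.∸ x) (ℕₚ.m+[n∸m]≡n (ℕₚ.<⇒≤ x<U))) ⟩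
      ∑ U (λ x → h 0 + ∑ K (λ k → t k x))
        ≈⟨ ∑-+ U _ _ ⟩
      ∑ U (λ _ → h 0) + ∑ U (λ x → ∑ K (λ k → t k x))
        ≈⟨ +-congˡ (trans (sym (∑-swap K U t)) (∑-cong K (λ k _ → block k))) ⟩
      ∑ U (λ _ → h 0) + ∑ K (λ k → (f₁ k - f₂ k) - (f₃ (suc k) - f₃ k))
        ≈⟨ +-congˡ (trans (∑-- K _ _) (+-cong (∑-- K f₁ f₂) (-‿cong (∑-telescope K f₃)))) ⟩
      ∑ U (λ _ → h 0) + (∑ K f₁ - ∑ K f₂ - (f₃ K - f₃ 0))
        ≈⟨ +-congˡ (+-cong (+-congˡ (-‿cong (sym (∑-blocks K U δ)))) (-‿cong (+-cong f₃K (-‿cong (*-identityˡ _))))) ⟩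
      ∑ U (λ _ → h 0) + (∑ K f₁ - ∑ (K ℕ.* U) δ - (0# - h 0))
        ≈⟨ solve 4 (λ a b c d → a :+ (b :- c :- (:0 :- d)) := a :+ d :+ b :- c) refl _ _ _ _ ⟩
      ∑ U (λ _ → h 0) + h 0 + ∑ K f₁ - ∑ (K ℕ.* U) δ ∎
      where
      t : ℕ → ℕ → Carrier
      t k x = (p₁ k x - m₁ k x) + (p₂ k (U ℕ.∸ x) - m₂ k (U ℕ.∸ x))
      f₁ f₂ f₃ : ℕ → Carrier
      f₁ k = γ (suc k) * δ (suc k ℕ.* U)
      f₂ k = ∑ U (λ x → δ (x ℕ.+ k ℕ.* U))
      f₃ k = F k (k ℕ.* U)
      f₃K : f₃ K ≈ 0#
      f₃K = trans (*-congˡ (binom-> N _ (ℕₚ.<-≤-trans N<K (K≤i+K* U 1≤U K n′)))) (zeroʳ _)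
      -- As x₀ runs over 0, ..., U - 1, c runs over 1, ..., U; this is what allows pairing x₀ = x
      -- with c = x + 1.
      reflect : ∀ (f : ℕ → Carrier) → ∑ U (λ x → f (U ℕ.∸ x)) ≈ ∑ U (λ x → f (suc x))
      reflect f = trans (∑-reverse U _) (∑-cong U (λ x x<U → reflexive (≡.cong f (ℕₚ.m∸[m∸n]≡n x<U))))
      -- The remainders left by `p-block` and `m-block` share F k ((k+1)U). Once it cancels, what is
      -- left is a difference in k and telescopes again.
      block : ∀ k → ∑ U (t k) ≈ (f₁ k - f₂ k) - (f₃ (suc k) - f₃ k)
      block k = begin
        ∑ U (t k)
          ≈⟨ ∑-+ U _ _ ⟩
        ∑ U (λ x → p₁ k x - m₁ k x) + ∑ U (λ x → p₂ k (U ℕ.∸ x) - m₂ k (U ℕ.∸ x))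
          ≈⟨ +-cong (∑-- U (p₁ k) (m₁ k)) (trans (reflect (λ c → p₂ k c - m₂ k c)) (∑-- U (λ x → p₂ k (suc x)) (λ x → m₂ k (suc x)))) ⟩
        (∑ U (p₁ k) - ∑ U (m₁ k)) + (∑ U (λ x → p₂ k (suc x)) - ∑ U (λ x → m₂ k (suc x)))
          ≈⟨ solve 4 (λ a b c d → (a :- b) :+ (c :- d) := (a :+ c) :- (b :+ d)) refl _ _ _ _ ⟩
        (∑ U (p₁ k) + ∑ U (λ x → p₂ k (suc x))) - (∑ U (m₁ k) + ∑ U (λ x → m₂ k (suc x)))
          ≈⟨ +-cong (p-block k) (-‿cong (m-block k)) ⟩
        (f₁ k + (f - f₃ (suc k))) - (f₂ k + (f - f₃ k))
          ≈⟨ solve 5 (λ a f b c d → (a :+ (f :- b)) :- (c :+ (f :- d)) := (a :- c) :- (b :- d)) refl _ _ _ _ _ ⟩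
        (f₁ k - f₂ k) - (f₃ (suc k) - f₃ k) ∎
        where
        f = F k (suc k ℕ.* U)

-- The q-Lucas theorem, and the reduction from n to n / d.

private
  double-row : ∀ m d → suc ((suc m ℕ.* suc d) ℕ.+ (d ℕ.+ m ℕ.* suc d)) ≡ (suc m ℕ.+ suc m) ℕ.* suc d
  double-row = solve-∀

  short-row : ∀ m d → (suc m ℕ.* suc d) ℕ.+ (d ℕ.+ m ℕ.* suc d) ≡ d ℕ.+ (suc m ℕ.+ m) ℕ.* suc d
  short-row = solve-∀

  vanish-index : ∀ m d s I → (suc m ℕ.* d) ℕ.+ (suc s ℕ.+ I ℕ.* d) ≡ suc s ℕ.+ (suc m ℕ.+ I) ℕ.* d
  vanish-index = solve-∀

  *-swap : ∀ a b c → a ℕ.* b ℕ.* c ≡ a ℕ.* c ℕ.* b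
  *-swap = solve-∀

module Lucas
  (R : CommutativeRing 0ℓ 0ℓ) (z : CommutativeRing.Carrier R) (d′ : ℕ)
  (domain : NoZeroDivisors R)
  (zᵈ≈1 : CommutativeRing._≈_ R (pow R z (suc d′)) (CommutativeRing.1# R))
  (z-prim : ∀ s → s ℕ.< d′ → ¬ CommutativeRing._≈_ R (pow R z (suc s)) (CommutativeRing.1# R))
  where
  open CommutativeRing R hiding (zero)
  open RingBasics R
  open QBinomial R z
  open QBinomial R 1# using () renaming (binom to binom₁) public
  open import Relation.Binary.Reasoning.Setoid setoid

  d : ℕ
  d = suc d′

  z^*d≈1 : ∀ I → z ^ (I ℕ.* d) ≈ 1#
  z^*d≈1 I = ^-*-1 z I d zᵈ≈1

  -- For s < d′ the indices suc s + I d are exactly those not divisible by d.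
  cancel-1-z : ∀ s I → s ℕ.< d′ → ∀ {x} → (1# - z ^ (suc s ℕ.+ I ℕ.* d)) * x ≈ 0# → x ≈ 0#
  cancel-1-z s I s<d′ e with domain _ _ e
  ... | inj₁ 1-z≈0 = ⊥-elim (z-prim s s<d′ (sym (trans (x-y≈0⇒x≈y _ _ 1-z≈0)
                       (trans (^-+ z (suc s) (I ℕ.* d)) (trans (*-congˡ (z^*d≈1 I)) (*-identityʳ _))))))
  ... | inj₂ x≈0   = x≈0

  -- By `absorb`, (1 - z^i) [N, i] is a multiple of 1 - z^N = 0, and 1 - z^i is a nonzero element of
  -- a domain when d does not divide i.
  binom-vanish : ∀ N s I → z ^ N ≈ 1# → s ℕ.< d′ → binom N (suc s ℕ.+ I ℕ.* d) ≈ 0#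
  binom-vanish zero    s I zᴺ≈1 s<d′ = refl
  binom-vanish (suc N) s I zᴺ≈1 s<d′ = cancel-1-z s I s<d′ (trans (absorb N (s ℕ.+ I ℕ.* d))
    (trans (*-congʳ (x≈y⇒x-y≈0 (sym zᴺ≈1))) (zeroˡ _)))

  mutual
    -- One Pascal step leads to row Md + d′, where `lucas-digit` applies. Since z^d = 1, the outcome
    -- is Pascal's rule for ordinary binomial coefficients.
    lucas : ∀ M I → binom (M ℕ.* d) (I ℕ.* d) ≈ binom₁ M I
    lucas M       zero    = refl
    lucas zero    (suc I) = refl
    lucas (suc M) (suc I) = begin
      binom (d′ ℕ.+ M ℕ.* d) (d′ ℕ.+ I ℕ.* d) + z ^ (suc I ℕ.* d) * binom (d′ ℕ.+ M ℕ.* d) (suc I ℕ.* d)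
        ≈⟨ +-cong (lucas-digit M d′ ℕₚ.≤-refl I d′ ℕₚ.≤-refl) (*-cong (z^*d≈1 (suc I)) (lucas-digit M d′ ℕₚ.≤-refl (suc I) 0 ℕ.z≤n)) ⟩
      binom₁ M I * binom d′ d′ + 1# * (binom₁ M (suc I) * 1#)
        ≈⟨ +-cong (trans (*-congˡ (binom-refl d′)) (*-identityʳ _)) (*-cong (sym (1^ (suc I))) (*-identityʳ _)) ⟩
      binom₁ M I + 1# ^ suc I * binom₁ M (suc I) ∎

    lucas-digit : ∀ M r → r ℕ.≤ d′ → ∀ I s → s ℕ.≤ d′ →
      binom (r ℕ.+ M ℕ.* d) (s ℕ.+ I ℕ.* d) ≈ binom₁ M I * binom r s
    lucas-digit M zero    r≤d′ I zero    _    = trans (lucas M I) (sym (*-identityʳ _))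
    lucas-digit M zero    r≤d′ I (suc s) s<d′ = trans (binom-vanish (M ℕ.* d) s I (z^*d≈1 M) s<d′) (sym (zeroʳ _))
    lucas-digit M (suc r) r<d′ zero zero _ = sym (*-identityˡ _)
    -- The last digit of the lower index borrows: the preceding index has digit d′, where [r, d′] =
    -- 0 because r < d′.
    lucas-digit M (suc r) r<d′ (suc I) zero _ = begin
      binom (r ℕ.+ M ℕ.* d) (d′ ℕ.+ I ℕ.* d) + z ^ (suc I ℕ.* d) * binom (r ℕ.+ M ℕ.* d) (suc I ℕ.* d)
        ≈⟨ +-cong (trans (lucas-digit M r (ℕₚ.<⇒≤ r<d′) I d′ ℕₚ.≤-refl) (trans (*-congˡ (binom-> r d′ r<d′)) (zeroʳ _)))
                  (*-cong (z^*d≈1 (suc I)) (lucas-digit M r (ℕₚ.<⇒≤ r<d′) (suc I) 0 ℕ.z≤n)) ⟩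
      0# + 1# * (binom₁ M (suc I) * 1#)
        ≈⟨ trans (+-identityˡ _) (*-identityˡ _) ⟩
      binom₁ M (suc I) * 1# ∎
    lucas-digit M (suc r) r<d′ I (suc s) s<d′ = begin
      binom (r ℕ.+ M ℕ.* d) (s ℕ.+ I ℕ.* d) + z ^ (suc s ℕ.+ I ℕ.* d) * binom (r ℕ.+ M ℕ.* d) (suc s ℕ.+ I ℕ.* d)
        ≈⟨ +-cong (lucas-digit M r (ℕₚ.<⇒≤ r<d′) I s (ℕₚ.<⇒≤ s<d′))
                  (*-cong (trans (^-+ z (suc s) (I ℕ.* d)) (trans (*-congˡ (z^*d≈1 I)) (*-identityʳ _)))
                          (lucas-digit M r (ℕₚ.<⇒≤ r<d′) I (suc s) s<d′)) ⟩
      binom₁ M I * binom r s + z ^ suc s * (binom₁ M I * binom r (suc s))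
        ≈⟨ solve 4 (λ b a z c → b :* a :+ z :* (b :* c) := b :* (a :+ z :* c)) refl _ _ _ _ ⟩
      binom₁ M I * binom (suc r) (suc s) ∎

  ∑-multiples : ∀ K φ → (∀ s I → s ℕ.< d′ → φ (suc s ℕ.+ I ℕ.* d) ≈ 0#) →
    ∑ (K ℕ.* d) φ ≈ ∑ K (λ I → φ (I ℕ.* d))
  ∑-multiples K φ vanish = trans (∑-blocks K d φ) (∑-cong K (λ I _ →
    trans (∑-first d′ _) (trans (+-congˡ (∑-0 d′ (λ s s<d′ → vanish s I s<d′))) (+-identityʳ _))))

  module _ (cancel : PowersCancel R z) (m′ U K : ℕ) where
    private
      n′ n : ℕ
      n′ = d′ ℕ.+ m′ ℕ.* d
      n = suc n′
    open TraceSum R z cancel n′ U (K ℕ.* d)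

    g : ℕ → Carrier
    g I = binom₁ (suc m′ ℕ.+ suc m′) (suc m′ ℕ.+ I)

    private
      δ-vanish : ∀ s I → s ℕ.< d′ → δ (suc s ℕ.+ I ℕ.* d) ≈ 0#
      δ-vanish s I s<d′ = trans
        (reflexive (≡.cong (binom (suc (n ℕ.+ n′))) (vanish-index m′ d s I)))
        (binom-vanish (suc (n ℕ.+ n′)) s (suc m′ ℕ.+ I) (z²ⁿ≈1 (z^*d≈1 (suc m′))) s<d′)

      δ-multiple : ∀ I → δ (I ℕ.* d) ≈ g I
      δ-multiple I = trans
        (reflexive (≡.cong₂ binom (double-row m′ d′) (≡.sym (ℕₚ.*-distribʳ-+ d (suc m′) I))))
        (lucas (suc m′ ℕ.+ suc m′) (suc m′ ℕ.+ I))

      h0 : h 0 ≈ binom₁ (suc m′ ℕ.+ m′) m′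
      h0 = trans
        (reflexive (≡.cong₂ binom (short-row m′ d′) (ℕₚ.+-identityʳ n′)))
        (trans (lucas-digit (suc m′ ℕ.+ m′) d′ ℕₚ.≤-refl m′ d′ ℕₚ.≤-refl)
          (trans (*-congˡ (binom-refl d′)) (*-identityʳ _)))

      Γ : ℕ → Carrier
      Γ κ = γ κ * δ (κ ℕ.* U)

      γ-geometric : ∀ κ → (1# - z ^ κ) * γ κ ≈ z ^ κ * (1# - z ^ (κ ℕ.* U))
      γ-geometric κ = begin
        (1# - z ^ κ) * γ κ
          ≈⟨ ∑-*ˡ U _ _ ⟨
        ∑ U (λ x → (1# - z ^ κ) * z ^ (κ ℕ.* suc x))
          ≈⟨ ∑-cong U (λ x _ → trans
               (solve 2 (λ a b → (:1 :- a) :* b := (:- (a :* b)) :- (:- b)) refl (z ^ κ) (z ^ (κ ℕ.* suc x)))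
               (+-congʳ (-‿cong (trans (sym (^-+ z κ _)) (^-congʳ z (≡.sym (ℕₚ.*-suc κ (suc x)))))))) ⟩
        ∑ U (λ x → - z ^ (κ ℕ.* suc (suc x)) - - z ^ (κ ℕ.* suc x))
          ≈⟨ ∑-telescope U (λ x → - z ^ (κ ℕ.* suc x)) ⟩
        - z ^ (κ ℕ.* suc U) - - z ^ (κ ℕ.* 1)
          ≈⟨ +-cong (-‿cong (trans (^-congʳ z (ℕₚ.*-suc κ U)) (^-+ z κ _))) (-‿cong (-‿cong (^-congʳ z (ℕₚ.*-identityʳ κ)))) ⟩
        - (z ^ κ * z ^ (κ ℕ.* U)) - - z ^ κ
          ≈⟨ solve 2 (λ a b → (:- (a :* b)) :- (:- a) := a :* (:1 :- b)) refl _ _ ⟩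
        z ^ κ * (1# - z ^ (κ ℕ.* U)) ∎

      -- Multiplied by 1 - z^κ, the geometric sum `γ κ` yields the factor 1 - z^(κU), which
      -- annihilates `δ (κU)` by `z^*δ`; the multiplier can be cancelled as d does not divide κ.
      Γ-vanish : ∀ s I → s ℕ.< d′ → Γ (suc s ℕ.+ I ℕ.* d) ≈ 0#
      Γ-vanish s I s<d′ = cancel-1-z s I s<d′ (begin
        (1# - z ^ κ) * (γ κ * δ i)            ≈⟨ *-assoc _ _ _ ⟨
        (1# - z ^ κ) * γ κ * δ i              ≈⟨ *-congʳ (γ-geometric κ) ⟩
        z ^ κ * (1# - z ^ i) * δ i            ≈⟨ solve 3 (λ a b c → a :* (:1 :- b) :* c := a :* (c :- b :* c)) refl _ _ _ ⟩
        z ^ κ * (δ i - z ^ i * δ i)           ≈⟨ *-congˡ (x≈y⇒x-y≈0 (sym (z^*δ (z^*d≈1 (suc m′)) i))) ⟩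
        z ^ κ * 0#                            ≈⟨ zeroʳ _ ⟩
        0#                                    ∎)
        where
        κ = suc s ℕ.+ I ℕ.* d
        i = κ ℕ.* U

      Γ-multiple : ∀ I → Γ (I ℕ.* d) ≈ ∑ U (λ _ → 1#) * g (I ℕ.* U)
      Γ-multiple I = *-cong
        (∑-cong U (λ x _ → trans (^-congʳ z (*-swap I d (suc x))) (z^*d≈1 (I ℕ.* suc x))))
        (trans (reflexive (≡.cong δ (*-swap I d U))) (δ-multiple (I ℕ.* U)))

    reduced : Carrier
    reduced = ∑ U (λ _ → binom₁ (suc m′ ℕ.+ m′) m′) + binom₁ (suc m′ ℕ.+ m′) m′
      + (∑ K (λ I → ∑ U (λ _ → 1#) * g (I ℕ.* U)) - ∑ U (λ _ → 1#) * g 0) - ∑ (K ℕ.* U) g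

    ∑-strip-reduced : n ℕ.+ n′ ℕ.< K ℕ.* d → 1 ℕ.≤ U → ∑ U (λ x → strip x (U ℕ.∸ x)) ≈ reduced
    ∑-strip-reduced N<Kd 1≤U = trans (∑-strip (z^*d≈1 (suc m′)) N<Kd 1≤U)
      (+-cong (+-cong (+-cong (∑-cong U (λ _ _ → h0)) h0) Γ-sum) (-‿cong δ-sum))
      where
      δ-sum : ∑ (K ℕ.* d ℕ.* U) δ ≈ ∑ (K ℕ.* U) g
      δ-sum = trans (reflexive (≡.cong (λ L → ∑ L δ) (*-swap K d U)))
        (trans (∑-multiples (K ℕ.* U) δ δ-vanish) (∑-cong (K ℕ.* U) (λ I _ → δ-multiple I)))
      δ-end : δ (K ℕ.* d ℕ.* U) ≈ 0#
      δ-end = binom-> _ _ (ℕ.s≤s (ℕₚ.<-≤-trans N<Kd (K≤i+K* U 1≤U (K ℕ.* d) n′)))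
      Γ-sum : ∑ (K ℕ.* d) (λ k → Γ (suc k)) ≈ ∑ K (λ I → ∑ U (λ _ → 1#) * g (I ℕ.* U)) - ∑ U (λ _ → 1#) * g 0
      Γ-sum = begin
        ∑ (K ℕ.* d) (λ k → Γ (suc k))
          -- `∑-strip` sums from κ = 1 to K d, whereas `∑-multiples` wants 0 ≤ κ < K d. The term κ =
          -- 0 is added and taken off again, and the term κ = K d vanishes by `δ-end`.
          ≈⟨ solve 2 (λ a b → a := b :+ a :- b) refl _ (Γ 0) ⟩
        Γ 0 + ∑ (K ℕ.* d) (λ k → Γ (suc k)) - Γ 0
          ≈⟨ +-congʳ (∑-first (K ℕ.* d) Γ) ⟨
        ∑ (K ℕ.* d) Γ + Γ (K ℕ.* d) - Γ 0
          ≈⟨ +-cong (trans (+-congˡ (trans (*-congˡ δ-end) (zeroʳ _))) (+-identityʳ _)) (-‿cong (Γ-multiple 0)) ⟩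
        ∑ (K ℕ.* d) Γ - ∑ U (λ _ → 1#) * g 0
          ≈⟨ +-congʳ (trans (∑-multiples K Γ Γ-vanish) (∑-cong K (λ I _ → Γ-multiple I))) ⟩
        ∑ K (λ I → ∑ U (λ _ → 1#) * g (I ℕ.* U)) - ∑ U (λ _ → 1#) * g 0 ∎

-- Words under appending a letter, and sums over words.

countFalse : List Bool → ℕ
countFalse []           = 0
countFalse (true ∷ bs)  = countFalse bs
countFalse (false ∷ bs) = suc (countFalse bs)

countFalse+countTrue : ∀ b → countFalse b ℕ.+ countTrue b ≡ length b
countFalse+countTrue []           = ≡.refl
countFalse+countTrue (true ∷ bs)  = ≡.trans (ℕₚ.+-suc _ _) (≡.cong suc (countFalse+countTrue bs))
countFalse+countTrue (false ∷ bs) = ≡.cong suc (countFalse+countTrue bs)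

countTrue-∷ʳ-true : ∀ b → countTrue (b ∷ʳ true) ≡ suc (countTrue b)
countTrue-∷ʳ-true []           = ≡.refl
countTrue-∷ʳ-true (true ∷ bs)  = ≡.cong suc (countTrue-∷ʳ-true bs)
countTrue-∷ʳ-true (false ∷ bs) = countTrue-∷ʳ-true bs

countTrue-∷ʳ-false : ∀ b → countTrue (b ∷ʳ false) ≡ countTrue b
countTrue-∷ʳ-false []           = ≡.refl
countTrue-∷ʳ-false (true ∷ bs)  = ≡.cong suc (countTrue-∷ʳ-false bs)
countTrue-∷ʳ-false (false ∷ bs) = countTrue-∷ʳ-false bs

lastIsTrue-∷ʳ : ∀ b c → lastIsTrue (b ∷ʳ c) ≡ c
lastIsTrue-∷ʳ []           c = ≡.refl
lastIsTrue-∷ʳ (_ ∷ [])     c = ≡.refl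
lastIsTrue-∷ʳ (_ ∷ y ∷ bs) c = lastIsTrue-∷ʳ (y ∷ bs) c

lastIsTrue⇒countTrue≢0 : ∀ b → lastIsTrue b ≡ true → countTrue b ≢ 0
lastIsTrue⇒countTrue≢0 (true ∷ [])     e ()
lastIsTrue⇒countTrue≢0 (true ∷ _ ∷ _)  e ()
lastIsTrue⇒countTrue≢0 (false ∷ y ∷ b) e = lastIsTrue⇒countTrue≢0 (y ∷ b) e

majFrom-∷ʳ-true : ∀ i b → majFrom i (b ∷ʳ true) ≡ majFrom i b
majFrom-∷ʳ-true i []           = ≡.refl
majFrom-∷ʳ-true i (true ∷ [])  = ≡.refl
majFrom-∷ʳ-true i (false ∷ []) = ≡.refl
majFrom-∷ʳ-true i (x ∷ y ∷ bs) = ≡.cong (_ ℕ.+_) (majFrom-∷ʳ-true (suc i) (y ∷ bs))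

-- A final east step creates a descent exactly when it follows a north step. With the first letter
-- at position i + 1, the last letter of b is at position i + length b.
majFrom-∷ʳ-false : ∀ i b → majFrom (suc i) (b ∷ʳ false) ≡
  majFrom (suc i) b ℕ.+ (if lastIsTrue b then i ℕ.+ length b else 0)
majFrom-∷ʳ-false i []           = ≡.refl
majFrom-∷ʳ-false i (true ∷ [])  = ≡.trans (ℕₚ.+-identityʳ _) (ℕₚ.+-comm 1 i)
majFrom-∷ʳ-false i (false ∷ []) = ≡.refl
majFrom-∷ʳ-false i (x ∷ y ∷ bs) = ≡.trans
  (≡.cong (e ℕ.+_) (majFrom-∷ʳ-false (suc i) (y ∷ bs)))
  (≡.trans (≡.sym (ℕₚ.+-assoc e _ _))
    (≡.cong (λ l → e ℕ.+ majFrom (suc (suc i)) (y ∷ bs) ℕ.+ (if lastIsTrue (y ∷ bs) then l else 0))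
      (≡.sym (ℕₚ.+-suc i _))))
  where e = if x ∧ not y then suc i else 0

module _ (w : ℕ) where
  avoids-∷ʳ-true : ∀ x y b → avoids w x y (b ∷ʳ true) ≡
    avoids w x y b ∧ okPoint w (x ℕ.+ countFalse b) (suc (y ℕ.+ countTrue b))
  avoids-∷ʳ-true x y [] rewrite ℕₚ.+-identityʳ x | ℕₚ.+-identityʳ y = ≡.refl
  avoids-∷ʳ-true x y (true ∷ bs)
    rewrite avoids-∷ʳ-true x (suc y) bs | ℕₚ.+-suc y (countTrue bs) =
      ≡.sym (Boolₚ.∧-assoc (okPoint w x y) (avoids w x (suc y) bs) _)
  avoids-∷ʳ-true x y (false ∷ bs)
    rewrite avoids-∷ʳ-true (suc x) y bs | ℕₚ.+-suc x (countFalse bs) =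
      ≡.sym (Boolₚ.∧-assoc (okPoint w x y) (avoids w (suc x) y bs) _)

  avoids-∷ʳ-false : ∀ x y b → avoids w x y (b ∷ʳ false) ≡
    avoids w x y b ∧ okPoint w (suc (x ℕ.+ countFalse b)) (y ℕ.+ countTrue b)
  avoids-∷ʳ-false x y [] rewrite ℕₚ.+-identityʳ x | ℕₚ.+-identityʳ y = ≡.refl
  avoids-∷ʳ-false x y (true ∷ bs)
    rewrite avoids-∷ʳ-false x (suc y) bs | ℕₚ.+-suc y (countTrue bs) =
      ≡.sym (Boolₚ.∧-assoc (okPoint w x y) (avoids w x (suc y) bs) _)
  avoids-∷ʳ-false x y (false ∷ bs)
    rewrite avoids-∷ʳ-false (suc x) y bs | ℕₚ.+-suc x (countFalse bs) =
      ≡.sym (Boolₚ.∧-assoc (okPoint w x y) (avoids w (suc x) y bs) _)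

  avoids-end : ∀ x y b → okPoint w (x ℕ.+ countFalse b) (y ℕ.+ countTrue b) ≡ false → avoids w x y b ≡ false
  avoids-end x y [] e rewrite ℕₚ.+-identityʳ x | ℕₚ.+-identityʳ y = e
  avoids-end x y (true ∷ bs) e
    rewrite ℕₚ.+-suc y (countTrue bs) | avoids-end x (suc y) bs e = Boolₚ.∧-zeroʳ (okPoint w x y)
  avoids-end x y (false ∷ bs) e
    rewrite ℕₚ.+-suc x (countFalse bs) | avoids-end (suc x) y bs e = Boolₚ.∧-zeroʳ (okPoint w x y)

≡ᵇ-refl : ∀ m → (m ≡ᵇ m) ≡ true
≡ᵇ-refl zero    = ≡.refl
≡ᵇ-refl (suc m) = ≡ᵇ-refl m

≢⇒≡ᵇ-false : ∀ m n → m ≢ n → (m ≡ᵇ n) ≡ false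
≢⇒≡ᵇ-false m n m≢n with m ≡ᵇ n in e
... | true  = ⊥-elim (m≢n (ℕₚ.≡ᵇ⇒≡ m n (≡.subst T (≡.sym e) tt)))
... | false = ≡.refl

okPoint-inside : ∀ w x y → y ℕ.< x → x ℕ.< y ℕ.+ (w ℕ.+ 2) → okPoint w x y ≡ true
okPoint-inside w x y y<x x<y+U
  rewrite ≢⇒≡ᵇ-false x y (λ x≡y → ℕₚ.<⇒≢ y<x (≡.sym x≡y))
        | ≢⇒≡ᵇ-false x (y ℕ.+ (w ℕ.+ 2)) (ℕₚ.<⇒≢ x<y+U) = ≡.refl

okPoint-diagonal : ∀ w x → okPoint w x x ≡ false
okPoint-diagonal w x rewrite ≡ᵇ-refl x = ≡.refl

okPoint-upper : ∀ w y → okPoint w (y ℕ.+ (w ℕ.+ 2)) y ≡ false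
okPoint-upper w y rewrite ≡ᵇ-refl (y ℕ.+ (w ℕ.+ 2)) = Boolₚ.∧-zeroʳ _

module ListSums (R : CommutativeRing 0ℓ 0ℓ) where
  open CommutativeRing R hiding (zero)
  open RingBasics R
  open import Relation.Binary.Reasoning.Setoid setoid

  ι : Bool → Carrier
  ι b = if b then 1# else 0#

  ι-∧ : ∀ a b → ι (a ∧ b) ≈ ι a * ι b
  ι-∧ true  b = sym (*-identityˡ _)
  ι-∧ false b = sym (zeroˡ _)

  lsum : ∀ {A : Set} → (A → Carrier) → List A → Carrier
  lsum f []       = 0#
  lsum f (x ∷ xs) = f x + lsum f xs

  module _ {A : Set} where
    lsum-cong : ∀ {f g : A → Carrier} xs → (∀ x → f x ≈ g x) → lsum f xs ≈ lsum g xs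
    lsum-cong []       e = refl
    lsum-cong (x ∷ xs) e = +-cong (e x) (lsum-cong xs e)

    lsum-++ : ∀ (f : A → Carrier) xs ys → lsum f (xs ++ ys) ≈ lsum f xs + lsum f ys
    lsum-++ f []       ys = sym (+-identityˡ _)
    lsum-++ f (x ∷ xs) ys = trans (+-congˡ (lsum-++ f xs ys)) (sym (+-assoc _ _ _))

    lsum-map : ∀ {B : Set} (f : A → Carrier) (g : B → A) xs → lsum f (map g xs) ≈ lsum (λ x → f (g x)) xs
    lsum-map f g []       = refl
    lsum-map f g (x ∷ xs) = +-congˡ (lsum-map f g xs)

    lsum-concatMap : ∀ {B : Set} (f : A → Carrier) (g : B → List A) xs →
      lsum f (concatMap g xs) ≈ lsum (λ x → lsum f (g x)) xs
    lsum-concatMap f g []       = refl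
    lsum-concatMap f g (x ∷ xs) = trans (lsum-++ f (g x) (concatMap g xs)) (+-congˡ (lsum-concatMap f g xs))

    lsum-filter : ∀ (f : A → Carrier) p xs → lsum f (filterᵇ p xs) ≈ lsum (λ x → ι (p x) * f x) xs
    lsum-filter f p []       = refl
    lsum-filter f p (x ∷ xs) with p x
    ... | true  = +-cong (sym (*-identityˡ _)) (lsum-filter f p xs)
    ... | false = trans (lsum-filter f p xs) (trans (sym (+-identityˡ _)) (+-congʳ (sym (zeroˡ _))))

    natR-length : ∀ (xs : List A) → natR R (length xs) ≈ lsum (λ _ → 1#) xs
    natR-length []       = refl
    natR-length (x ∷ xs) = +-congˡ (natR-length xs)

  evalExps-lsum : ∀ es x → evalExps R es x ≈ lsum (x ^_) es
  evalExps-lsum []       x = refl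
  evalExps-lsum (e ∷ es) x = +-congˡ (evalExps-lsum es x)

  -- A recursive form of the sum over `allBools`, so that words can be split at the first letter by
  -- definition and at the last letter by `words-∷ʳ`.
  words : ℕ → (List Bool → Carrier) → Carrier
  words zero    φ = φ []
  words (suc m) φ = words m (λ b → φ (true ∷ b)) + words m (λ b → φ (false ∷ b))

  words-allBools : ∀ m φ → lsum φ (allBools m) ≈ words m φ
  words-allBools zero    φ = +-identityʳ _
  words-allBools (suc m) φ = begin
    lsum φ (allBools (suc m))
      ≈⟨ lsum-concatMap φ (λ b → map (b ∷_) (allBools m)) (true ∷ false ∷ []) ⟩
    lsum φ (map (true ∷_) (allBools m)) + (lsum φ (map (false ∷_) (allBools m)) + 0#)
      ≈⟨ +-cong (lsum-map φ _ (allBools m)) (trans (+-identityʳ _) (lsum-map φ _ (allBools m))) ⟩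
    lsum (λ b → φ (true ∷ b)) (allBools m) + lsum (λ b → φ (false ∷ b)) (allBools m)
      ≈⟨ +-cong (words-allBools m _) (words-allBools m _) ⟩
    words (suc m) φ ∎

  words-cong : ∀ m {φ ψ : List Bool → Carrier} → (∀ b → length b ≡ m → φ b ≈ ψ b) → words m φ ≈ words m ψ
  words-cong zero    e = e [] ≡.refl
  words-cong (suc m) e = +-cong (words-cong m (λ b l → e _ (≡.cong suc l))) (words-cong m (λ b l → e _ (≡.cong suc l)))

  words-*ˡ : ∀ m c φ → words m (λ b → c * φ b) ≈ c * words m φ
  words-*ˡ zero    c φ = refl
  words-*ˡ (suc m) c φ = trans (+-cong (words-*ˡ m c _) (words-*ˡ m c _)) (sym (distribˡ _ _ _))

  words-0 : ∀ m {φ : List Bool → Carrier} → (∀ b → length b ≡ m → φ b ≈ 0#) → words m φ ≈ 0#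
  words-0 m e = trans (words-cong m (λ b l → trans (e b l) (sym (zeroˡ 0#)))) (trans (words-*ˡ m 0# (λ _ → 0#)) (zeroˡ _))

  words-∷ʳ : ∀ m φ → words (suc m) φ ≈ words m (λ b → φ (b ∷ʳ true)) + words m (λ b → φ (b ∷ʳ false))
  words-∷ʳ zero    φ = refl
  words-∷ʳ (suc m) φ = trans (+-cong (words-∷ʳ m (λ b → φ (true ∷ b))) (words-∷ʳ m (λ b → φ (false ∷ b))))
    (solve 4 (λ a b c d → (a :+ b) :+ (c :+ d) := (a :+ c) :+ (b :+ d)) refl _ _ _ _)

countFalse≡ : ∀ b {N j} → length b ≡ N → N ≡ j ℕ.+ countTrue b → countFalse b ≡ j
countFalse≡ b l e = ℕₚ.+-cancelʳ-≡ (countTrue b) _ _ (≡.trans (countFalse+countTrue b) (≡.trans l e))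

-- Strip paths weighted by maj are counted by the image sum.

module StripPaths (R : CommutativeRing 0ℓ 0ℓ) (q : CommutativeRing.Carrier R) (w x₀ : ℕ) where
  open CommutativeRing R hiding (zero)
  open RingBasics R
  open ListSums R
  open import Relation.Binary.Reasoning.Setoid setoid

  wt : ℕ → List Bool → Carrier
  wt y b = ι (avoids w x₀ 0 b ∧ (countTrue b ≡ᵇ y)) * q ^ maj b

  paths : ℕ → ℕ → Carrier
  paths N y = words N (wt y)

  wt-≢ : ∀ y b → countTrue b ≢ y → wt y b ≈ 0#
  wt-≢ y b ne rewrite ≢⇒≡ᵇ-false (countTrue b) y ne | Boolₚ.∧-zeroʳ (avoids w x₀ 0 b) = zeroˡ _

  wt-≡ : ∀ b → wt (countTrue b) b ≈ ι (avoids w x₀ 0 b) * q ^ maj b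
  wt-≡ b rewrite ≡ᵇ-refl (countTrue b) | Boolₚ.∧-identityʳ (avoids w x₀ 0 b) = refl

  ok : ℕ → ℕ → Carrier
  ok j y = ι (okPoint w (x₀ ℕ.+ j) y)

  wt-∷ʳ-true : ∀ N j y → N ≡ j ℕ.+ y → ∀ b → length b ≡ N → wt (suc y) (b ∷ʳ true) ≈ ok j (suc y) * wt y b
  wt-∷ʳ-true N j y N≡ b l with countTrue b ℕₚ.≟ y
  ... | no ne = trans
    (wt-≢ (suc y) (b ∷ʳ true) (λ e → ne (ℕₚ.suc-injective (≡.trans (≡.sym (countTrue-∷ʳ-true b)) e))))
    (sym (trans (*-congˡ (wt-≢ y b ne)) (zeroʳ _)))
  ... | yes ≡.refl = begin
    wt (suc y) (b ∷ʳ true)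
      ≈⟨ reflexive (≡.cong (λ t → wt t (b ∷ʳ true)) (≡.sym (countTrue-∷ʳ-true b))) ⟩
    wt (countTrue (b ∷ʳ true)) (b ∷ʳ true)
      ≈⟨ wt-≡ (b ∷ʳ true) ⟩
    ι (avoids w x₀ 0 (b ∷ʳ true)) * q ^ maj (b ∷ʳ true)
      ≈⟨ *-cong (reflexive (≡.cong ι (avoids-∷ʳ-true w x₀ 0 b))) (^-congʳ q (majFrom-∷ʳ-true 1 b)) ⟩
    ι (avoids w x₀ 0 b ∧ okPoint w (x₀ ℕ.+ countFalse b) (suc y)) * q ^ maj b
      ≈⟨ *-congʳ (ι-∧ (avoids w x₀ 0 b) _) ⟩
    ι (avoids w x₀ 0 b) * ok (countFalse b) (suc y) * q ^ maj b
      ≈⟨ solve 3 (λ a b c → a :* b :* c := b :* (a :* c)) refl _ _ _ ⟩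
    ok (countFalse b) (suc y) * (ι (avoids w x₀ 0 b) * q ^ maj b)
      ≈⟨ *-cong (reflexive (≡.cong (λ i → ok i (suc y)) (countFalse≡ b l N≡))) (sym (wt-≡ b)) ⟩
    ok j (suc y) * wt y b ∎

  wt-∷ʳ-false : ∀ N j y → N ≡ j ℕ.+ y → ∀ b → length b ≡ N →
    wt y (b ∷ʳ false) ≈ ok (suc j) y * (q ^ (if lastIsTrue b then N else 0) * wt y b)
  wt-∷ʳ-false N j y N≡ b l with countTrue b ℕₚ.≟ y
  ... | no ne = trans
    (wt-≢ y (b ∷ʳ false) (λ e → ne (≡.trans (≡.sym (countTrue-∷ʳ-false b)) e)))
    (sym (trans (*-congˡ (trans (*-congˡ (wt-≢ y b ne)) (zeroʳ _))) (zeroʳ _)))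
  ... | yes ≡.refl = begin
    wt y (b ∷ʳ false)
      ≈⟨ reflexive (≡.cong (λ t → wt t (b ∷ʳ false)) (≡.sym (countTrue-∷ʳ-false b))) ⟩
    wt (countTrue (b ∷ʳ false)) (b ∷ʳ false)
      ≈⟨ wt-≡ (b ∷ʳ false) ⟩
    ι (avoids w x₀ 0 (b ∷ʳ false)) * q ^ maj (b ∷ʳ false)
      ≈⟨ *-cong (reflexive (≡.cong ι (avoids-∷ʳ-false w x₀ 0 b)))
                (trans (^-congʳ q (majFrom-∷ʳ-false 0 b)) (trans (^-congʳ q (≡.cong (λ t → maj b ℕ.+ (if lastIsTrue b then t else 0)) l)) (^-+ q (maj b) _))) ⟩
    ι (avoids w x₀ 0 b ∧ okPoint w (suc (x₀ ℕ.+ countFalse b)) y) * (q ^ maj b * Q)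
      ≈⟨ *-congʳ (ι-∧ (avoids w x₀ 0 b) _) ⟩
    ι (avoids w x₀ 0 b) * ι (okPoint w (suc (x₀ ℕ.+ countFalse b)) y) * (q ^ maj b * Q)
      ≈⟨ solve 4 (λ a b c d → a :* b :* (c :* d) := b :* (d :* (a :* c))) refl _ _ _ _ ⟩
    ι (okPoint w (suc (x₀ ℕ.+ countFalse b)) y) * (Q * (ι (avoids w x₀ 0 b) * q ^ maj b))
      ≈⟨ *-cong (reflexive (≡.cong (λ i → ι (okPoint w i y)) (≡.trans (≡.cong (λ i → suc (x₀ ℕ.+ i)) (countFalse≡ b l N≡)) (≡.sym (ℕₚ.+-suc x₀ j)))))
                (*-congˡ (sym (wt-≡ b))) ⟩
    ok (suc j) y * (Q * wt y b) ∎
    where Q = q ^ (if lastIsTrue b then N else 0)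

  paths-north : ∀ N j y → N ≡ j ℕ.+ y → words N (λ b → wt (suc y) (b ∷ʳ true)) ≈ ok j (suc y) * paths N y
  paths-north N j y N≡ = trans (words-cong N (wt-∷ʳ-true N j y N≡)) (words-*ˡ N _ _)

  -- A final north step costs nothing. A final east step costs q^(N+1) after a north step and
  -- nothing after an east step: weight 1 for all prefixes, plus q^(N+1) - 1 for those ending north.
  -- The latter come from `paths N y` through the corner (x₀ + j, y + 1), whence the inner factor
  -- `ok j (suc y)`.
  paths-rec : ∀ N j y → N ≡ j ℕ.+ y → paths (suc (suc N)) (suc y) ≈
    ok (suc j) (suc y) * (paths (suc N) y + (paths (suc N) (suc y) + (q ^ suc N - 1#) * (ok j (suc y) * paths N y)))
  paths-rec N j y N≡ = begin
    paths (suc (suc N)) (suc y)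
      ≈⟨ words-∷ʳ (suc N) (wt (suc y)) ⟩
    words (suc N) (λ b → wt (suc y) (b ∷ʳ true)) + words (suc N) (λ b → wt (suc y) (b ∷ʳ false))
      ≈⟨ +-cong (paths-north (suc N) (suc j) y (≡.cong suc N≡))
                (trans (words-cong (suc N) (wt-∷ʳ-false (suc N) j (suc y) (≡.trans (≡.cong suc N≡) (≡.sym (ℕₚ.+-suc j y))))) (words-*ˡ (suc N) o turn)) ⟩
    o * paths (suc N) y + o * words (suc N) turn
      ≈⟨ +-congˡ (*-congˡ (words-∷ʳ N turn)) ⟩
    o * paths (suc N) y + o * (words N (λ b → turn (b ∷ʳ true)) + words N (λ b → turn (b ∷ʳ false)))
      ≈⟨ +-congˡ (*-congˡ (+-cong
           (trans (words-cong N (λ b _ → *-congʳ (reflexive (≡.cong (λ t → q ^ (if t then suc N else 0)) (lastIsTrue-∷ʳ b true))))) (words-*ˡ N _ _))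
           (trans (words-cong N (λ b _ → *-congʳ (reflexive (≡.cong (λ t → q ^ (if t then suc N else 0)) (lastIsTrue-∷ʳ b false))))) (words-*ˡ N _ _)))) ⟩
    o * paths (suc N) y + o * (q ^ suc N * n₁ + 1# * n₂)
      ≈⟨ solve 5 (λ o p x a b → o :* p :+ o :* (x :* a :+ :1 :* b) := o :* (p :+ ((a :+ b) :+ (x :- :1) :* a))) refl o _ _ _ _ ⟩
    o * (paths (suc N) y + ((n₁ + n₂) + (q ^ suc N - 1#) * n₁))
      ≈⟨ *-congˡ (+-congˡ (+-cong (sym (words-∷ʳ N (wt (suc y)))) (*-congˡ (paths-north N j y N≡)))) ⟩
    o * (paths (suc N) y + (paths (suc N) (suc y) + (q ^ suc N - 1#) * (ok j (suc y) * paths N y))) ∎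
    where
    o = ok (suc j) (suc y)
    turn : List Bool → Carrier
    turn b = q ^ (if lastIsTrue b then suc N else 0) * wt (suc y) b
    n₁ = words N (λ b → wt (suc y) (b ∷ʳ true))
    n₂ = words N (λ b → wt (suc y) (b ∷ʳ false))

  paths-forbidden : ∀ N j y → N ≡ j ℕ.+ y → okPoint w (x₀ ℕ.+ j) y ≡ false → paths N y ≈ 0#
  paths-forbidden N j y N≡ bad = words-0 N vanish
    where
    vanish : ∀ b → length b ≡ N → wt y b ≈ 0#
    vanish b l with countTrue b ℕₚ.≟ y
    ... | no ne = wt-≢ y b ne
    ... | yes ≡.refl
      rewrite avoids-end w x₀ 0 b (≡.trans (≡.cong (λ i → okPoint w (x₀ ℕ.+ i) (countTrue b)) (countFalse≡ b l N≡)) bad) = zeroˡ _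

  paths-bottom : ∀ j → paths (suc j) 0 ≈ ok (suc j) 0 * paths j 0
  paths-bottom j = begin
    paths (suc j) 0
      ≈⟨ words-∷ʳ j (wt 0) ⟩
    words j (λ b → wt 0 (b ∷ʳ true)) + words j (λ b → wt 0 (b ∷ʳ false))
      ≈⟨ +-cong (words-0 j (λ b _ → wt-≢ 0 (b ∷ʳ true) (λ e → ℕₚ.1+n≢0 (≡.trans (≡.sym (countTrue-∷ʳ-true b)) e))))
                (trans (words-cong j (λ b l → trans (wt-∷ʳ-false j j 0 (≡.sym (ℕₚ.+-identityʳ j)) b l) (*-congˡ (no-descent b)))) (words-*ˡ j _ _)) ⟩
    0# + ok (suc j) 0 * paths j 0
      ≈⟨ +-identityˡ _ ⟩
    ok (suc j) 0 * paths j 0 ∎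
    where
    no-descent : ∀ b → q ^ (if lastIsTrue b then j else 0) * wt 0 b ≈ wt 0 b
    no-descent b with lastIsTrue b in e
    ... | false = *-identityˡ _
    ... | true  = trans (*-congˡ zero-wt) (trans (zeroʳ _) (sym zero-wt))
      where zero-wt = wt-≢ 0 b (lastIsTrue⇒countTrue≢0 b e)

  paths-left : ∀ y → paths (suc y) (suc y) ≈ ok 0 (suc y) * paths y y
  paths-left y = begin
    paths (suc y) (suc y)
      ≈⟨ words-∷ʳ y (wt (suc y)) ⟩
    words y (λ b → wt (suc y) (b ∷ʳ true)) + words y (λ b → wt (suc y) (b ∷ʳ false))
      ≈⟨ +-cong (paths-north y 0 y ≡.refl) (words-0 y (λ b l → wt-≢ (suc y) (b ∷ʳ false) (too-few b l))) ⟩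
    ok 0 (suc y) * paths y y + 0#
      ≈⟨ +-identityʳ _ ⟩
    ok 0 (suc y) * paths y y ∎
    where
    too-few : ∀ b → length b ≡ y → countTrue (b ∷ʳ false) ≢ suc y
    too-few b l e = ℕₚ.1+n≰n (ℕₚ.≤-trans (ℕₚ.≤-reflexive (≡.trans (≡.sym e) (countTrue-∷ʳ-false b)))
      (ℕₚ.≤-trans (ℕₚ.m≤n+m (countTrue b) (countFalse b)) (ℕₚ.≤-reflexive (≡.trans (countFalse+countTrue b) l))))

  module _
    (cancel : PowersCancel R q)
    (c K : ℕ) (1≤x₀ : 1 ℕ.≤ x₀) (1≤c : 1 ℕ.≤ c) (x₀+c≡w+2 : x₀ ℕ.+ c ≡ w ℕ.+ 2) where
    open QBinomial R q
    open Images R q cancel x₀ c K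

    private
      1≤U : 1 ℕ.≤ U
      1≤U = ℕₚ.≤-trans 1≤x₀ (ℕₚ.m≤m+n x₀ c)

      ok-inside : ∀ j y → y ℕ.< x₀ ℕ.+ j → x₀ ℕ.+ j ℕ.< y ℕ.+ U → ok j y ≈ 1#
      ok-inside j y lo hi = reflexive (≡.cong ι (okPoint-inside w (x₀ ℕ.+ j) y lo (≡.subst (λ u → x₀ ℕ.+ j ℕ.< y ℕ.+ u) x₀+c≡w+2 hi)))

      on-upper : ∀ N j y → N ≡ j ℕ.+ y → N ℕ.< K → x₀ ℕ.+ j ≡ y ℕ.+ U → paths N y ≈ image N j y
      on-upper N j y N≡ N<K e = trans
        (paths-forbidden N j y N≡ (≡.trans (≡.cong (λ t → okPoint w t y) (≡.trans e (≡.cong (y ℕ.+_) x₀+c≡w+2))) (okPoint-upper w y)))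
        (sym (zero-image N j N≡ N<K j≡y+c))
        where
        j≡y+c : j ≡ y ℕ.+ c
        j≡y+c = ℕₚ.+-cancelˡ-≡ x₀ j (y ℕ.+ c) (≡.trans e (≡.trans (≡.sym (ℕₚ.+-assoc y x₀ c)) (≡.trans (≡.cong (ℕ._+ c) (ℕₚ.+-comm y x₀)) (ℕₚ.+-assoc x₀ y c))))
        zero-image : ∀ N j → N ≡ j ℕ.+ y → N ℕ.< K → j ≡ y ℕ.+ c → image N j y ≈ 0#
        zero-image _ _ ≡.refl N<K ≡.refl = image-upper y 1≤U N<K

    -- The range includes the upper line, where both sides vanish, but excludes the lower one, where
    -- only the combination in `image-lower` is available.
    paths-image : ∀ N j y → N ≡ j ℕ.+ y → N ℕ.< K → y ℕ.< x₀ ℕ.+ j → x₀ ℕ.+ j ℕ.≤ y ℕ.+ U →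
      paths N y ≈ image N j y
    paths-inside : ∀ N j y → N ≡ j ℕ.+ y → N ℕ.< K → y ℕ.< x₀ ℕ.+ j → x₀ ℕ.+ j ℕ.< y ℕ.+ U →
      paths N y ≈ image N j y

    paths-image N j y N≡ N<K lo hi with ℕₚ.m≤n⇒m<n∨m≡n hi
    ... | inj₁ x<y+U = paths-inside N j y N≡ N<K lo x<y+U
    ... | inj₂ x≡y+U = on-upper N j y N≡ N<K x≡y+U

    paths-inside _ zero zero ≡.refl N<K lo hi = begin
      ι (okPoint w x₀ 0 ∧ true) * 1#   ≈⟨ *-identityʳ _ ⟩
      ι (okPoint w x₀ 0 ∧ true)        ≈⟨ reflexive (≡.cong ι (≡.trans (Boolₚ.∧-identityʳ _) (≡.cong (λ t → okPoint w t 0) (≡.sym (ℕₚ.+-identityʳ x₀))))) ⟩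
      ok 0 0                           ≈⟨ ok-inside 0 0 lo hi ⟩
      1#                               ≈⟨ image-bottom 0 1≤x₀ 1≤c ⟨
      image 0 0 0                      ∎
    paths-inside (suc N) (suc j) zero N≡ N<K lo hi = begin
      paths (suc N) 0             ≈⟨ paths-bottom N ⟩
      ok (suc N) 0 * paths N 0    ≈⟨ *-cong (trans (reflexive (≡.cong (λ i → ok i 0) (≡.trans N≡ (ℕₚ.+-identityʳ (suc j))))) (ok-inside (suc j) 0 lo hi))
                                       (paths-image N j 0 (ℕₚ.suc-injective N≡) (ℕₚ.<⇒≤ N<K) (ℕₚ.≤-trans 1≤x₀ (ℕₚ.m≤m+n x₀ j)) (ℕₚ.+-monoʳ-≤ x₀ (ℕₚ.<⇒≤ (ℕₚ.<⇒≤ 1+j<c)))) ⟩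
      1# * image N j 0            ≈⟨ trans (*-identityˡ _) (bottom N j (ℕₚ.suc-injective N≡) (ℕₚ.<⇒≤ 1+j<c)) ⟩
      1#                          ≈⟨ bottom (suc N) (suc j) N≡ 1+j<c ⟨
      image (suc N) (suc j) 0     ∎
      where
      1+j<c : suc j ℕ.< c
      1+j<c = ℕₚ.+-cancelˡ-< x₀ (suc j) c hi
      bottom : ∀ N j → N ≡ j ℕ.+ 0 → j ℕ.< c → image N j 0 ≈ 1#
      bottom N j e j<c = trans (reflexive (≡.cong (λ N → image N j 0) (≡.trans e (ℕₚ.+-identityʳ j)))) (image-bottom j 1≤x₀ j<c)
    paths-inside (suc _) zero (suc y) ≡.refl N<K lo hi = begin
      paths (suc y) (suc y)       ≈⟨ paths-left y ⟩
      ok 0 (suc y) * paths y y    ≈⟨ *-cong (ok-inside 0 (suc y) lo hi) (paths-image y 0 y ≡.refl (ℕₚ.<⇒≤ N<K) (ℕₚ.<⇒≤ lo)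
                                       (ℕₚ.≤-trans (ℕₚ.≤-reflexive (ℕₚ.+-identityʳ x₀)) (ℕₚ.≤-trans (ℕₚ.m≤m+n x₀ c) (ℕₚ.m≤n+m U y)))) ⟩
      1# * image y 0 y            ≈⟨ trans (*-identityˡ _) (image-left y 1≤c (ℕₚ.<⇒≤ 1+y<x₀)) ⟩
      1#                          ≈⟨ image-left (suc y) 1≤c 1+y<x₀ ⟨
      image (suc y) 0 (suc y)     ∎
      where
      1+y<x₀ : suc y ℕ.< x₀
      1+y<x₀ = ℕₚ.<-≤-trans lo (ℕₚ.≤-reflexive (ℕₚ.+-identityʳ x₀))
    paths-inside (suc zero) (suc j) (suc y) N≡ N<K lo hi = ⊥-elim (ℕₚ.0≢1+n (≡.trans (ℕₚ.suc-injective N≡) (ℕₚ.+-suc j y)))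
    paths-inside (suc (suc M)) (suc j) (suc y) N≡ N<K lo hi = begin
      paths (suc (suc M)) (suc y)
        ≈⟨ paths-rec M j y M≡j+y ⟩
      ok (suc j) (suc y) * (paths (suc M) y + (paths (suc M) (suc y) + Q * (ok j (suc y) * paths M y)))
        ≈⟨ trans (*-congʳ (ok-inside (suc j) (suc y) lo hi)) (*-identityˡ _) ⟩
      paths (suc M) y + (paths (suc M) (suc y) + Q * (ok j (suc y) * paths M y))
        ≈⟨ +-cong (paths-image (suc M) (suc j) y (≡.cong suc M≡j+y) 1+M<K (ℕₚ.<⇒≤ lo) (ℕ.s≤s⁻¹ hi)) east ⟩
      image (suc M) (suc j) y + (image (suc M) j (suc y) + Q * image M j y)
        ≈⟨ trans (image-3term M j y) (+-assoc _ _ _) ⟨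
      image (suc (suc M)) (suc j) (suc y) ∎
      where
      Q = q ^ suc M - 1#
      1+M≡j+1+y : suc M ≡ j ℕ.+ suc y
      1+M≡j+1+y = ℕₚ.suc-injective N≡
      M≡j+y : M ≡ j ℕ.+ y
      M≡j+y = ℕₚ.suc-injective (≡.trans 1+M≡j+1+y (ℕₚ.+-suc j y))
      1+M<K : suc M ℕ.< K
      1+M<K = ℕₚ.<⇒≤ N<K
      1+y≤x : suc y ℕ.≤ x₀ ℕ.+ j
      1+y≤x = ℕ.s≤s⁻¹ (ℕₚ.<-≤-trans lo (ℕₚ.≤-reflexive (ℕₚ.+-suc x₀ j)))
      x<y+U : x₀ ℕ.+ j ℕ.< y ℕ.+ U
      x<y+U = ℕ.s≤s⁻¹ (ℕₚ.≤-<-trans (ℕₚ.≤-reflexive (≡.sym (ℕₚ.+-suc x₀ j))) hi)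
      lower : ∀ M → M ≡ j ℕ.+ y → M ℕ.< K → x₀ ℕ.+ j ≡ suc y → image (suc M) j (suc y) + (q ^ suc M - 1#) * image M j y ≈ 0#
      lower _ ≡.refl M<K e = image-lower j y 1≤U e M<K
      east : paths (suc M) (suc y) + Q * (ok j (suc y) * paths M y) ≈ image (suc M) j (suc y) + Q * image M j y
      east with ℕₚ.m≤n⇒m<n∨m≡n 1+y≤x
      ... | inj₁ 1+y<x = +-cong
        (paths-image (suc M) j (suc y) 1+M≡j+1+y 1+M<K 1+y<x (ℕₚ.m≤n⇒m≤1+n (ℕₚ.<⇒≤ x<y+U)))
        (*-congˡ (trans (*-cong (ok-inside j (suc y) 1+y<x (ℕₚ.m<n⇒m<1+n x<y+U))
                                (paths-image M j y M≡j+y (ℕₚ.<⇒≤ 1+M<K) 1+y≤x (ℕₚ.<⇒≤ x<y+U)))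
                        (*-identityˡ _)))
      -- The corner lies on the line x = y: both path terms are 0 because it is forbidden, and the
      -- two image terms cancel by `image-lower`.
      ... | inj₂ 1+y≡x = trans
        (+-cong (paths-forbidden (suc M) j (suc y) 1+M≡j+1+y forbidden)
                (trans (*-congˡ (trans (*-congʳ (reflexive (≡.cong ι forbidden))) (zeroˡ _))) (zeroʳ _)))
        (trans (+-identityˡ 0#) (sym (lower M M≡j+y (ℕₚ.<⇒≤ 1+M<K) (≡.sym 1+y≡x))))
        where
        forbidden : okPoint w (x₀ ℕ.+ j) (suc y) ≡ false
        forbidden = ≡.trans (≡.cong (λ t → okPoint w t (suc y)) (≡.sym 1+y≡x)) (okPoint-diagonal w (suc y))

  -- The last step is north, so it leaves `maj` unchanged, and its end point (x₀ + n, n) is inside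
  -- the strip because x₀ is. It can be removed.
  valid-paths : ∀ n′ → 1 ℕ.≤ x₀ → x₀ ℕ.≤ w → let n = suc n′ in
    lsum (q ^_) (map maj (filterᵇ (validPair n w x₀) (allBools (n ℕ.+ n)))) ≈ paths (n ℕ.+ n′) n′
  valid-paths n′ 1≤x₀ x₀≤w = begin
    lsum (q ^_) (map maj (filterᵇ (validPair n w x₀) (allBools (n ℕ.+ n))))
      ≈⟨ trans (lsum-map (q ^_) maj (filterᵇ (validPair n w x₀) (allBools (n ℕ.+ n)))) (trans (lsum-filter (λ b → q ^ maj b) (validPair n w x₀) (allBools (n ℕ.+ n))) (words-allBools (n ℕ.+ n) φ)) ⟩
    words (n ℕ.+ n) φ
      ≈⟨ reflexive (≡.cong (λ t → words t φ) (ℕₚ.+-suc n n′)) ⟩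
    words (suc (n ℕ.+ n′)) φ
      ≈⟨ words-∷ʳ (n ℕ.+ n′) φ ⟩
    words (n ℕ.+ n′) (λ b → φ (b ∷ʳ true)) + words (n ℕ.+ n′) (λ b → φ (b ∷ʳ false))
      ≈⟨ +-cong (words-cong (n ℕ.+ n′) (λ b _ → φ-true b)) (words-0 (n ℕ.+ n′) (λ b _ → φ-false b)) ⟩
    words (n ℕ.+ n′) (λ b → wt n (b ∷ʳ true)) + 0#
      ≈⟨ trans (+-identityʳ _) (paths-north (n ℕ.+ n′) n n′ ≡.refl) ⟩
    ok n n * paths (n ℕ.+ n′) n′
      ≈⟨ trans (*-congʳ (reflexive (≡.cong ι (okPoint-inside w (x₀ ℕ.+ n) n (ℕₚ.m<n+m n 1≤x₀) hi)))) (*-identityˡ _) ⟩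
    paths (n ℕ.+ n′) n′ ∎
    where
    n = suc n′
    φ : List Bool → Carrier
    φ b = ι (validPair n w x₀ b) * q ^ maj b
    φ-true : ∀ b → φ (b ∷ʳ true) ≈ wt n (b ∷ʳ true)
    φ-true b rewrite lastIsTrue-∷ʳ b true =
      *-congʳ (reflexive (≡.cong ι (Boolₚ.∧-comm (countTrue (b ∷ʳ true) ≡ᵇ n) (avoids w x₀ 0 (b ∷ʳ true)))))
    φ-false : ∀ b → φ (b ∷ʳ false) ≈ 0#
    φ-false b rewrite lastIsTrue-∷ʳ b false | Boolₚ.∧-zeroʳ (countTrue (b ∷ʳ false) ≡ᵇ n) = zeroˡ _
    hi : x₀ ℕ.+ n ℕ.< n ℕ.+ (w ℕ.+ 2)
    hi = ℕₚ.≤-<-trans (ℕₚ.≤-reflexive (ℕₚ.+-comm x₀ n)) (ℕₚ.+-monoʳ-< n (ℕₚ.≤-<-trans x₀≤w (ℕₚ.m<m+n w (ℕ.s≤s ℕ.z≤n))))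

-- Evaluating |CDP(n,w)|_q at roots of unity.

module Evaluation (R : CommutativeRing 0ℓ 0ℓ) where
  open CommutativeRing R hiding (zero)
  open RingBasics R
  open ListSums R
  open import Relation.Binary.Reasoning.Setoid setoid

  lsum-applyUpTo : ∀ {A : Set} (φ : A → Carrier) f n → lsum φ (applyUpTo f n) ≈ ∑ n (λ i → φ (f i))
  lsum-applyUpTo φ f zero    = refl
  lsum-applyUpTo φ f (suc n) = trans (+-congˡ (lsum-applyUpTo φ (λ i → f (suc i)) n)) (sym (∑-first n _))

  lsum-qExps : ∀ (φ : ℕ → Carrier) n w → lsum φ (qExps n w) ≈
    ∑ w (λ i → lsum φ (map maj (filterᵇ (validPair n w (suc i)) (allBools (n ℕ.+ n)))))
  lsum-qExps φ n w = trans (lsum-concatMap φ _ (map suc (upTo w)))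
    (trans (lsum-map _ suc (upTo w)) (lsum-applyUpTo _ (λ i → i) w))

  -- The inverse of z^i is z^(i n′), since i n′ + i = i n.
  root-cancel : ∀ z n′ → z ^ suc n′ ≈ 1# → ∀ i {a b} → z ^ i * a ≈ z ^ i * b → a ≈ b
  root-cancel z n′ zⁿ≈1 i {a} {b} e = trans (sym (undo a)) (trans (*-congˡ e) (undo b))
    where
    undo : ∀ x → z ^ (i ℕ.* n′) * (z ^ i * x) ≈ x
    undo x = begin
      z ^ (i ℕ.* n′) * (z ^ i * x)   ≈⟨ *-assoc _ _ _ ⟨
      z ^ (i ℕ.* n′) * z ^ i * x     ≈⟨ *-congʳ (^-+ z (i ℕ.* n′) i) ⟨
      z ^ (i ℕ.* n′ ℕ.+ i) * x       ≈⟨ *-congʳ (^-congʳ z (≡.trans (ℕₚ.+-comm (i ℕ.* n′) i) (≡.sym (ℕₚ.*-suc i n′)))) ⟩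
      z ^ (i ℕ.* suc n′) * x         ≈⟨ *-congʳ (^-*-1 z i (suc n′) zⁿ≈1) ⟩
      1# * x                         ≈⟨ *-identityˡ x ⟩
      x                              ∎

  module _ (q : Carrier) (cancel : PowersCancel R q) (n′ w K : ℕ) (N<K : suc n′ ℕ.+ n′ ℕ.< K) where
    open TraceSum R q cancel n′ (suc (suc w)) K using (strip)

    private
      n U : ℕ
      n = suc n′
      U = suc (suc w)

      U≡w+2 : U ≡ w ℕ.+ 2
      U≡w+2 = ℕₚ.+-comm 2 w

      strip-inside : ∀ i → i ℕ.< w →
        lsum (q ^_) (map maj (filterᵇ (validPair n w (suc i)) (allBools (n ℕ.+ n)))) ≈ strip (suc i) (U ℕ.∸ suc i)
      strip-inside i i<w = trans (valid-paths n′ (ℕ.s≤s ℕ.z≤n) i<w)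
        (paths-image cancel c K (ℕ.s≤s ℕ.z≤n) (ℕₚ.m<n⇒0<n∸m (ℕ.s≤s (ℕₚ.m<n⇒m<1+n i<w)))
          (≡.trans x₀+c≡U U≡w+2) (n ℕ.+ n′) n n′ ≡.refl N<K
          (ℕ.s≤s (ℕₚ.≤-trans (ℕₚ.n≤1+n n′) (ℕₚ.m≤n+m n i)))
          (ℕₚ.≤-trans (ℕₚ.≤-reflexive (ℕₚ.+-suc (suc i) n′)) (ℕₚ.≤-trans (ℕₚ.+-monoˡ-≤ n′ (ℕ.s≤s (ℕₚ.m≤n⇒m≤1+n i<w))) (ℕₚ.≤-reflexive (≡.trans (ℕₚ.+-comm U n′) (≡.cong (n′ ℕ.+_) (≡.sym x₀+c≡U)))))))
        where
        open StripPaths R q w (suc i)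
        c = U ℕ.∸ suc i
        x₀+c≡U : suc i ℕ.+ c ≡ U
        x₀+c≡U = ℕₚ.m+[n∸m]≡n {suc i} {U} (ℕ.s≤s (ℕₚ.<⇒≤ (ℕₚ.m<n⇒m<1+n i<w)))

      strip-zero : strip 0 U ≈ 0#
      strip-zero = image-origin R q cancel U K n n′ (ℕ.s≤s ℕ.z≤n) N<K

      -- For x₀ = w + 1 the end point (x₀ + n, n - 1) lies on the upper line. In `strip-zero` it is
      -- the starting point that lies on a boundary line.
      strip-top : strip (suc w) (U ℕ.∸ suc w) ≈ 0#
      strip-top = trans (reflexive (≡.cong (λ c → strip (suc w) c) (ℕₚ.m+n∸n≡m 1 (suc w)))) (upper n (≡.sym (ℕₚ.+-comm n′ 1)) N<K)
        where
        upper : ∀ j → j ≡ n′ ℕ.+ 1 → j ℕ.+ n′ ℕ.< K → Images.image R q cancel (suc w) 1 K (j ℕ.+ n′) j n′ ≈ 0#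
        upper _ ≡.refl j+n′<K = Images.image-upper R q cancel (suc w) 1 K n′ (ℕ.s≤s ℕ.z≤n) j+n′<K

    evalExps-strip : evalExps R (qExps n w) q ≈ ∑ U (λ x → strip x (U ℕ.∸ x))
    evalExps-strip = begin
      evalExps R (qExps n w) q
        ≈⟨ trans (evalExps-lsum (qExps n w) q) (lsum-qExps (q ^_) n w) ⟩
      ∑ w (λ i → lsum (q ^_) (map maj (filterᵇ (validPair n w (suc i)) (allBools (n ℕ.+ n)))))
        ≈⟨ ∑-cong w strip-inside ⟩
      ∑ w (λ i → S (suc i))
        ≈⟨ trans (+-congʳ strip-zero) (+-identityˡ _) ⟨
      S 0 + ∑ w (λ i → S (suc i))
        ≈⟨ ∑-first w S ⟨
      ∑ (suc w) S
        ≈⟨ trans (+-congˡ strip-top) (+-identityʳ _) ⟨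
      ∑ (suc w) S + S (suc w) ∎
      where
      S : ℕ → Carrier
      S x = strip x (U ℕ.∸ x)

  evalExps-root : NoZeroDivisors R → ∀ z d′ m′ n w → n ≡ suc m′ ℕ.* suc d′ →
    z ^ suc d′ ≈ 1# → (∀ s → s ℕ.< d′ → ¬ z ^ suc s ≈ 1#) →
    evalExps R (qExps n w) z ≈ evalExps R (qExps (suc m′) w) 1#
  evalExps-root domain z d′ m′ n w ≡.refl zᵈ≈1 z-prim = begin
    evalExps R (qExps n w) z
      ≈⟨ evalExps-strip z z-cancel n′ w (K ℕ.* suc d′) N<Kd ⟩
    _
      ≈⟨ Lucas.∑-strip-reduced R z d′ domain zᵈ≈1 z-prim z-cancel m′ U K N<Kd (ℕ.s≤s ℕ.z≤n) ⟩
    _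
      ≈⟨ Lucas.∑-strip-reduced R 1# 0 domain 1-root (λ _ ()) 1-cancel m′ U K M<K (ℕ.s≤s ℕ.z≤n) ⟨
    _
      ≈⟨ evalExps-strip 1# 1-cancel (m′ ℕ.* 1) w (K ℕ.* 1) M<K ⟨
    evalExps R (qExps (suc (m′ ℕ.* 1)) w) 1#
      ≈⟨ reflexive (≡.cong (λ m → evalExps R (qExps (suc m) w) 1#) (ℕₚ.*-identityʳ m′)) ⟩
    evalExps R (qExps (suc m′) w) 1# ∎
    where
    n′ = d′ ℕ.+ m′ ℕ.* suc d′
    U = suc (suc w)
    -- One bound for both reductions, since `reduced` depends on it: it exceeds the row 2n - 1 at z
    -- and the row 2m - 1 at 1.
    K = n ℕ.+ n
    z-cancel : PowersCancel R z
    z-cancel = root-cancel z d′ zᵈ≈1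
    1-root : 1# ^ 1 ≈ 1#
    1-root = 1^ 1
    1-cancel : PowersCancel R 1#
    1-cancel = root-cancel 1# 0 1-root
    N<K : n ℕ.+ n′ ℕ.< K
    N<K = ℕₚ.≤-reflexive (≡.sym (ℕₚ.+-suc n n′))
    N<Kd : n ℕ.+ n′ ℕ.< K ℕ.* suc d′
    N<Kd = ℕₚ.≤-trans N<K (ℕₚ.m≤m*n K (suc d′))
    m′≤n′ : m′ ℕ.* 1 ℕ.≤ n′
    m′≤n′ = ℕₚ.≤-trans (ℕₚ.*-monoʳ-≤ m′ {1} {suc d′} (ℕ.s≤s ℕ.z≤n)) (ℕₚ.m≤n+m _ d′)
    M<K : suc (m′ ℕ.* 1) ℕ.+ m′ ℕ.* 1 ℕ.< K ℕ.* 1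
    M<K = ℕₚ.≤-trans (ℕ.s≤s (ℕₚ.+-mono-≤ (ℕ.s≤s m′≤n′) m′≤n′)) (ℕₚ.≤-trans N<K (ℕₚ.≤-reflexive (≡.sym (ℕₚ.*-identityʳ K))))

-- The count at q = 1 by closed chains of heights.

T⇒≡true : ∀ {b} → T b → b ≡ true
T⇒≡true {true} _ = ≡.refl

T-ext : ∀ {a b} → (T a → T b) → (T b → T a) → a ≡ b
T-ext {true}  {true}  f g = ≡.refl
T-ext {true}  {false} f g = ⊥-elim (f tt)
T-ext {false} {true}  f g = ⊥-elim (g tt)
T-ext {false} {false} f g = ≡.refl

≤⇒≤ᵇ-true : ∀ {m n} → m ℕ.≤ n → (m ≤ᵇ n) ≡ true
≤⇒≤ᵇ-true m≤n = T⇒≡true (ℕₚ.≤⇒≤ᵇ m≤n)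

>⇒≤ᵇ-false : ∀ {m n} → n ℕ.< m → (m ≤ᵇ n) ≡ false
>⇒≤ᵇ-false {m} {n} n<m with m ≤ᵇ n in e
... | false = ≡.refl
... | true  = ⊥-elim (ℕₚ.<⇒≱ n<m (ℕₚ.≤ᵇ⇒≤ m n (≡.subst T (≡.sym e) tt)))

avoids-start : ∀ w x y b → okPoint w x y ≡ false → avoids w x y b ≡ false
avoids-start w x y []          e = e
avoids-start w x y (true ∷ b)  e rewrite e = ≡.refl
avoids-start w x y (false ∷ b) e rewrite e = ≡.refl

lastIsTrue-false∷ : ∀ b → lastIsTrue (false ∷ b) ≡ lastIsTrue b
lastIsTrue-false∷ []      = ≡.refl
lastIsTrue-false∷ (_ ∷ _) = ≡.refl

module Chains (R : CommutativeRing 0ℓ 0ℓ) (w : ℕ) where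
  open CommutativeRing R hiding (zero)
  open RingBasics R
  open ListSums R
  open Evaluation R
  open import Relation.Binary.Reasoning.Setoid setoid

  -- The number of sequences y₁, …, y_r < w with y₁ ≤ u, y_{i+1} ≤ y_i + 1 and z ≤ y_r + 1 (z ≤ u if r = 0).
  chains : ℕ → ℕ → ℕ → Carrier
  chains zero    u z = ι (z ≤ᵇ u)
  chains (suc r) u z = ∑ w (λ y → ι (y ≤ᵇ u) * chains r (suc y) z)

  ∑-≤ᵇ : ∀ u n (f : ℕ → Carrier) → u ℕ.< n → ∑ n (λ y → ι (y ≤ᵇ u) * f y) ≈ ∑ (suc u) f
  ∑-≤ᵇ u n f u<n = begin
    ∑ n F                                             ≈⟨ reflexive (≡.cong (λ t → ∑ t F) (≡.sym (ℕₚ.m∸n+n≡m u<n))) ⟩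
    ∑ (n ℕ.∸ suc u ℕ.+ suc u) F                       ≈⟨ ∑-split (suc u) (n ℕ.∸ suc u) F ⟩
    ∑ (suc u) F + ∑ (n ℕ.∸ suc u) (λ i → F (i ℕ.+ suc u))
      ≈⟨ +-cong (∑-cong (suc u) (λ y y<1+u → trans (*-congʳ (reflexive (≡.cong ι (≤⇒≤ᵇ-true (ℕ.s≤s⁻¹ y<1+u))))) (*-identityˡ _)))
                (∑-0 (n ℕ.∸ suc u) (λ i _ → trans (*-congʳ (reflexive (≡.cong ι (>⇒≤ᵇ-false (ℕₚ.m≤n+m (suc u) i))))) (zeroˡ _))) ⟩
    ∑ (suc u) f + 0#                                  ≈⟨ +-identityʳ _ ⟩
    ∑ (suc u) f                                       ∎
    where
    F : ℕ → Carrier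
    F y = ι (y ≤ᵇ u) * f y

  ∑-≤ᵇ-all : ∀ u n (f : ℕ → Carrier) → n ℕ.≤ suc u → ∑ n (λ y → ι (y ≤ᵇ u) * f y) ≈ ∑ n f
  ∑-≤ᵇ-all u n f n≤1+u = ∑-cong n (λ y y<n → trans
    (*-congʳ (reflexive (≡.cong ι (≤⇒≤ᵇ-true (ℕ.s≤s⁻¹ (ℕₚ.≤-trans y<n n≤1+u)))))) (*-identityˡ _))

  chains-far : ∀ r u z → u ℕ.+ r ℕ.< z → chains r u z ≈ 0#
  chains-far zero    u z h = reflexive (≡.cong ι (>⇒≤ᵇ-false (ℕₚ.≤-<-trans (ℕₚ.m≤m+n u 0) h)))
  chains-far (suc r) u z h = ∑-0 w vanish
    where
    vanish : ∀ y → y ℕ.< w → ι (y ≤ᵇ u) * chains r (suc y) z ≈ 0#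
    vanish y _ with y ℕₚ.≤? u
    ... | yes y≤u = trans (*-congˡ (chains-far r (suc y) z (ℕₚ.≤-<-trans (ℕₚ.≤-trans (ℕ.s≤s (ℕₚ.+-monoˡ-≤ r y≤u)) (ℕₚ.≤-reflexive (≡.sym (ℕₚ.+-suc u r)))) h))) (zeroʳ _)
    ... | no  y≰u = trans (*-congʳ (reflexive (≡.cong ι (>⇒≤ᵇ-false (ℕₚ.≰⇒> y≰u))))) (zeroˡ _)

  -- Completions of a path that has reached (x, y) and still has r north steps to make. The
  -- preceding letter `c` is kept because the whole word must end in a north step even if `b` is
  -- empty.
  suffix : ℕ → Bool → ℕ → ℕ → List Bool → Carrier
  suffix r c x y b = ι ((countTrue b ≡ᵇ r) ∧ (lastIsTrue (c ∷ b) ∧ avoids w x y b))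

  suffixes : ℕ → ℕ → Bool → ℕ → ℕ → Carrier
  suffixes M r c x y = words M (suffix r c x y)

  suffixes-forbidden : ∀ M r c x y → okPoint w x y ≡ false → suffixes M r c x y ≈ 0#
  suffixes-forbidden M r c x y bad = words-0 M vanish
    where
    vanish : ∀ b → length b ≡ M → suffix r c x y b ≈ 0#
    vanish b _ rewrite avoids-start w x y b bad | Boolₚ.∧-zeroʳ (lastIsTrue (c ∷ b)) | Boolₚ.∧-zeroʳ (countTrue b ≡ᵇ r) = refl

  suffixes-none : ∀ M c x y → suffixes (suc M) 0 c x y ≈ 0#
  suffixes-none M c x y = words-0 (suc M) vanish
    where
    vanish : ∀ b → length b ≡ suc M → suffix 0 c x y b ≈ 0#
    vanish b@(_ ∷ _) _ with lastIsTrue b in e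
    ... | false = reflexive (≡.cong ι (Boolₚ.∧-zeroʳ (countTrue b ≡ᵇ 0)))
    ... | true rewrite ≢⇒≡ᵇ-false (countTrue b) 0 (lastIsTrue⇒countTrue≢0 b e) = refl

  suffixes-step : ∀ M r c x y → okPoint w x y ≡ true →
    suffixes (suc M) (suc r) c x y ≈ suffixes M r true x (suc y) + suffixes M (suc r) false (suc x) y
  suffixes-step M r c x y good = +-cong
    (words-cong M (λ b _ → reflexive (≡.cong (λ t → ι ((countTrue b ≡ᵇ r) ∧ (lastIsTrue (true ∷ b) ∧ (t ∧ avoids w x (suc y) b)))) good)))
    (words-cong M (λ b _ → reflexive (≡.cong (λ t → ι ((countTrue b ≡ᵇ suc r) ∧ (lastIsTrue (false ∷ b) ∧ (t ∧ avoids w (suc x) y b)))) good)))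

  suffixes-end : ∀ M x y → (M ≡ 0 → okPoint w x y ≡ true) → suffixes M 0 true x y ≈ ι (M ≡ᵇ 0)
  suffixes-end zero    x y good = reflexive (≡.cong ι (good ≡.refl))
  suffixes-end (suc M) x y good = suffixes-none M true x y

  -- The height u = w + 1 - (x - y) is the number of east steps that still fit before the upper
  -- line. North raises it by one and east lowers it by one. Just before the successive north steps
  -- the heights are below w, as a north step at height w would hit x = y, and each exceeds its
  -- predecessor by at most 1. The length condition places the last of the r + 1 north steps at
  -- height z.
  suffixes-chains : ∀ M r c x y u z → x ℕ.+ u ≡ y ℕ.+ suc w → y ℕ.< x → u ℕ.+ suc (r ℕ.+ r) ≡ z ℕ.+ M → z ℕ.< w →
    suffixes M (suc r) c x y ≈ chains r u z
  -- No steps are left although r + 1 north steps are due; correspondingly z = u + 2r + 1 is too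
  -- high for a chain.
  suffixes-chains zero r c x y u z pos y<x len z<w = sym (chains-far r u z
    (ℕₚ.≤-trans (ℕₚ.≤-reflexive (≡.sym (ℕₚ.+-suc u r)))
      (ℕₚ.≤-trans (ℕₚ.+-monoʳ-≤ u (ℕ.s≤s (ℕₚ.m≤m+n r r))) (ℕₚ.≤-reflexive (≡.trans len (ℕₚ.+-identityʳ z))))))
  suffixes-chains (suc M) r c x y u z pos y<x len z<w = trans
    (suffixes-step M r c x y (okPoint-inside w x y y<x x<y+U))
    (trans (+-cong (north r len) (east u pos len)) (chains-step r u len u≤w))
    where
    u≤w : u ℕ.≤ w
    u≤w = ℕₚ.+-cancelˡ-≤ (suc y) u w (ℕₚ.≤-trans (ℕₚ.+-monoˡ-≤ u y<x) (ℕₚ.≤-reflexive (≡.trans pos (ℕₚ.+-suc y w))))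
    x<y+U : x ℕ.< y ℕ.+ (w ℕ.+ 2)
    x<y+U = ℕₚ.≤-<-trans (ℕₚ.≤-trans (ℕₚ.m≤m+n x u) (ℕₚ.≤-reflexive pos)) (ℕₚ.+-monoʳ-< y (ℕₚ.≤-reflexive (≡.sym (ℕₚ.+-comm w 2))))

    1+y<x : u ℕ.< w → suc y ℕ.< x
    1+y<x u<w = ℕₚ.+-cancelʳ-< u (suc y) x (ℕₚ.<-≤-trans (ℕₚ.+-monoʳ-< (suc y) u<w) (ℕₚ.≤-reflexive (≡.sym (≡.trans pos (ℕₚ.+-suc y w)))))

    -- The chains split by their first height: u, if the next step is north, or less than u, if it
    -- is east. For r = 0 the only height left is z, so stepping north must end the word.
    lower upper : ℕ → ℕ → Carrier
    lower r zero    = 0#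
    lower r (suc u) = chains r u z
    upper zero    u = ι (M ≡ᵇ 0)
    upper (suc r) u = ι (suc u ≤ᵇ w) * chains r (suc u) z

    north : ∀ r → u ℕ.+ suc (r ℕ.+ r) ≡ z ℕ.+ suc M → suffixes M r true x (suc y) ≈ upper r u
    north zero    len = suffixes-end M x (suc y) (λ { ≡.refl → okPoint-inside w x (suc y) (1+y<x (u<w len)) (ℕₚ.m<n⇒m<1+n x<y+U) })
      where
      u<w : u ℕ.+ 1 ≡ z ℕ.+ 1 → u ℕ.< w
      u<w e = ℕₚ.≤-<-trans (ℕₚ.≤-reflexive (ℕₚ.+-cancelʳ-≡ 1 u z e)) z<w
    north (suc r) len with u ℕₚ.<? w
    ... | yes u<w = begin
      suffixes M (suc r) true x (suc y)
        ≈⟨ suffixes-chains M r true x (suc y) (suc u) z (≡.trans (ℕₚ.+-suc x u) (≡.cong suc pos)) (1+y<x u<w)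
             (ℕₚ.suc-injective (≡.trans (≡.sym (≡.cong suc (ℕₚ.+-suc u (suc (r ℕ.+ r)))))
               (≡.trans (≡.sym (ℕₚ.+-suc u (suc (suc (r ℕ.+ r))))) (≡.trans (≡.cong (λ t → u ℕ.+ suc (suc t)) (≡.sym (ℕₚ.+-suc r r))) (≡.trans len (ℕₚ.+-suc z M)))))) z<w ⟩
      chains r (suc u) z
        ≈⟨ trans (*-congʳ (reflexive (≡.cong ι (≤⇒≤ᵇ-true u<w)))) (*-identityˡ _) ⟨
      ι (suc u ≤ᵇ w) * chains r (suc u) z ∎
    ... | no u≮w = trans
      (suffixes-forbidden M (suc r) true x (suc y) (≡.trans (≡.cong (λ t → okPoint w t (suc y)) x≡1+y) (okPoint-diagonal w (suc y))))
      (sym (trans (*-congʳ (reflexive (≡.cong ι (>⇒≤ᵇ-false (ℕ.s≤s (ℕₚ.≮⇒≥ u≮w)))))) (zeroˡ _)))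
      where
      x≡1+y : x ≡ suc y
      x≡1+y = ℕₚ.≤-antisym
        (ℕₚ.+-cancelʳ-≤ u x (suc y) (ℕₚ.≤-trans (ℕₚ.≤-reflexive (≡.trans pos (ℕₚ.+-suc y w))) (ℕₚ.+-monoʳ-≤ (suc y) (ℕₚ.≮⇒≥ u≮w))))
        y<x

    east : ∀ u → x ℕ.+ u ≡ y ℕ.+ suc w → u ℕ.+ suc (r ℕ.+ r) ≡ z ℕ.+ suc M → suffixes M (suc r) false (suc x) y ≈ lower r u
    east zero    pos _   = suffixes-forbidden M (suc r) false (suc x) y
      (≡.trans (≡.cong (λ t → okPoint w t y) (≡.trans (≡.cong suc (≡.trans (≡.sym (ℕₚ.+-identityʳ x)) pos)) (≡.trans (≡.sym (ℕₚ.+-suc y (suc w))) (≡.cong (y ℕ.+_) (ℕₚ.+-comm 2 w))))) (okPoint-upper w y))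
    east (suc u) pos len = suffixes-chains M r false (suc x) y u z
      (≡.trans (≡.sym (ℕₚ.+-suc x u)) pos) (ℕₚ.m<n⇒m<1+n y<x) (ℕₚ.suc-injective (≡.trans len (ℕₚ.+-suc z M))) z<w

    F : ℕ → ℕ → Carrier
    F r v = chains r (suc v) z

    lower-∑ : ∀ r u → u ℕ.≤ w → lower (suc r) u ≈ ∑ u (F r)
    lower-∑ r zero    _   = refl
    lower-∑ r (suc u) u<w = ∑-≤ᵇ u w (F r) u<w

    chains-step : ∀ r u → u ℕ.+ suc (r ℕ.+ r) ≡ z ℕ.+ suc M → u ℕ.≤ w → upper r u + lower r u ≈ chains r u z
    chains-step zero u len _ = trans (last M u u≡z+M)
      (reflexive (≡.cong ι (≡.sym (≤⇒≤ᵇ-true (ℕₚ.≤-trans (ℕₚ.m≤m+n z M) (ℕₚ.≤-reflexive (≡.sym u≡z+M)))))))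
      where
      u≡z+M : u ≡ z ℕ.+ M
      u≡z+M = ℕₚ.suc-injective (≡.trans (ℕₚ.+-comm 1 u) (≡.trans len (ℕₚ.+-suc z M)))
      last : ∀ M u → u ≡ z ℕ.+ M → ι (M ≡ᵇ 0) + lower 0 u ≈ 1#
      last zero    zero    _ = +-identityʳ _
      last zero    (suc u) e = trans (+-congˡ (reflexive (≡.cong ι (>⇒≤ᵇ-false (ℕₚ.≤-reflexive (≡.trans e (ℕₚ.+-identityʳ z))))))) (+-identityʳ _)
      last (suc M) zero    e = ⊥-elim (ℕₚ.0≢1+n (≡.trans e (ℕₚ.+-suc z M)))
      last (suc M) (suc u) e = trans (+-identityˡ _) (reflexive (≡.cong ι (≤⇒≤ᵇ-true
        (ℕₚ.≤-trans (ℕₚ.m≤m+n z M) (ℕₚ.≤-reflexive (≡.sym (ℕₚ.suc-injective (≡.trans e (ℕₚ.+-suc z M)))))))))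
    chains-step (suc r) u len u≤w with u ℕₚ.<? w
    ... | yes u<w = begin
      ι (suc u ≤ᵇ w) * F r u + lower (suc r) u   ≈⟨ +-cong (trans (*-congʳ (reflexive (≡.cong ι (≤⇒≤ᵇ-true u<w)))) (*-identityˡ _)) (lower-∑ r u u≤w) ⟩
      F r u + ∑ u (F r)                          ≈⟨ +-comm _ _ ⟩
      ∑ (suc u) (F r)                            ≈⟨ ∑-≤ᵇ u w (F r) u<w ⟨
      chains (suc r) u z                         ∎
    ... | no u≮w = begin
      ι (suc u ≤ᵇ w) * F r u + lower (suc r) u   ≈⟨ +-cong (trans (*-congʳ (reflexive (≡.cong ι (>⇒≤ᵇ-false (ℕ.s≤s (ℕₚ.≮⇒≥ u≮w)))))) (zeroˡ _)) (lower-∑ r u u≤w) ⟩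
      0# + ∑ u (F r)                             ≈⟨ +-identityˡ _ ⟩
      ∑ u (F r)                                  ≈⟨ reflexive (≡.cong (λ t → ∑ t (F r)) (ℕₚ.≤-antisym u≤w (ℕₚ.≮⇒≥ u≮w))) ⟩
      ∑ w (F r)                                  ≈⟨ ∑-≤ᵇ-all u w (F r) (ℕₚ.m≤n⇒m≤1+n (ℕₚ.≮⇒≥ u≮w)) ⟨
      chains (suc r) u z                         ∎

  closed-chains : ℕ → Carrier
  closed-chains m′ = ∑ w (λ z → chains m′ (suc z) z)

  -- A word with m zeros and m ones returns to its starting height z + 1, where z = w - x₀, so its
  -- last north step is at height z. The first height is at most z + 1 as well: read cyclically, z
  -- is the entry that closes the chain.
  evalExps-1 : ∀ m′ → evalExps R (qExps (suc m′) w) 1# ≈ closed-chains m′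
  evalExps-1 m′ = begin
    evalExps R (qExps m w) 1#
      ≈⟨ trans (evalExps-lsum (qExps m w) 1#) (trans (lsum-cong (qExps m w) 1^) (lsum-qExps (λ _ → 1#) m w)) ⟩
    ∑ w (λ i → lsum (λ _ → 1#) (map maj (filterᵇ (validPair m w (suc i)) (allBools (m ℕ.+ m)))))
      ≈⟨ ∑-cong w closed ⟩
    ∑ w (λ i → chains m′ (suc (w ℕ.∸ suc i)) (w ℕ.∸ suc i))
      ≈⟨ ∑-reverse w (λ z → chains m′ (suc z) z) ⟨
    closed-chains m′ ∎
    where
    m = suc m′
    closed : ∀ i → i ℕ.< w → lsum (λ _ → 1#) (map maj (filterᵇ (validPair m w (suc i)) (allBools (m ℕ.+ m)))) ≈
      chains m′ (suc (w ℕ.∸ suc i)) (w ℕ.∸ suc i)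
    closed i i<w = begin
      lsum (λ _ → 1#) (map maj (filterᵇ (validPair m w (suc i)) (allBools (m ℕ.+ m))))
        ≈⟨ lsum-map (λ _ → 1#) maj (filterᵇ (validPair m w (suc i)) (allBools (m ℕ.+ m))) ⟩
      lsum (λ _ → 1#) (filterᵇ (validPair m w (suc i)) (allBools (m ℕ.+ m)))
        ≈⟨ lsum-filter (λ _ → 1#) (validPair m w (suc i)) (allBools (m ℕ.+ m)) ⟩
      lsum (λ b → ι (validPair m w (suc i) b) * 1#) (allBools (m ℕ.+ m))
        ≈⟨ words-allBools (m ℕ.+ m) _ ⟩
      words (m ℕ.+ m) (λ b → ι (validPair m w (suc i) b) * 1#)
        ≈⟨ words-cong (m ℕ.+ m) (λ b _ → trans (*-identityʳ _)
             (reflexive (≡.cong (λ t → ι ((countTrue b ≡ᵇ m) ∧ (t ∧ avoids w (suc i) 0 b))) (≡.sym (lastIsTrue-false∷ b))))) ⟩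
      suffixes (m ℕ.+ m) m false (suc i) 0
        ≈⟨ suffixes-chains (m ℕ.+ m) m′ false (suc i) 0 (suc z) z
             (≡.trans (ℕₚ.+-suc (suc i) z) (≡.cong suc (ℕₚ.m+[n∸m]≡n i<w)))
             (ℕ.s≤s ℕ.z≤n)
             (≡.trans (≡.sym (ℕₚ.+-suc z (suc (m′ ℕ.+ m′)))) (≡.cong (z ℕ.+_) (≡.cong suc (≡.sym (ℕₚ.+-suc m′ m′)))))
             (ℕₚ.∸-monoʳ-< {w} {suc i} {0} (ℕ.s≤s ℕ.z≤n) i<w) ⟩
      chains m′ (suc z) z ∎
      where z = w ℕ.∸ suc i

-- Periodic extensions and sequences fixed by a rotation.

cyclic : ∀ {A : Set} {n′} → (Fin (suc n′) → A) → ℕ → A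
cyclic {n′ = n′} a t = a (t mod suc n′)

mod-cong : ∀ n′ s t → s % suc n′ ≡ t % suc n′ → s mod suc n′ ≡ t mod suc n′
mod-cong n′ s t e = Finₚ.fromℕ<-cong _ _ e _ _

module _ {A : Set} {n′ : ℕ} (a : Fin (suc n′) → A) where
  private n = suc n′

  cyclic-+* : ∀ t x → cyclic a (t ℕ.+ x ℕ.* n) ≡ cyclic a t
  cyclic-+* t x = ≡.cong a (mod-cong n′ (t ℕ.+ x ℕ.* n) t ([m+kn]%n≡m%n t x n))

  cyclic-% : ∀ t s → cyclic a (t % n ℕ.+ s) ≡ cyclic a (t ℕ.+ s)
  cyclic-% t s = ≡.trans (≡.sym (cyclic-+* (t % n ℕ.+ s) (t / n)))
    (≡.cong (cyclic a) (≡.trans (ℕₚ.+-assoc (t % n) s _) (≡.trans (≡.cong (t % n ℕ.+_) (ℕₚ.+-comm s _))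
      (≡.trans (≡.sym (ℕₚ.+-assoc (t % n) _ s)) (≡.cong (ℕ._+ s) (≡.sym (m≡m%n+[m/n]*n t n)))))))

  toℕ-mod : ∀ t → toℕ (t mod n) ≡ t % n
  toℕ-mod t = Finₚ.toℕ-fromℕ< (m%n<n t n)

  cyclic-mod : ∀ t s → cyclic a (toℕ (t mod n) ℕ.+ s) ≡ cyclic a (t ℕ.+ s)
  cyclic-mod t s = ≡.trans (≡.cong (λ r → cyclic a (r ℕ.+ s)) (toℕ-mod t)) (cyclic-% t s)

  cyclic-toℕ : ∀ i → cyclic a (toℕ i) ≡ a i
  cyclic-toℕ i = ≡.cong a (Finₚ.toℕ-injective (≡.trans (toℕ-mod (toℕ i)) (m<n⇒m%n≡m (Finₚ.toℕ<n i))))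

-- `predCyc` adds n - 1 modulo n, so k backward shifts become the addition of k n′ and no
-- subtraction of indices occurs.
cyclic-α : ∀ {n′} (a : Fin (suc n′) → ℕ) k i → iter k α a i ≡ cyclic a (toℕ i ℕ.+ k ℕ.* n′)
cyclic-α a zero i = ≡.sym (≡.trans (≡.cong (cyclic a) (ℕₚ.+-identityʳ (toℕ i))) (cyclic-toℕ a i))
cyclic-α {n′} a (suc k) i = ≡.trans (cyclic-α a k (predCyc i))
  (≡.trans (cyclic-mod a (toℕ i ℕ.+ n′) (k ℕ.* n′)) (≡.cong (cyclic a) (ℕₚ.+-assoc (toℕ i) n′ _)))

periodic-* : ∀ (f : ℕ → ℕ) p → (∀ t → f (t ℕ.+ p) ≡ f t) → ∀ x t → f (t ℕ.+ x ℕ.* p) ≡ f t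
periodic-* f p per zero    t = ≡.cong f (ℕₚ.+-identityʳ t)
periodic-* f p per (suc x) t = ≡.trans (≡.cong f (≡.sym (ℕₚ.+-assoc t p _)))
  (≡.trans (periodic-* f p per x (t ℕ.+ p)) (per t))

periodic-gcd : ∀ (f : ℕ → ℕ) n k → (∀ t → f (t ℕ.+ n) ≡ f t) → (∀ t → f (t ℕ.+ k) ≡ f t) →
  ∀ t → f (t ℕ.+ gcd n k) ≡ f t
periodic-gcd f n k perₙ perₖ t with Bézout.identity (gcd-GCD n k)
... | Bézout.+- x y g+yk≡xn = ≡.trans (≡.sym (periodic-* f k perₖ y (t ℕ.+ gcd n k)))
  (≡.trans (≡.cong f (≡.trans (ℕₚ.+-assoc t _ _) (≡.cong (t ℕ.+_) g+yk≡xn))) (periodic-* f n perₙ x t))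
... | Bézout.-+ x y g+xn≡yk = ≡.trans (≡.sym (periodic-* f n perₙ x (t ℕ.+ gcd n k)))
  (≡.trans (≡.cong f (≡.trans (ℕₚ.+-assoc t _ _) (≡.cong (t ℕ.+_) g+xn≡yk))) (periodic-* f k perₖ y t))

T-isCDP : ∀ n w (a : Fin n → Fin w) → T (isCDP n w (toℕ ∘ a)) ⇔ (∀ i → toℕ (a (sucCyc i)) ℕ.≤ toℕ (a i) ℕ.+ 1)
T-isCDP n w a = mk⇔
  (λ t i → ℕₚ.≤ᵇ⇒≤ _ _ (proj₂ (to (Boolₚ.T-∧ {toℕ (a i) <ᵇ w}) (toWitness t i))))
  (λ h → fromWitness (λ i → from Boolₚ.T-∧ (ℕₚ.<⇒<ᵇ (Finₚ.toℕ<n (a i)) , ℕₚ.≤⇒≤ᵇ (h i))))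

T-isCDP-cyclic : ∀ {n′} w (a : Fin (suc n′) → Fin w) →
  T (isCDP (suc n′) w (toℕ ∘ a)) ⇔ (∀ t → cyclic (toℕ ∘ a) (suc t) ℕ.≤ cyclic (toℕ ∘ a) t ℕ.+ 1)
T-isCDP-cyclic {n′} w a = mk⇔
  (λ c t → ≡.subst (ℕ._≤ cyclic (toℕ ∘ a) t ℕ.+ 1)
    (≡.trans (≡.cong (cyclic (toℕ ∘ a)) (ℕₚ.+-comm 1 _)) (≡.trans (cyclic-mod (toℕ ∘ a) t 1) (≡.cong (cyclic (toℕ ∘ a)) (ℕₚ.+-comm t 1))))
    (to (T-isCDP (suc n′) w a) c (t mod suc n′)))
  (λ h → from (T-isCDP (suc n′) w a) (λ i → ≡.subst (λ s → toℕ (a (sucCyc i)) ℕ.≤ s ℕ.+ 1) (cyclic-toℕ (toℕ ∘ a) i) (h (toℕ i))))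

T-eqSeq : ∀ {n} (a b : Fin n → ℕ) → T (eqSeq a b) ⇔ (∀ i → a i ≡ b i)
T-eqSeq a b = mk⇔ (λ t i → ℕₚ.≡ᵇ⇒≡ _ _ (toWitness t i)) (λ h → fromWitness (λ i → ℕₚ.≡⇒≡ᵇ _ _ (h i)))

module _ (n′ m′ w k : ℕ) (m≡gcd : suc m′ ≡ gcd (suc n′) k) (a : Fin (suc n′) → Fin w) (b : Fin (suc m′) → Fin w) where
  private
    n = suc n′
    m = suc m′
    A B : ℕ → ℕ
    A = cyclic (toℕ ∘ a)
    B = cyclic (toℕ ∘ b)

    B-periodic : ∀ {p} → m ∣ p → ∀ x t → B (t ℕ.+ x ℕ.* p) ≡ B t
    B-periodic (divides e ≡.refl) x t = ≡.trans
      (≡.cong (λ s → B (t ℕ.+ s)) (≡.sym (ℕₚ.*-assoc x e m))) (cyclic-+* (toℕ ∘ b) t (x ℕ.* e))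

    reduce-% : ∀ p .{{_ : ℕ.NonZero p}} (f : ℕ → ℕ) → (∀ x t → f (t ℕ.+ x ℕ.* p) ≡ f t) → ∀ t → f (t % p) ≡ f t
    reduce-% p f per t = ≡.trans (≡.sym (per (t / p) (t % p))) (≡.cong f (≡.sym (m≡m%n+[m/n]*n t p)))

    shift : ∀ t → t ℕ.+ k ℕ.+ k ℕ.* n′ ≡ t ℕ.+ k ℕ.* n
    shift t = ≡.trans (ℕₚ.+-assoc t k _) (≡.cong (t ℕ.+_) (≡.sym (ℕₚ.*-suc k n′)))

    m∣n : m ∣ n
    m∣n = ≡.subst (_∣ n) (≡.sym m≡gcd) (gcd[m,n]∣m n k)

    m∣k : m ∣ k
    m∣k = ≡.subst (_∣ k) (≡.sym m≡gcd) (gcd[m,n]∣n n k)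

  -- Sequences fixed by the k-th power of the shift are the n-periodic extensions of sequences of length gcd n k.
  fixed⇔extension :
    (isCDP n w (toℕ ∘ a) ∧ eqSeq (iter k α (toℕ ∘ a)) (toℕ ∘ a)) ∧ eqSeq (toℕ ∘ b) (A ∘ toℕ)
      ≡ isCDP m w (toℕ ∘ b) ∧ eqSeq (toℕ ∘ a) (B ∘ toℕ)
  fixed⇔extension = T-ext forward backward
    where
    forward : T ((isCDP n w (toℕ ∘ a) ∧ eqSeq (iter k α (toℕ ∘ a)) (toℕ ∘ a)) ∧ eqSeq (toℕ ∘ b) (A ∘ toℕ)) →
      T (isCDP m w (toℕ ∘ b) ∧ eqSeq (toℕ ∘ a) (B ∘ toℕ))
    forward h = from Boolₚ.T-∧
      ( from (T-isCDP-cyclic w b) (λ t → ≡.subst₂ (λ x y → x ℕ.≤ y ℕ.+ 1) (≡.sym (B≡A (suc t))) (≡.sym (B≡A t)) (cdp t))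
      , from (T-eqSeq _ _) (λ i → ≡.sym (≡.trans (B≡A (toℕ i)) (cyclic-toℕ (toℕ ∘ a) i))) )
      where
      split = to Boolₚ.T-∧ h
      split₁ = to (Boolₚ.T-∧ {isCDP n w (toℕ ∘ a)}) (proj₁ split)
      cdp = to (T-isCDP-cyclic w a) (proj₁ split₁)
      fixed = to (T-eqSeq (iter k α (toℕ ∘ a)) (toℕ ∘ a)) (proj₂ split₁)
      restricted = to (T-eqSeq (toℕ ∘ b) (A ∘ toℕ)) (proj₂ split)
      A-kn′ : ∀ t → A (t ℕ.+ k ℕ.* n′) ≡ A t
      A-kn′ t = ≡.trans (≡.sym (cyclic-mod (toℕ ∘ a) t (k ℕ.* n′)))
        (≡.trans (≡.sym (cyclic-α (toℕ ∘ a) k (t mod n))) (fixed (t mod n)))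
      -- Being fixed yields the period k n′, which is -k modulo n; the period k n turns it into the
      -- period k.
      A-k : ∀ t → A (t ℕ.+ k) ≡ A t
      A-k t = ≡.trans (≡.sym (A-kn′ (t ℕ.+ k))) (≡.trans (≡.cong A (shift t)) (cyclic-+* (toℕ ∘ a) t k))
      A-n : ∀ t → A (t ℕ.+ n) ≡ A t
      A-n t = ≡.trans (≡.cong (λ s → A (t ℕ.+ s)) (≡.sym (ℕₚ.*-identityˡ n))) (cyclic-+* (toℕ ∘ a) t 1)
      A-m : ∀ t → A (t ℕ.+ m) ≡ A t
      A-m t = ≡.trans (≡.cong (λ s → A (t ℕ.+ s)) m≡gcd) (periodic-gcd A n k A-n A-k t)
      B≡A : ∀ t → B t ≡ A t
      B≡A t = ≡.trans (restricted (t mod m)) (≡.trans (≡.cong A (toℕ-mod (toℕ ∘ b) t)) (reduce-% m A (periodic-* A m A-m) t))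
    backward : T (isCDP m w (toℕ ∘ b) ∧ eqSeq (toℕ ∘ a) (B ∘ toℕ)) →
      T ((isCDP n w (toℕ ∘ a) ∧ eqSeq (iter k α (toℕ ∘ a)) (toℕ ∘ a)) ∧ eqSeq (toℕ ∘ b) (A ∘ toℕ))
    backward h = from Boolₚ.T-∧
      ( from Boolₚ.T-∧
        ( from (T-isCDP-cyclic w a) (λ t → ≡.subst₂ (λ x y → x ℕ.≤ y ℕ.+ 1) (≡.sym (A≡B (suc t))) (≡.sym (A≡B t)) (cdp t))
        , from (T-eqSeq _ _) fixed )
      , from (T-eqSeq _ _) (λ i → ≡.trans (≡.sym (cyclic-toℕ (toℕ ∘ b) i)) (≡.sym (A≡B (toℕ i)))) )
      where
      split = to (Boolₚ.T-∧ {isCDP m w (toℕ ∘ b)}) h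
      cdp = to (T-isCDP-cyclic w b) (proj₁ split)
      extended = to (T-eqSeq (toℕ ∘ a) (B ∘ toℕ)) (proj₂ split)
      A≡B : ∀ t → A t ≡ B t
      A≡B t = ≡.trans (extended (t mod n)) (≡.trans (≡.cong B (toℕ-mod (toℕ ∘ a) t)) (reduce-% n B (B-periodic m∣n) t))
      fixed : ∀ i → iter k α (toℕ ∘ a) i ≡ toℕ (a i)
      fixed i = ≡.trans (cyclic-α (toℕ ∘ a) k i) (≡.trans (A≡B (toℕ i ℕ.+ k ℕ.* n′))
        (≡.trans (≡.cong (λ s → B (toℕ i ℕ.+ s)) (ℕₚ.*-comm k n′)) (≡.trans (B-periodic m∣k n′ (toℕ i)) (≡.sym (extended i)))))

-- The cyclic condition cut open at the first entry.

sucCyc-inject₁ : ∀ {n} (i : Fin n) → sucCyc (inject₁ i) ≡ fsuc i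
sucCyc-inject₁ {n} i = Finₚ.toℕ-injective (≡.trans (Finₚ.toℕ-fromℕ< (m%n<n (suc (toℕ (inject₁ i))) (suc n)))
  (≡.trans (≡.cong (λ t → suc t % suc n) (Finₚ.toℕ-inject₁ i)) (m<n⇒m%n≡m (ℕ.s≤s (Finₚ.toℕ<n i)))))

sucCyc-fromℕ : ∀ n → sucCyc (fromℕ n) ≡ fzero
sucCyc-fromℕ n = Finₚ.toℕ-injective (≡.trans (Finₚ.toℕ-fromℕ< (m%n<n (suc (toℕ (fromℕ n))) (suc n)))
  (≡.trans (≡.cong (λ t → suc t % suc n) (Finₚ.toℕ-fromℕ n)) (n%n≡0 (suc n))))

-- The entries `f` follow `x`, and `z` is the value to which the circle returns. The recursion is
-- that of `chains`, with bound suc x.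
closing : ∀ {n w} → ℕ → ℕ → (Fin n → Fin w) → Bool
closing {zero}  z x f = z ≤ᵇ suc x
closing {suc n} z x f = (toℕ (f fzero) ≤ᵇ suc x) ∧ closing z (toℕ (f fzero)) (f ∘ fsuc)

T-closing : ∀ {n w} z (g : Fin (suc n) → Fin w) → T (closing z (toℕ (g fzero)) (g ∘ fsuc)) ⇔
  ((∀ i → toℕ (g (fsuc i)) ℕ.≤ toℕ (g (inject₁ i)) ℕ.+ 1) × z ℕ.≤ toℕ (g (fromℕ n)) ℕ.+ 1)
T-closing {zero}  z g = mk⇔
  (λ t → (λ ()) , ℕₚ.≤-trans (ℕₚ.≤ᵇ⇒≤ z _ t) (ℕₚ.≤-reflexive (ℕₚ.+-comm 1 _)))
  (λ (_ , h) → ℕₚ.≤⇒≤ᵇ (ℕₚ.≤-trans h (ℕₚ.≤-reflexive (ℕₚ.+-comm _ 1))))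
T-closing {suc n} z g = mk⇔ forward backward
  where
  rec = T-closing z (g ∘ fsuc)
  forward : _ → _
  forward t = (λ { fzero    → ℕₚ.≤-trans (ℕₚ.≤ᵇ⇒≤ _ _ (proj₁ (to Boolₚ.T-∧ t))) (ℕₚ.≤-reflexive (ℕₚ.+-comm 1 _))
                 ; (fsuc i) → proj₁ (to rec (proj₂ (to (Boolₚ.T-∧ {toℕ (g (fsuc fzero)) ≤ᵇ _}) t))) i })
            , proj₂ (to rec (proj₂ (to (Boolₚ.T-∧ {toℕ (g (fsuc fzero)) ≤ᵇ _}) t)))
  backward : _ → _
  backward (h , e) = from Boolₚ.T-∧ (ℕₚ.≤⇒≤ᵇ (ℕₚ.≤-trans (h fzero) (ℕₚ.≤-reflexive (ℕₚ.+-comm _ 1)))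
                              , from rec ((λ i → h (fsuc i)) , e))

isCDP-closing : ∀ {n w} (g : Fin (suc n) → Fin w) →
  isCDP (suc n) w (toℕ ∘ g) ≡ closing (toℕ (g fzero)) (toℕ (g fzero)) (g ∘ fsuc)
isCDP-closing {n} {w} g = T-ext
  (λ t → let h = to (T-isCDP (suc n) w g) t in from (T-closing _ g)
    ( (λ i → ≡.subst (λ j → toℕ (g j) ℕ.≤ toℕ (g (inject₁ i)) ℕ.+ 1) (sucCyc-inject₁ i) (h (inject₁ i)))
    , ≡.subst (λ j → toℕ (g j) ℕ.≤ toℕ (g (fromℕ n)) ℕ.+ 1) (sucCyc-fromℕ n) (h (fromℕ n)) ))
  (λ t → from (T-isCDP (suc n) w g) (cyc (to (T-closing _ g) t)))
  where
  cyc : ((∀ i → toℕ (g (fsuc i)) ℕ.≤ toℕ (g (inject₁ i)) ℕ.+ 1) × toℕ (g fzero) ℕ.≤ toℕ (g (fromℕ n)) ℕ.+ 1) →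
    ∀ i → toℕ (g (sucCyc i)) ℕ.≤ toℕ (g i) ℕ.+ 1
  cyc (h , e) i with view i
  ... | ‵fromℕ     = ≡.subst (λ j → toℕ (g j) ℕ.≤ toℕ (g (fromℕ n)) ℕ.+ 1) (≡.sym (sucCyc-fromℕ n)) e
  ... | ‵inject₁ j = ≡.subst (λ l → toℕ (g l) ℕ.≤ toℕ (g (inject₁ j)) ℕ.+ 1) (≡.sym (sucCyc-inject₁ j)) (h j)

-- Counting the fixed sequences by closed chains.

module FixedPoints (R : CommutativeRing 0ℓ 0ℓ) (w : ℕ) where
  open CommutativeRing R hiding (zero)
  open RingBasics R
  open ListSums R
  open Chains R w
  open import Relation.Binary.Reasoning.Setoid setoid

  lsum-tabulate : ∀ {A : Set} n (φ : A → Carrier) (ψ : ℕ → Carrier) (f : Fin n → A) →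
    (∀ i → φ (f i) ≈ ψ (toℕ i)) → lsum φ (tabulate f) ≈ ∑ n ψ
  lsum-tabulate zero    φ ψ f e = refl
  lsum-tabulate (suc n) φ ψ f e = trans
    (+-cong (e fzero) (lsum-tabulate n φ (ψ ∘ suc) (f ∘ fsuc) (e ∘ fsuc))) (sym (∑-first n ψ))

  lsum-allFin : ∀ n (ψ : ℕ → Carrier) → lsum (ψ ∘ toℕ) (allFin n) ≈ ∑ n ψ
  lsum-allFin n ψ = lsum-tabulate n (ψ ∘ toℕ) ψ (λ i → i) (λ _ → refl)

  lsum-allFuns : ∀ n (φ : (Fin (suc n) → Fin w) → Carrier) →
    lsum φ (allFuns (suc n) w) ≈ lsum (λ x → lsum (λ f → φ (x ◂ f)) (allFuns n w)) (allFin w)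
  lsum-allFuns n φ = trans (lsum-concatMap φ _ (allFin w))
    (lsum-cong (allFin w) (λ x → lsum-map φ (x ◂_) (allFuns n w)))

  lsum-*ˡ : ∀ {A : Set} c (f : A → Carrier) xs → lsum (λ x → c * f x) xs ≈ c * lsum f xs
  lsum-*ˡ c f []       = sym (zeroʳ c)
  lsum-*ˡ c f (x ∷ xs) = trans (+-congˡ (lsum-*ˡ c f xs)) (sym (distribˡ _ _ _))

  lsum-0 : ∀ {A : Set} (xs : List A) → lsum (λ _ → 0#) xs ≈ 0#
  lsum-0 []       = refl
  lsum-0 (_ ∷ xs) = trans (+-identityˡ _) (lsum-0 xs)

  lsum-+ : ∀ {A : Set} (f g : A → Carrier) xs → lsum (λ x → f x + g x) xs ≈ lsum f xs + lsum g xs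
  lsum-+ f g []       = sym (+-identityˡ _)
  lsum-+ f g (x ∷ xs) = trans (+-congˡ (lsum-+ f g xs))
    (solve 4 (λ a b c d → (a :+ b) :+ (c :+ d) := (a :+ c) :+ (b :+ d)) refl _ _ _ _)

  lsum-swap : ∀ {A B : Set} (f : A → B → Carrier) xs ys →
    lsum (λ x → lsum (f x) ys) xs ≈ lsum (λ y → lsum (λ x → f x y) xs) ys
  lsum-swap f []       ys = sym (lsum-0 ys)
  lsum-swap f (x ∷ xs) ys = trans (+-congˡ (lsum-swap f xs ys)) (sym (lsum-+ (f x) (λ y → lsum (λ x → f x y) xs) ys))

  ∑-δ : ∀ n j → j ℕ.< n → ∑ n (λ i → ι (i ≡ᵇ j)) ≈ 1#
  ∑-δ (suc n) j j<1+n with j ℕₚ.≟ n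
  ... | yes ≡.refl = trans
    (+-cong (∑-0 n (λ i i<n → reflexive (≡.cong ι (≢⇒≡ᵇ-false i n (ℕₚ.<⇒≢ i<n))))) (reflexive (≡.cong ι (≡ᵇ-refl n))))
    (+-identityˡ _)
  ... | no j≢n = trans
    (+-cong (∑-δ n j (ℕₚ.≤∧≢⇒< (ℕ.s≤s⁻¹ j<1+n) j≢n)) (reflexive (≡.cong ι (≢⇒≡ᵇ-false n j (λ e → j≢n (≡.sym e))))))
    (+-identityʳ _)

  eqSeq-◂ : ∀ {n} x (f : Fin n → Fin w) (b : Fin (suc n) → ℕ) →
    eqSeq (toℕ ∘ (x ◂ f)) b ≡ (toℕ x ≡ᵇ b fzero) ∧ eqSeq (toℕ ∘ f) (b ∘ fsuc)
  eqSeq-◂ x f b = T-ext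
    (λ t → let h = to (T-eqSeq (toℕ ∘ (x ◂ f)) b) t in
      from Boolₚ.T-∧ (ℕₚ.≡⇒≡ᵇ _ _ (h fzero) , from (T-eqSeq (toℕ ∘ f) (b ∘ fsuc)) (h ∘ fsuc)))
    (λ t → let h = to (Boolₚ.T-∧ {toℕ x ≡ᵇ b fzero}) t in
      from (T-eqSeq (toℕ ∘ (x ◂ f)) b)
        (λ { fzero → ℕₚ.≡ᵇ⇒≡ _ _ (proj₁ h) ; (fsuc i) → to (T-eqSeq (toℕ ∘ f) (b ∘ fsuc)) (proj₂ h) i }))

  -- The list of functions is complete and free of repetitions up to pointwise equality. In this
  -- form it is a factor 1 that can be inserted into a sum or removed from it.
  allFuns-unique : ∀ n (b : Fin n → ℕ) → (∀ i → b i ℕ.< w) → lsum (λ a → ι (eqSeq (toℕ ∘ a) b)) (allFuns n w) ≈ 1#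
  allFuns-unique zero    b b<w = +-identityʳ _
  allFuns-unique (suc n) b b<w = begin
    lsum (λ a → ι (eqSeq (toℕ ∘ a) b)) (allFuns (suc n) w)
      ≈⟨ lsum-allFuns n _ ⟩
    lsum (λ x → lsum (λ f → ι (eqSeq (toℕ ∘ (x ◂ f)) b)) (allFuns n w)) (allFin w)
      ≈⟨ lsum-cong (allFin w) (λ x → trans
           (lsum-cong (allFuns n w) (λ f → trans (reflexive (≡.cong ι (eqSeq-◂ x f b))) (ι-∧ (toℕ x ≡ᵇ b fzero) _)))
           (lsum-*ˡ (ι (toℕ x ≡ᵇ b fzero)) _ (allFuns n w))) ⟩
    lsum (λ x → ι (toℕ x ≡ᵇ b fzero) * lsum (λ f → ι (eqSeq (toℕ ∘ f) (b ∘ fsuc))) (allFuns n w)) (allFin w)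
      ≈⟨ lsum-cong (allFin w) (λ x → trans (*-congˡ (allFuns-unique n (b ∘ fsuc) (b<w ∘ fsuc))) (*-identityʳ _)) ⟩
    lsum (λ x → ι (toℕ x ≡ᵇ b fzero)) (allFin w)
      ≈⟨ lsum-allFin w (λ i → ι (i ≡ᵇ b fzero)) ⟩
    ∑ w (λ i → ι (i ≡ᵇ b fzero))
      ≈⟨ ∑-δ w (b fzero) (b<w fzero) ⟩
    1# ∎

  closing-chains : ∀ n z x → lsum (λ f → ι (closing z x f)) (allFuns n w) ≈ chains n (suc x) z
  closing-chains zero    z x = +-identityʳ _
  closing-chains (suc n) z x = begin
    lsum (λ f → ι (closing z x f)) (allFuns (suc n) w)
      ≈⟨ lsum-allFuns n _ ⟩
    lsum (λ y → lsum (λ f → ι ((toℕ y ≤ᵇ suc x) ∧ closing z (toℕ y) f)) (allFuns n w)) (allFin w)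
      ≈⟨ lsum-cong (allFin w) (λ y → trans
           (lsum-cong (allFuns n w) (λ f → ι-∧ (toℕ y ≤ᵇ suc x) (closing z (toℕ y) f)))
           (trans (lsum-*ˡ (ι (toℕ y ≤ᵇ suc x)) _ (allFuns n w)) (*-congˡ (closing-chains n z (toℕ y))))) ⟩
    lsum (λ y → ι (toℕ y ≤ᵇ suc x) * chains n (suc (toℕ y)) z) (allFin w)
      ≈⟨ lsum-allFin w (λ y → ι (y ≤ᵇ suc x) * chains n (suc y) z) ⟩
    chains (suc n) (suc x) z ∎

  count-CDP : ∀ m′ → lsum (λ b → ι (isCDP (suc m′) w (toℕ ∘ b))) (allFuns (suc m′) w) ≈ closed-chains m′
  count-CDP m′ = begin
    lsum (λ b → ι (isCDP (suc m′) w (toℕ ∘ b))) (allFuns (suc m′) w)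
      ≈⟨ lsum-allFuns m′ _ ⟩
    lsum (λ x → lsum (λ f → ι (isCDP (suc m′) w (toℕ ∘ (x ◂ f)))) (allFuns m′ w)) (allFin w)
      ≈⟨ lsum-cong (allFin w) (λ x → trans
           (lsum-cong (allFuns m′ w) (λ f → reflexive (≡.cong ι (isCDP-closing (x ◂ f)))))
           (closing-chains m′ (toℕ x) (toℕ x))) ⟩
    lsum (λ x → chains m′ (suc (toℕ x)) (toℕ x)) (allFin w)
      ≈⟨ lsum-allFin w (λ z → chains m′ (suc z) z) ⟩
    closed-chains m′ ∎

  -- The bijection between fixed sequences of length n and sequences of length m is carried out as a
  -- double count of pairs (a, b). `fixed⇔extension` gives two descriptions of the same relation; in
  -- the first a determines b, in the second b determines a, both by `allFuns-unique`.
  fixCount-chains : ∀ n′ m′ k → suc m′ ≡ gcd (suc n′) k → natR R (fixCount (suc n′) w k) ≈ closed-chains m′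
  fixCount-chains n′ m′ k m≡gcd = begin
    natR R (fixCount n w k)
      ≈⟨ natR-length (filterᵇ fixed (CDP n w)) ⟩
    lsum (λ _ → 1#) (filterᵇ fixed (CDP n w))
      ≈⟨ trans (lsum-filter _ fixed (CDP n w)) (lsum-cong (CDP n w) (λ a → *-identityʳ _)) ⟩
    lsum (λ a → ι (fixed a)) (CDP n w)
      ≈⟨ trans (lsum-filter _ (isCDP n w) seqs) (lsum-map (λ a → ι (isCDP n w a) * ι (fixed a)) (toℕ ∘_) (allFuns n w)) ⟩
    lsum (λ a → ι (isCDP n w (toℕ ∘ a)) * ι (fixed (toℕ ∘ a))) (allFuns n w)
      ≈⟨ lsum-cong (allFuns n w) (λ a → sym (ι-∧ (isCDP n w (toℕ ∘ a)) _)) ⟩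
    lsum (λ a → ι (P a)) (allFuns n w)
      ≈⟨ lsum-cong (allFuns n w) (λ a → trans (sym (*-identityʳ _))
           (trans (*-congˡ (sym (allFuns-unique m (cyclic (toℕ ∘ a) ∘ toℕ) (λ i → Finₚ.toℕ<n _)))) (sym (lsum-*ˡ (ι (P a)) _ (allFuns m w))))) ⟩
    lsum (λ a → lsum (λ b → ι (P a) * ι (eqSeq (toℕ ∘ b) (cyclic (toℕ ∘ a) ∘ toℕ))) (allFuns m w)) (allFuns n w)
      ≈⟨ lsum-swap _ (allFuns n w) (allFuns m w) ⟩
    lsum (λ b → lsum (λ a → ι (P a) * ι (eqSeq (toℕ ∘ b) (cyclic (toℕ ∘ a) ∘ toℕ))) (allFuns n w)) (allFuns m w)
      ≈⟨ lsum-cong (allFuns m w) (λ b → trans (lsum-cong (allFuns n w) (λ a →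
           trans (sym (ι-∧ (P a) _)) (trans (reflexive (≡.cong ι (fixed⇔extension n′ m′ w k m≡gcd a b))) (ι-∧ (isCDP m w (toℕ ∘ b)) _))))
           (lsum-*ˡ (ι (isCDP m w (toℕ ∘ b))) _ (allFuns n w))) ⟩
    lsum (λ b → ι (isCDP m w (toℕ ∘ b)) * lsum (λ a → ι (eqSeq (toℕ ∘ a) (cyclic (toℕ ∘ b) ∘ toℕ))) (allFuns n w)) (allFuns m w)
      ≈⟨ lsum-cong (allFuns m w) (λ b → trans (*-congˡ (allFuns-unique n (cyclic (toℕ ∘ b) ∘ toℕ) (λ i → Finₚ.toℕ<n _))) (*-identityʳ _)) ⟩
    lsum (λ b → ι (isCDP m w (toℕ ∘ b))) (allFuns m w)
      ≈⟨ count-CDP m′ ⟩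
    closed-chains m′ ∎
    where
    n = suc n′
    m = suc m′
    seqs : List (Fin n → ℕ)
    seqs = map (toℕ ∘_) (allFuns n w)
    fixed : (Fin n → ℕ) → Bool
    fixed a = eqSeq (iter k α a) a
    P : (Fin n → Fin w) → Bool
    P a = isCDP n w (toℕ ∘ a) ∧ fixed (toℕ ∘ a)

theorem4p1 : (n w : ℕ) → 1 ≤ n → 1 ≤ w →
    (R : CommutativeRing 0ℓ 0ℓ) → IsIntDomainChar0 R →
    (ω : CommutativeRing.Carrier R) → IsPrimitiveRoot R n ω →
    (k : ℕ) → 1 ≤ k → k ≤ n →
    CommutativeRing._≈_ R (evalExps R (qExps n w) (pow R ω k)) (natR R (fixCount n w k))
theorem4p1 (suc n′) w _ _ R (domain , _) ω (ωⁿ≈1 , ω-prim) k 1≤k k≤n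
  with gcd (suc n′) k in gcd≡ | gcd[m,n]∣m (suc n′) k | gcd[m,n]∣n (suc n′) k | Bézout.identity (gcd-GCD (suc n′) k)
... | zero   | divides d n≡dm | _ | _ = ⊥-elim (ℕₚ.1+n≢0 (≡.trans n≡dm (ℕₚ.*-zeroʳ d)))
... | suc m′ | divides zero n≡dm | _ | _ = ⊥-elim (ℕₚ.1+n≢0 n≡dm)
-- Here m = gcd n k, and d = n / m is the exact order of ω^k.
... | suc m′ | divides (suc d′) n≡dm | divides e k≡em | bézout = begin
  evalExps R (qExps n w) (ω ^ k)
    ≈⟨ evalExps-root domain (ω ^ k) d′ m′ n w (≡.trans n≡dm (ℕₚ.*-comm d m)) zᵈ≈1 z-prim ⟩
  evalExps R (qExps m w) 1#
    ≈⟨ evalExps-1 m′ ⟩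
  closed-chains m′
    ≈⟨ fixCount-chains n′ m′ k (≡.sym gcd≡) ⟨
  natR R (fixCount n w k) ∎
  where
  open CommutativeRing R hiding (zero)
  open RingBasics R
  open Evaluation R
  open Chains R w
  open FixedPoints R w
  open import Relation.Binary.Reasoning.Setoid setoid
  n = suc n′
  m = suc m′
  d = suc d′

  zᵈ≈1 : (ω ^ k) ^ d ≈ 1#
  zᵈ≈1 = trans (sym (^-* ω d k)) (trans (^-congʳ ω dk≡en) (^-*-1 ω e n ωⁿ≈1))
    where
    dk≡en : d ℕ.* k ≡ e ℕ.* n
    dk≡en = ≡.trans (≡.cong (d ℕ.*_) k≡em) (≡.trans (≡.sym (ℕₚ.*-assoc d e m))
      (≡.trans (≡.cong (ℕ._* m) (ℕₚ.*-comm d e)) (≡.trans (ℕₚ.*-assoc e d m) (≡.cong (e ℕ.*_) (≡.sym n≡dm)))))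

  -- Bézout writes m as a difference of a multiple of n and a multiple of k, in one order or the
  -- other; both multiples, times j, are exponents at which ω gives 1.
  ω^jm≈1 : ∀ j → ω ^ (j ℕ.* k) ≈ 1# → ω ^ (j ℕ.* m) ≈ 1#
  ω^jm≈1 j ω^jk≈1 = absorbed bézout
    where
    kill : ∀ i y → ω ^ (j ℕ.* i) ≈ 1# → ω ^ (j ℕ.* (y ℕ.* i)) ≈ 1#
    kill i y e = trans (^-congʳ ω (≡.trans (≡.sym (ℕₚ.*-assoc j y i)) (≡.trans (≡.cong (ℕ._* i) (ℕₚ.*-comm j y)) (ℕₚ.*-assoc y j i)))) (^-*-1 ω y (j ℕ.* i) e)
    ω^jn≈1 = ^-*-1 ω j n ωⁿ≈1
    cancelled : ∀ s t → m ℕ.+ s ≡ t → ω ^ (j ℕ.* s) ≈ 1# → ω ^ (j ℕ.* t) ≈ 1# → ω ^ (j ℕ.* m) ≈ 1#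
    cancelled s t m+s≡t es et = begin
      ω ^ (j ℕ.* m)                    ≈⟨ *-identityʳ _ ⟨
      ω ^ (j ℕ.* m) * 1#               ≈⟨ *-congˡ es ⟨
      ω ^ (j ℕ.* m) * ω ^ (j ℕ.* s)    ≈⟨ ^-+ ω (j ℕ.* m) (j ℕ.* s) ⟨
      ω ^ (j ℕ.* m ℕ.+ j ℕ.* s)        ≈⟨ ^-congʳ ω (≡.trans (≡.sym (ℕₚ.*-distribˡ-+ j m s)) (≡.cong (j ℕ.*_) m+s≡t)) ⟩
      ω ^ (j ℕ.* t)                    ≈⟨ et ⟩
      1#                               ∎
    absorbed : Bézout.Identity m n k → ω ^ (j ℕ.* m) ≈ 1#
    absorbed (Bézout.+- x y eq) = cancelled (y ℕ.* k) (x ℕ.* n) eq (kill k y ω^jk≈1) (kill n x ω^jn≈1)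
    absorbed (Bézout.-+ x y eq) = cancelled (x ℕ.* n) (y ℕ.* k) eq (kill n x ω^jn≈1) (kill k y ω^jk≈1)

  -- A smaller order would give ω^((s+1)m) = 1 with 0 < (s+1)m < n, against primitivity of ω.
  z-prim : ∀ s → s ℕ.< d′ → ¬ (ω ^ k) ^ suc s ≈ 1#
  z-prim s s<d′ zˢ≈1 = ω-prim (suc s ℕ.* m) (ℕ.s≤s ℕ.z≤n)
    (ℕₚ.<-≤-trans (ℕₚ.*-monoˡ-< m (ℕ.s≤s s<d′)) (ℕₚ.≤-reflexive (≡.sym n≡dm)))
    (ω^jm≈1 (suc s) (trans (^-* ω (suc s) k) zˢ≈1))
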